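{- Let $t\ge2$, $N=t+2$, $\lambda$ a partition with at most $N$ parts, and $\Phi_t(\lambda;z)=s_\lambda(1,\zeta,\dots,\zeta^{t-1},z,z^{ -1})$ with $\zeta=e^{2\pi i/t}$. Then $\Phi_t(\lambda;z)\equiv0$ (identically in $z$) if and only if some residue class modulo $t$ contains no element of $\beta(\lambda)$, or (no class being empty) $a_1+a_2=b_1+b_2$. In particular, if one residue class contains exactly three elements of $\beta(\lambda)$ and every other class exactly one, then $\Phi_t(\lambda;z)\not\equiv0$.
   Context: For $\lambda=(\lambda_1\ge\dots\ge\lambda_N\ge0)$ the beta set is $\beta(\lambda)=\{\beta_1>\dots>\beta_N\ge0\}$ with $\beta_j=\lambda_j+N-j$. Let $n_i$ be the number of $\beta_j\equiv i\pmod t$, so $\sum_{i=0}^{t-1}n_i=t+2$. If no class is empty, then either exactly two classes have $n_i=2$ (all others $1$), or exactly one has $n_i=3$ (all others $1$). In the first case let $r_A<r_B$ be the residues of the two classes of size two and let $A=\{a_1>a_2\}$, $B=\{b_1>b_2\}$ be the elements of $\beta(\lambda)$ in classes $r_A$, $r_B$. In the second case, if the class of size three is $\{p>q>r\}$, let $A=\{a_1>a_2\}=\{p,q\}$ and $B=\{b_1>b_2\}=\{q,r\}$. $s_\lambda$ denotes the Schur polynomial. -}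

module Defs where

open import Algebra.Apartness.Bundles using (HeytingField; HeytingCommutativeRing)
open import Algebra.Bundles using (CommutativeRing; Semiring)
import Algebra.Definitions.RawSemiring as RawSemiringDefs
open import Data.Fin.Base as Fin using (Fin; toℕ)
open import Data.Fin.Properties as Fin using ()
open import Data.List.Base as List
  using (List; []; _∷_; length; map; filter; foldr; replicate; concat; allFin; cartesianProductWith)
open import Data.List.Relation.Binary.Prefix.Heterogeneous using (Prefix)
open import Data.List.Relation.Binary.Prefix.Heterogeneous.Properties using (prefix?)
open import Data.List.Relation.Unary.All using (All; all?)
open import Data.List.Relation.Unary.Linked using (Linked; linked?)
open import Data.Nat.Base as ℕ using (ℕ; suc; _∸_; _%_; NonZero)
open import Data.Nat.Properties as ℕ using ()
open import Data.Product.Base using (_×_)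
open import Data.Vec.Functional as Vector using (Vector)
open import Function.Base using (flip)
open import Level using (Level; _⊔_)
open import Relation.Binary.Core using (_Preserves_⟶_)
open import Relation.Binary.PropositionalEquality using (_≡_; _≢_)
open import Relation.Nullary.Decidable using (Dec; _×-dec_)

private variable
  a c ℓ ℓ₁ ℓ₂ : Level
  A : Set a
  n : ℕ

-- Partitions with at most n parts, padded with zeros to length n.
IsPartition : Vector ℕ n → Set
IsPartition lam = lam Preserves Fin._≤_ ⟶ ℕ._≥_

-- Schur polynomials, as sums over semistandard Young tableaux.  A filling is
-- the list of its rows, from top to bottom (English notation).

Filling : ℕ → Set
Filling n = List (List (Fin n))

-- Rows weakly increase from left to right.  The `Prefix` condition says that
-- each row is no longer than the row above it and that every entry is
-- strictly larger than the entry directly above it.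
IsSemistandard : Filling n → Set
IsSemistandard T = All (Linked Fin._≤_) T × Linked (flip (Prefix Fin._>_)) T

isSemistandard? : (T : Filling n) → Dec (IsSemistandard T)
isSemistandard? T =
  all? (linked? Fin._≤?_) T ×-dec linked? (flip (prefix? (flip Fin._<?_))) T

-- All lists with one entry taken from each of the given lists.
choices : List (List A) → List (List A)
choices []         = [] ∷ []
choices (xs ∷ xss) = cartesianProductWith _∷_ xs (choices xss)

fillings : Vector ℕ n → List (Filling n)
fillings {n} lam = choices (map (λ m → choices (replicate m (allFin n))) (Vector.toList lam))

tableaux : Vector ℕ n → List (Filling n)
tableaux lam = filter isSemistandard? (fillings lam)

module _ (R : CommutativeRing c ℓ) where
  open CommutativeRing R using (Carrier; _+_; _*_; 0#; 1#)

  -- The monomial of a tableau, evaluated at x.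
  weight : Vector Carrier n → Filling n → Carrier
  weight x T = foldr _*_ 1# (map x (concat T))

  -- The value at x of the Schur polynomial of lam in n variables.
  schur : Vector ℕ n → Vector Carrier n → Carrier
  schur lam x = foldr _+_ 0# (map (weight x) (tableaux lam))

-- Indices start at 0, so the exponent shift of the entry with index j is
-- n - 1 - j.  For a partition the list is strictly decreasing.
beta : Vector ℕ n → List ℕ
beta {n} lam = List.tabulate (λ j → lam j ℕ.+ (n ∸ suc (toℕ j)))

module _ (t : ℕ) .{{_ : NonZero t}} where

  -- The elements of the beta set congruent to r modulo t, in decreasing order.
  residueClass : Vector ℕ n → Fin t → List ℕ
  residueClass lam r = filter (λ b → b % t ℕ.≟ toℕ r) (beta lam)

  -- Exactly one residue class has three elements, all the others have one.
  OneTriple : Vector ℕ n → Fin t → Set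
  OneTriple lam r =
    length (residueClass lam r) ≡ 3 ×
    (∀ s → s ≢ r → length (residueClass lam s) ≡ 1)

  -- `Pairs lam a₁ a₂ b₁ b₂` states that A = {a₁ > a₂} and B = {b₁ > b₂} are the
  -- two pairs attached to lam.
  data Pairs (lam : Vector ℕ n) : (a₁ a₂ b₁ b₂ : ℕ) → Set where
    twoDoubles : ∀ {a₁ a₂ b₁ b₂} (rA rB : Fin t) → rA Fin.< rB →
                 residueClass lam rA ≡ a₁ ∷ a₂ ∷ [] →
                 residueClass lam rB ≡ b₁ ∷ b₂ ∷ [] →
                 (∀ s → s ≢ rA → s ≢ rB → length (residueClass lam s) ≡ 1) →
                 Pairs lam a₁ a₂ b₁ b₂
    oneTriple  : ∀ {p q r} (s : Fin t) → OneTriple lam s →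
                 residueClass lam s ≡ p ∷ q ∷ r ∷ [] →
                 Pairs lam p q q r

-- The library has no complex numbers.  ℂ with ζ = e^(2πi/t) is replaced by any
-- field of characteristic zero with a primitive t-th root of unity ζ.  Heyting
-- fields need not have decidable equality, so ℂ is an instance constructively.
module _ (K : HeytingField c ℓ₁ ℓ₂) where
  open HeytingField K

  private
    R : CommutativeRing c ℓ₁
    R = HeytingCommutativeRing.commutativeRing heytingCommutativeRing

  open RawSemiringDefs (Semiring.rawSemiring (CommutativeRing.semiring R)) using (_^_) renaming (_×_ to _·_)

  CharacteristicZero : Set ℓ₂
  CharacteristicZero = ∀ m → suc m · 1# # 0#

  record IsPrimitiveRoot (t : ℕ) (ζ : Carrier) : Set (ℓ₁ ⊔ ℓ₂) where
    field
      ζ^t≈1 : ζ ^ t ≈ 1#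
      ζ^k#1 : ∀ k → 0 ℕ.< k → k ℕ.< t → ζ ^ k # 1#

  -- (1, ζ, …, ζ^(t-1), z, z⁻¹), with the inverse of z passed as w.
  point : (t : ℕ) (ζ z w : Carrier) → Vector Carrier (t ℕ.+ 2)
  point t ζ z w = (λ (k : Fin t) → ζ ^ toℕ k) Vector.++ (z Vector.∷ w Vector.∷ Vector.[])

  Φ : (t : ℕ) (ζ : Carrier) (lam : Vector ℕ (t ℕ.+ 2)) (z w : Carrier) → Carrier
  Φ t ζ lam z w = schur R lam (point t ζ z w)

  -- Vanishing at every unit z.  Over a field of characteristic zero, which is
  -- infinite, this is vanishing as a Laurent polynomial in z.
  VanishesIdentically : (t : ℕ) (ζ : Carrier) (lam : Vector ℕ (t ℕ.+ 2)) → Set (c ⊔ ℓ₁)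
  VanishesIdentically t ζ lam = ∀ z w → z * w ≈ 1# → Φ t ζ lam z w ≈ 0#

{-# OPTIONS --safe #-}
-- By the bialternant formula, Φ_t(λ; z) times a Vandermonde determinant is the
-- alternant with exponents β(λ) at the point (1, ζ, …, ζ^(t-1), z, z⁻¹).  The
-- formula holds because both sides satisfy the same branching rule when the last
-- variable y is split off: on tableaux by removing the largest letter, on
-- alternants by subtracting from each column a multiple of the next one.
--
-- In the rows 1, ζ, …, ζ^(t-1) a column depends only on its exponent modulo t.  If
-- the class of r is empty, then Σ_k ζ^(-kr) (row of ζ^k) is zero, and the alternant
-- vanishes.  Otherwise the column a₁ minus the column a₂, and likewise b₁ minus b₂,
-- is zero outside the rows z and z⁻¹.  This leaves a 2 × 2 determinant, which is
-- (z^(a₁-a₂) - 1) (z^(b₁-b₂) - 1) (z^(a₁+a₂) - z^(b₁+b₂)) up to a power of z, times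
-- the alternant of a complete system of residues at the powers of ζ, which is
-- invertible.
--
-- The Vandermonde determinant is invertible at the integers z = 2, 3, …, and a
-- Laurent polynomial is determined by its values there.
module Submission where

open import Algebra.Apartness.Bundles using (HeytingField; HeytingCommutativeRing)
open import Algebra.Bundles using (CommutativeRing; RawRing)
import Algebra.Properties.CommutativeMonoid.Sum as CommutativeMonoidSum
import Algebra.Properties.CommutativeSemiring.Exp as CommutativeSemiringExp
import Algebra.Properties.Ring as RingProperties
import Algebra.Properties.Semiring.Exp as SemiringExp
import Algebra.Properties.Semiring.Mult as SemiringMult
import Algebra.Solver.Ring as RingSolver
open import Algebra.Solver.Ring.AlmostCommutativeRing
  using (fromCommutativeRing; module AlmostCommutativeRing; _-Raw-AlmostCommutative⟶_)
open import Data.Bool.Base using (Bool; true; false; _∧_; if_then_else_)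
import Data.Bool.Properties as Bool
open import Data.Fin.Base as Fin using (Fin; toℕ; inject₁; fromℕ; fromℕ<; splitAt)
import Data.Fin.Properties as Fin
open import Data.List.Base as List
  using (List; []; _∷_; _++_; map; foldl; foldr; upTo; [_]; length; filter; allFin; replicate;
      concat; cartesianProductWith; downFrom; applyUpTo)
open import Data.List.Membership.Propositional using (_∈_)
import Data.List.Membership.Propositional.Properties as ∈
import Data.List.Properties as List
open import Data.List.Relation.Binary.Permutation.Propositional as ↭
  using (_↭_; ↭-sym; ↭-trans; ↭-reflexive)
import Data.List.Relation.Binary.Permutation.Propositional.Properties as ↭
open import Data.List.Relation.Binary.Pointwise as Pointwise using (Pointwise; []; _∷_)
open import Data.List.Relation.Binary.Prefix.Heterogeneous.Properties using (prefix?)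
open import Data.List.Relation.Unary.All as All using (All; []; _∷_; all?)
import Data.List.Relation.Unary.All.Properties as All
open import Data.List.Relation.Unary.AllPairs as AllPairs using (AllPairs; []; _∷_)
import Data.List.Relation.Unary.AllPairs.Properties as AllPairs
open import Data.List.Relation.Unary.Any using (here; there)
open import Data.List.Relation.Unary.Linked as Linked using (Linked; []; [-]; _∷_; linked?)
import Data.List.Relation.Unary.Linked.Properties as Linked
import Data.Maybe.Base as Maybe
open import Data.Nat.Base as ℕ using (ℕ; zero; suc; _∸_; _≤ᵇ_; _<ᵇ_; _%_; NonZero)
import Data.Nat.DivMod as ℕ
import Data.Nat.Properties as ℕ
open import Data.Product.Base using (_×_; _,_; ∃-syntax; proj₁; proj₂)
open import Data.Sum.Base using (_⊎_; inj₁; inj₂; [_,_])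
import Data.Sum.Properties as Sum
open import Data.Vec.Functional as Vector using (Vector)
open import Defs
open import Function.Base using (_∘_; id; flip)
open import Function.Bundles using (_⇔_; mk⇔)
open import Level using (0ℓ; _⊔_; Level)
open import Relation.Binary.Definitions using (tri<; tri≈; tri>)
open import Relation.Binary.PropositionalEquality as ≡ using (_≡_; _≢_)
import Relation.Binary.Reasoning.Setoid as SetoidReasoning
open import Relation.Nullary.Decidable using (dec⇒maybe; does; dec-true; dec-false; yes; no; ¬?)
open import Relation.Nullary.Negation using (¬_; contradiction)
open import Relation.Unary using (Decidable)

-- Equality in a Heyting field is undecidable, so apartness is turned into invertibility once, and
-- all preparations take place over commutative rings. Nonzero becomes "is a unit", and
-- non-vanishing becomes the statement that vanishing would make 0 a unit. The criterion itself
-- concerns natural numbers and is decidable, which permits a proof by contradiction in the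
-- necessary direction.
--
-- Determinants are iterated Laplace contractions acting on lists of columns, a column being a
-- function of the row variable. Rows are split off one at a time, and column operations are
-- pointwise identities.
--
-- The bialternant formula says nothing about s_λ where the Vandermonde determinant vanishes, for
-- example at z = 1, whereas every unit z has to be treated; hence the detour through Laurent
-- polynomials. Integers z ≥ 2 are good test points because distinct powers of z are distinct
-- integers: their differences are units in characteristic zero, and the factors in z and w that
-- have to be inverted divide such differences. For non-vanishing the single value z = 2 is enough.

-- Ring identities with integer coefficients

-- The pair (m , n) stands for the integer m - n.  Coefficients in R itself would
-- not cancel, since equality in R is not decidable.
module IntegerSolver {c ℓ} (R : CommutativeRing c ℓ) where
  open CommutativeRing R
  open RingProperties ring using (-‿distribˡ-*; -‿distribʳ-*; -0#≈0#; -‿involutive)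
  open SemiringMult semiring using (×-homo-+; ×1-homo-*) renaming (_×_ to _·_)
  open SetoidReasoning setoid

  private
    differences : RawRing 0ℓ 0ℓ
    differences = record
      { Carrier = ℕ × ℕ
      ; _≈_     = _≡_
      ; _+_     = λ (a , b) (c , d) → a ℕ.+ c , b ℕ.+ d
      ; _*_     = λ (a , b) (c , d) → a ℕ.* c ℕ.+ b ℕ.* d , a ℕ.* d ℕ.+ b ℕ.* c
      ; -_      = λ (a , b) → b , a
      ; 0#      = 0 , 0
      ; 1#      = 1 , 0
      }

    ⟦_⟧ : ℕ × ℕ → Carrier
    ⟦ a , b ⟧ = a · 1# - b · 1#

    middleFour : ∀ p q r s → (p + q) + (r + s) ≈ (p + r) + (q + s)
    middleFour p q r s = begin
      (p + q) + (r + s) ≈⟨ +-assoc p q (r + s) ⟩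
      p + (q + (r + s)) ≈⟨ +-congˡ (trans (sym (+-assoc q r s)) (trans (+-congʳ (+-comm q r))
          (+-assoc r q s))) ⟩
      p + (r + (q + s)) ≈⟨ +-assoc p r (q + s) ⟨
      (p + r) + (q + s) ∎

    -‿+ : ∀ p q → - (p + q) ≈ - p - q
    -‿+ p q = sym (AlmostCommutativeRing.-‿+-comm (fromCommutativeRing R) p q)

    +-homo : ∀ a b c d → (a ℕ.+ c) · 1# - (b ℕ.+ d) · 1# ≈ ⟦ a , b ⟧ + ⟦ c , d ⟧
    +-homo a b c d = begin
      (a ℕ.+ c) · 1# - (b ℕ.+ d) · 1#
        ≈⟨ +-cong (×-homo-+ 1# a c) (trans (-‿cong (×-homo-+ 1# b d)) (-‿+ _ _)) ⟩
      (a · 1# + c · 1#) + (- (b · 1#) - d · 1#)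
        ≈⟨ middleFour _ _ _ _ ⟩
      ⟦ a , b ⟧ + ⟦ c , d ⟧ ∎

    *-homo : ∀ a b c d →
      (a ℕ.* c ℕ.+ b ℕ.* d) · 1# - (a ℕ.* d ℕ.+ b ℕ.* c) · 1# ≈ ⟦ a , b ⟧ * ⟦ c , d ⟧
    *-homo a b c d = begin
      (a ℕ.* c ℕ.+ b ℕ.* d) · 1# - (a ℕ.* d ℕ.+ b ℕ.* c) · 1#
        ≈⟨ +-homo (a ℕ.* c) (a ℕ.* d) (b ℕ.* d) (b ℕ.* c) ⟩
      ((a ℕ.* c) · 1# - (a ℕ.* d) · 1#) + ((b ℕ.* d) · 1# - (b ℕ.* c) · 1#)
        ≈⟨ +-cong (+-cong (×1-homo-* a c) (trans (-‿cong (×1-homo-* a d)) (-‿distribʳ-* _ _)))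
                  (trans (+-cong (trans (×1-homo-* b d) (trans (*-congˡ (sym (-‿involutive _)))
                      (sym (-‿distribʳ-* _ _))))
                                  (-‿cong (×1-homo-* b c)))
                         (trans (+-comm _ _) (+-cong (-‿distribˡ-* _ _) (-‿distribˡ-* _ _)))) ⟩
      (A * C + A * (- D)) + ((- B) * C + (- B) * (- D))
        ≈⟨ +-cong (distribˡ _ _ _) (distribˡ _ _ _) ⟨
      A * (C - D) + (- B) * (C - D)
        ≈⟨ distribʳ _ _ _ ⟨
      ⟦ a , b ⟧ * ⟦ c , d ⟧ ∎
      where
      A = a · 1#
      B = b · 1#
      C = c · 1#
      D = d · 1#

    -‿homo : ∀ a b → b · 1# - a · 1# ≈ - ⟦ a , b ⟧
    -‿homo a b = begin
      b · 1# - a · 1#       ≈⟨ +-comm _ _ ⟩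
      - (a · 1#) + b · 1#   ≈⟨ +-congˡ (-‿involutive _) ⟨
      - (a · 1#) - - (b · 1#) ≈⟨ -‿+ _ _ ⟨
      - ⟦ a , b ⟧           ∎

    morphism : differences -Raw-AlmostCommutative⟶ fromCommutativeRing R
    morphism = record
      { ⟦_⟧    = ⟦_⟧
      ; +-homo = λ (a , b) (c , d) → +-homo a b c d
      ; *-homo = λ (a , b) (c , d) → *-homo a b c d
      ; -‿homo = λ (a , b) → -‿homo a b
      ; 0-homo = -‿inverseʳ 0#
      ; 1-homo = trans (+-cong (+-identityʳ 1#) -0#≈0#) (+-identityʳ 1#)
      }

    cross : ∀ a b c d → a ℕ.+ d ≡ c ℕ.+ b → ⟦ a , b ⟧ ≈ ⟦ c , d ⟧
    cross a b c d eq = begin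
      A - B               ≈⟨ +-identityʳ _ ⟨
      (A - B) + 0#        ≈⟨ +-congˡ (-‿inverseʳ D) ⟨
      (A - B) + (D - D)   ≈⟨ middleFour _ _ _ _ ⟩
      (A + D) + (- B - D) ≈⟨ +-cong (trans (sym (×-homo-+ 1# a d))
          (trans (reflexive (≡.cong (_· 1#) eq)) (×-homo-+ 1# c b))) (+-comm _ _) ⟩
      (C + B) + (- D - B) ≈⟨ middleFour _ _ _ _ ⟩
      (C - D) + (B - B)   ≈⟨ +-congˡ (-‿inverseʳ B) ⟩
      (C - D) + 0#        ≈⟨ +-identityʳ _ ⟩
      C - D               ∎
      where
      A = a · 1#
      B = b · 1#
      C = c · 1#
      D = d · 1#

  open RingSolver differences (fromCommutativeRing R) morphism
    (λ (a , b) (c , d) → Maybe.map (cross a b c d) (dec⇒maybe (a ℕ.+ d ℕ.≟ c ℕ.+ b)))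
    public using (solve; _:=_; _:+_; _:*_; _:-_; :-_)

module RingFacts {c ℓ} (R : CommutativeRing c ℓ) where
  open CommutativeRing R
  open RingProperties ring

  x-0≈x : ∀ x → x - 0# ≈ x
  x-0≈x x = trans (+-congˡ -0#≈0#) (+-identityʳ x)

  0-x≈-x : ∀ x → 0# - x ≈ - x
  0-x≈-x x = +-identityˡ (- x)

  infix 4 _≈±_
  _≈±_ : Carrier → Carrier → Set ℓ
  x ≈± y = x ≈ y ⊎ x ≈ - y

  ≈±-trans : ∀ {x y z} → x ≈± y → y ≈± z → x ≈± z
  ≈±-trans (inj₁ e) (inj₁ f) = inj₁ (trans e f)
  ≈±-trans (inj₁ e) (inj₂ f) = inj₂ (trans e f)
  ≈±-trans (inj₂ e) (inj₁ f) = inj₂ (trans e (-‿cong f))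
  ≈±-trans (inj₂ e) (inj₂ f) = inj₁ (trans e (trans (-‿cong f) (-‿involutive _)))

-- Laplace expansion on lists of columns

module Contraction {c ℓ} (R : CommutativeRing c ℓ) where
  open CommutativeRing R
  open RingProperties ring
  open RingFacts R
  open IntegerSolver R
  open SetoidReasoning setoid

  private variable
    a p : Level
    C : Set a
    P : C → Set p

  -- Laplace expansion along the row φ, where F is the determinant of the other
  -- rows as a function of the list of columns.
  expand : (C → Carrier) → (List C → Carrier) → List C → Carrier
  expand φ F []       = 0#
  expand φ F (c ∷ cs) = φ c * F cs - expand φ (F ∘ (c ∷_)) cs

  empty : List C → Carrier
  empty []      = 1#
  empty (_ ∷ _) = 0#

  expand-cong : ∀ {φ ψ : C → Carrier} {F G} → (∀ c → φ c ≈ ψ c) → (∀ cs → F cs ≈ G cs) →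
                ∀ cs → expand φ F cs ≈ expand ψ G cs
  expand-cong φ≈ψ F≈G []       = refl
  expand-cong φ≈ψ F≈G (c ∷ cs) =
    +-cong (*-cong (φ≈ψ c) (F≈G cs)) (-‿cong (expand-cong φ≈ψ (F≈G ∘ (c ∷_)) cs))

  -- The condition `P` is on single columns, so it passes to every sublist on which `F` is
  -- evaluated. A linear relation among inner rows thus survives further expansions.
  expand-vanishes : ∀ {φ : C → Carrier} {F} → (∀ cs → All P cs → F cs ≈ 0#) →
                    ∀ cs → All P cs → expand φ F cs ≈ 0#
  expand-vanishes F≈0 []       []         = refl
  expand-vanishes {φ = φ} {F} F≈0 (c ∷ cs) (pc ∷ pcs) = begin
    φ c * F cs - expand φ (F ∘ (c ∷_)) cs
      ≈⟨ +-cong (trans (*-congˡ (F≈0 cs pcs)) (zeroʳ _))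
                (-‿cong (expand-vanishes (λ ds pds → F≈0 (c ∷ ds) (pc ∷ pds)) cs pcs)) ⟩
    0# - 0#  ≈⟨ -‿inverseʳ 0# ⟩
    0#       ∎

  expand-zero : ∀ {φ : C → Carrier} {F} → (∀ cs → F cs ≈ 0#) → ∀ cs → expand φ F cs ≈ 0#
  expand-zero {φ = φ} {F} F≈0 cs =
    expand-vanishes {P = λ _ → CommutativeRing.Carrier R} (λ cs _ → F≈0 cs) cs
        (All.universal (λ _ → 0#) cs)

  expand-row-zero : ∀ {φ : C → Carrier} {F} cs → All (λ c → φ c ≈ 0#) cs → expand φ F cs ≈ 0#
  expand-row-zero []       []           = refl
  expand-row-zero {φ = φ} {F} (c ∷ cs) (φc≈0 ∷ φ≈0) = begin
    φ c * F cs - expand φ (F ∘ (c ∷_)) cs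
      ≈⟨ +-cong (trans (*-congʳ φc≈0) (zeroˡ _)) (-‿cong (expand-row-zero cs φ≈0)) ⟩
    0# - 0#  ≈⟨ -‿inverseʳ 0# ⟩
    0#       ∎

  expand-row-linear : ∀ k {φ ψ : C → Carrier} {F} cs →
    expand (λ c → k * φ c + ψ c) F cs ≈ k * expand φ F cs + expand ψ F cs
  expand-row-linear k []       = sym (trans (+-identityʳ _) (zeroʳ k))
  expand-row-linear k {φ} {ψ} {F} (c ∷ cs) = begin
    (k * φ c + ψ c) * F cs - expand (λ d → k * φ d + ψ d) (F ∘ (c ∷_)) cs
      ≈⟨ +-congˡ (-‿cong (expand-row-linear k cs)) ⟩
    (k * φ c + ψ c) * F cs - (k * expand φ (F ∘ (c ∷_)) cs + expand ψ (F ∘ (c ∷_)) cs)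
      ≈⟨ solve 6 (λ k u v f x y → (k :* u :+ v) :* f :- (k :* x :+ y)
                                 := k :* (u :* f :- x) :+ (v :* f :- y)) refl
           k (φ c) (ψ c) (F cs) (expand φ (F ∘ (c ∷_)) cs) (expand ψ (F ∘ (c ∷_)) cs) ⟩
    k * (φ c * F cs - expand φ (F ∘ (c ∷_)) cs) + (ψ c * F cs - expand ψ (F ∘ (c ∷_)) cs) ∎

  expand-linear : ∀ {φ : C → Carrier} k m {F G} cs →
    expand φ (λ ds → k * F ds + m * G ds) cs ≈ k * expand φ F cs + m * expand φ G cs
  expand-linear k m []       = sym (trans (+-cong (zeroʳ k) (zeroʳ m)) (+-identityʳ 0#))
  expand-linear {φ = φ} k m {F} {G} (c ∷ cs) = begin
    φ c * (k * F cs + m * G cs) - expand φ (λ ds → k * F (c ∷ ds) + m * G (c ∷ ds)) cs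
      ≈⟨ +-congˡ (-‿cong (expand-linear k m cs)) ⟩
    φ c * (k * F cs + m * G cs) - (k * expand φ (F ∘ (c ∷_)) cs + m * expand φ (G ∘ (c ∷_)) cs)
      ≈⟨ solve 7 (λ k m u f g x y → u :* (k :* f :+ m :* g) :- (k :* x :+ m :* y)
                                 := k :* (u :* f :- x) :+ m :* (u :* g :- y)) refl
           k m (φ c) (F cs) (G cs) (expand φ (F ∘ (c ∷_)) cs) (expand φ (G ∘ (c ∷_)) cs) ⟩
    k * (φ c * F cs - expand φ (F ∘ (c ∷_)) cs) + m * (φ c * G cs - expand φ (G ∘ (c ∷_)) cs) ∎

  expand-scale : ∀ {φ : C → Carrier} k {F} cs → expand φ (λ ds → k * F ds) cs ≈ k * expand φ F cs
  expand-scale k []       = sym (zeroʳ k)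
  expand-scale {φ = φ} k {F} (c ∷ cs) = begin
    φ c * (k * F cs) - expand φ (λ ds → k * F (c ∷ ds)) cs
      ≈⟨ +-congˡ (-‿cong (expand-scale k cs)) ⟩
    φ c * (k * F cs) - k * expand φ (F ∘ (c ∷_)) cs
      ≈⟨ solve 4 (λ k u f x → u :* (k :* f) :- k :* x := k :* (u :* f :- x)) refl
           k (φ c) (F cs) (expand φ (F ∘ (c ∷_)) cs) ⟩
    k * (φ c * F cs - expand φ (F ∘ (c ∷_)) cs) ∎

  -- Contraction is an antiderivation: the inner expansion along `ψ` either uses the column `c` or
  -- passes it at the cost of a sign.
  expand-∷ : ∀ {φ ψ : C → Carrier} {F} c cs →
    expand φ (expand ψ F ∘ (c ∷_)) cs ≈ ψ c * expand φ F cs - expand φ (expand ψ (F ∘ (c ∷_))) cs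
  expand-∷ {φ = φ} {ψ} {F} c cs = begin
    expand φ (λ ds → ψ c * F ds - expand ψ (F ∘ (c ∷_)) ds) cs
      ≈⟨ expand-cong (λ _ → refl) (λ ds → +-congˡ (-1*x≈-x _)) cs ⟨
    expand φ (λ ds → ψ c * F ds + - 1# * expand ψ (F ∘ (c ∷_)) ds) cs
      ≈⟨ expand-linear (ψ c) (- 1#) cs ⟩
    ψ c * expand φ F cs + - 1# * expand φ (expand ψ (F ∘ (c ∷_))) cs
      ≈⟨ +-congˡ (-1*x≈-x _) ⟩
    ψ c * expand φ F cs - expand φ (expand ψ (F ∘ (c ∷_))) cs ∎

  -- The head column is used by `φ`, by `ψ` or by neither. The first two terms trade places with
  -- opposite signs; the third is the same statement for the tail.
  expand-anticomm : ∀ {φ ψ : C → Carrier} {F} cs → expand φ (expand ψ F) cs ≈ - expand ψ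
      (expand φ F) cs
  expand-anticomm []       = sym -0#≈0#
  expand-anticomm {φ = φ} {ψ} {F} (c ∷ cs) = begin
    φ c * expand ψ F cs - expand φ (expand ψ F ∘ (c ∷_)) cs
      ≈⟨ +-congˡ (-‿cong (trans (expand-∷ c cs) (+-congˡ (-‿cong (expand-anticomm cs))))) ⟩
    φ c * expand ψ F cs - (ψ c * expand φ F cs - - expand ψ (expand φ (F ∘ (c ∷_))) cs)
      ≈⟨ solve 5 (λ u x v y z → u :* x :- (v :* y :- :- z) := :- (v :* y :- (u :* x :- z))) refl
           (φ c) (expand ψ F cs) (ψ c) (expand φ F cs) (expand ψ (expand φ (F ∘ (c ∷_))) cs) ⟩
    - (ψ c * expand φ F cs - (φ c * expand ψ F cs - expand ψ (expand φ (F ∘ (c ∷_))) cs))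
      ≈⟨ -‿cong (+-congˡ (-‿cong (expand-∷ c cs))) ⟨
    - (ψ c * expand φ F cs - expand ψ (expand φ F ∘ (c ∷_)) cs) ∎

  -- Anticommutativity gives only x = - x, and 2 need not be invertible in `R`; hence a separate
  -- induction, in which the two terms using `c` cancel.
  expand-repeated : ∀ {φ : C → Carrier} {F} cs → expand φ (expand φ F) cs ≈ 0#
  expand-repeated []       = refl
  expand-repeated {φ = φ} {F} (c ∷ cs) = begin
    φ c * expand φ F cs - expand φ (expand φ F ∘ (c ∷_)) cs
      ≈⟨ +-congˡ (-‿cong (trans (expand-∷ c cs) (trans (+-congˡ (-‿cong (expand-repeated cs)))
          (x-0≈x _)))) ⟩
    φ c * expand φ F cs - φ c * expand φ F cs
      ≈⟨ -‿inverseʳ _ ⟩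
    0# ∎

-- Alternating forms and determinants

module AlternatingForms {c ℓ} (R : CommutativeRing c ℓ) where
  open CommutativeRing R
  open RingProperties ring
  open RingFacts R
  open Contraction R
  open IntegerSolver R
  open SetoidReasoning setoid

  private variable
    a : Level
    X : Set a

  -- `linear` accepts pointwise combinations and thereby replaces function extensionality. `repeat`
  -- is a field of its own because `swap` yields it only after division by 2.
  record Alternating {X : Set a} (F : List (X → Carrier) → Carrier) : Set (a ⊔ c ⊔ ℓ) where
    field
      linear : ∀ pre {post u v w} k m → (∀ x → u x ≈ k * v x + m * w x) →
               F (pre ++ u ∷ post) ≈ k * F (pre ++ v ∷ post) + m * F (pre ++ w ∷ post)
      swap   : ∀ pre {post u v} → F (pre ++ u ∷ v ∷ post) ≈ - F (pre ++ v ∷ u ∷ post)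
      repeat : ∀ pre {post u} → F (pre ++ u ∷ u ∷ post) ≈ 0#

  open Alternating

  alternating-∷ : ∀ {F : List (X → Carrier) → Carrier} → Alternating F → ∀ u → Alternating
      (F ∘ (u ∷_))
  alternating-∷ alt u .linear pre = alt .linear (u ∷ pre)
  alternating-∷ alt u .swap   pre = alt .swap   (u ∷ pre)
  alternating-∷ alt u .repeat pre = alt .repeat (u ∷ pre)

  empty-alternating : Alternating {X = X} empty
  empty-alternating .linear []        k m _ = sym (trans (+-cong (zeroʳ k) (zeroʳ m))
      (+-identityʳ 0#))
  empty-alternating .linear (_ ∷ _)   k m _ = sym (trans (+-cong (zeroʳ k) (zeroʳ m))
      (+-identityʳ 0#))
  empty-alternating .swap   []        = sym -0#≈0#
  empty-alternating .swap   (_ ∷ _)   = sym -0#≈0#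
  empty-alternating .repeat []        = refl
  empty-alternating .repeat (_ ∷ _)   = refl

  at : X → (X → Carrier) → Carrier
  at x u = u x

  -- When the affected columns come first, the terms in which row `x` uses them are compared
  -- directly, and the remaining term inherits the property from `F`. Earlier columns are absorbed
  -- into the form by `alternating-∷`.
  expand-alternating : ∀ (x : X) {F} → Alternating F → Alternating (expand (at x) F)
  expand-alternating x {F} alt .linear [] {post} {u} {v} {w} k m u≈ = begin
    u x * F post - expand (at x) (F ∘ (u ∷_)) post
      ≈⟨ +-cong (*-congʳ (u≈ x))
                (-‿cong (trans (expand-cong (λ _ → refl) (λ ds → alt .linear [] {ds} k m u≈) post)
                               (expand-linear k m post))) ⟩
    (k * v x + m * w x) * F post
      - (k * expand (at x) (F ∘ (v ∷_)) post + m * expand (at x) (F ∘ (w ∷_)) post)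
      ≈⟨ solve 7 (λ k m u f g x y → (k :* f :+ m :* g) :* u :- (k :* x :+ m :* y)
                                 := k :* (f :* u :- x) :+ m :* (g :* u :- y)) refl
           k m (F post) (v x) (w x) (expand (at x) (F ∘ (v ∷_)) post)
               (expand (at x) (F ∘ (w ∷_)) post) ⟩
    k * (v x * F post - expand (at x) (F ∘ (v ∷_)) post)
      + m * (w x * F post - expand (at x) (F ∘ (w ∷_)) post) ∎
  expand-alternating x {F} alt .linear (p ∷ pre) {post} {u} {v} {w} k m u≈ = begin
    p x * F (pre ++ u ∷ post) - E (pre ++ u ∷ post)
      ≈⟨ +-cong (*-congˡ (alt .linear pre k m u≈))
                (-‿cong (expand-alternating x (alternating-∷ alt p) .linear pre k m u≈)) ⟩
    p x * (k * F (pre ++ v ∷ post) + m * F (pre ++ w ∷ post))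
      - (k * E (pre ++ v ∷ post) + m * E (pre ++ w ∷ post))
      ≈⟨ solve 7 (λ k m u f g x y → u :* (k :* f :+ m :* g) :- (k :* x :+ m :* y)
                                 := k :* (u :* f :- x) :+ m :* (u :* g :- y)) refl
           k m (p x) (F (pre ++ v ∷ post)) (F (pre ++ w ∷ post)) (E (pre ++ v ∷ post))
               (E (pre ++ w ∷ post)) ⟩
    k * (p x * F (pre ++ v ∷ post) - E (pre ++ v ∷ post))
      + m * (p x * F (pre ++ w ∷ post) - E (pre ++ w ∷ post)) ∎
    where E = expand (at x) (F ∘ (p ∷_))
  expand-alternating x {F} alt .swap [] {post} {u} {v} = begin
    u x * F (v ∷ post) - (v x * F (u ∷ post) - E u v)
      ≈⟨ +-congˡ (-‿cong (+-congˡ (-‿cong E-swap))) ⟩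
    u x * F (v ∷ post) - (v x * F (u ∷ post) - - E v u)
      ≈⟨ solve 5 (λ a f b g e → a :* f :- (b :* g :- :- e) := :- (b :* g :- (a :* f :- e))) refl
           (u x) (F (v ∷ post)) (v x) (F (u ∷ post)) (E v u) ⟩
    - (v x * F (u ∷ post) - (u x * F (v ∷ post) - E v u)) ∎
    where
    E : _ → _ → Carrier
    E s t = expand (at x) (F ∘ (s ∷_) ∘ (t ∷_)) post
    E-swap : E u v ≈ - E v u
    E-swap = begin
      E u v      ≈⟨ expand-cong (λ _ → refl) (λ ds → trans (alt .swap [] {ds}) (sym (-1*x≈-x _)))
          post ⟩
      expand (at x) (λ ds → - 1# * F (v ∷ u ∷ ds)) post
                 ≈⟨ expand-scale (- 1#) post ⟩
      - 1# * E v u ≈⟨ -1*x≈-x _ ⟩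
      - E v u    ∎
  expand-alternating x {F} alt .swap (p ∷ pre) {post} {u} {v} = begin
    p x * F (pre ++ u ∷ v ∷ post) - E (pre ++ u ∷ v ∷ post)
      ≈⟨ +-cong (*-congˡ (alt .swap pre))
          (-‿cong (expand-alternating x (alternating-∷ alt p) .swap pre)) ⟩
    p x * - F (pre ++ v ∷ u ∷ post) - - E (pre ++ v ∷ u ∷ post)
      ≈⟨ solve 3 (λ a f e → a :* :- f :- :- e := :- (a :* f :- e)) refl
           (p x) (F (pre ++ v ∷ u ∷ post)) (E (pre ++ v ∷ u ∷ post)) ⟩
    - (p x * F (pre ++ v ∷ u ∷ post) - E (pre ++ v ∷ u ∷ post)) ∎
    where E = expand (at x) (F ∘ (p ∷_))
  expand-alternating x {F} alt .repeat [] {post} {u} = begin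
    u x * F (u ∷ post) - (u x * F (u ∷ post) - expand (at x) (F ∘ (u ∷_) ∘ (u ∷_)) post)
      ≈⟨ +-congˡ (-‿cong (trans (+-congˡ (-‿cong (expand-zero (λ ds → alt .repeat [] {ds}) post)))
          (x-0≈x _))) ⟩
    u x * F (u ∷ post) - u x * F (u ∷ post)
      ≈⟨ -‿inverseʳ _ ⟩
    0# ∎
  expand-alternating x {F} alt .repeat (p ∷ pre) {post} {u} = begin
    p x * F (pre ++ u ∷ u ∷ post) - expand (at x) (F ∘ (p ∷_)) (pre ++ u ∷ u ∷ post)
      ≈⟨ +-cong (trans (*-congˡ (alt .repeat pre)) (zeroʳ _))
                (-‿cong (expand-alternating x (alternating-∷ alt p) .repeat pre)) ⟩
    0# - 0# ≈⟨ -‿inverseʳ 0# ⟩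
    0# ∎

  -- The last row is expanded first, so the rows are taken in reverse order.
  det : List X → List (X → Carrier) → Carrier
  det = foldl (λ F x → expand (at x) F) empty

  foldl-alternating : ∀ (xs : List X) {F} → Alternating F → Alternating
      (foldl (λ G x → expand (at x) G) F xs)
  foldl-alternating []       alt = alt
  foldl-alternating (x ∷ xs) alt = foldl-alternating xs (expand-alternating x alt)

  det-alternating : ∀ (xs : List X) → Alternating (det xs)
  det-alternating xs = foldl-alternating xs empty-alternating

  -- The sign of the permutation is not recorded, since the result serves only to prove vanishing or
  -- invertibility.
  alternating-↭ : ∀ {F : List (X → Carrier) → Carrier} → Alternating F →
                  ∀ {us vs} → us ↭ vs → F us ≈± F vs
  alternating-↭ alt ↭.refl         = inj₁ refl
  alternating-↭ alt (↭.prep u p)   = alternating-↭ (alternating-∷ alt u) p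
  alternating-↭ alt (↭.swap u v p) =
    ≈±-trans (inj₂ (alt .swap [])) (alternating-↭ (alternating-∷ (alternating-∷ alt v) u) p)
  alternating-↭ alt (↭.trans p q)  = ≈±-trans (alternating-↭ alt p) (alternating-↭ alt q)

-- Finite sums over lists

module ListSums {c ℓ} (R : CommutativeRing c ℓ) where
  open CommutativeRing R
  open IntegerSolver R

  private variable
    a b p : Level
    A B : Set a

  sumOver : List A → (A → Carrier) → Carrier
  sumOver xs f = foldr _+_ 0# (map f xs)

  sum-cong : ∀ (xs : List A) {f g} → (∀ x → f x ≈ g x) → sumOver xs f ≈ sumOver xs g
  sum-cong []       f≈g = refl
  sum-cong (x ∷ xs) f≈g = +-cong (f≈g x) (sum-cong xs f≈g)

  sum-cong-All : ∀ {P : A → Set p} {xs f g} → All P xs → (∀ x → P x → f x ≈ g x) → sumOver xs f ≈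
      sumOver xs g
  sum-cong-All []         f≈g = refl
  sum-cong-All (px ∷ pxs) f≈g = +-cong (f≈g _ px) (sum-cong-All pxs f≈g)

  sum-zero : ∀ (xs : List A) → sumOver xs (λ _ → 0#) ≈ 0#
  sum-zero []       = refl
  sum-zero (x ∷ xs) = trans (+-identityˡ _) (sum-zero xs)

  sum-vanishes : ∀ (xs : List A) {f} → (∀ x → f x ≈ 0#) → sumOver xs f ≈ 0#
  sum-vanishes xs f≈0 = trans (sum-cong xs f≈0) (sum-zero xs)

  sum-+ : ∀ (xs : List A) {f g} → sumOver xs (λ x → f x + g x) ≈ sumOver xs f + sumOver xs g
  sum-+ []       = sym (+-identityˡ 0#)
  sum-+ (x ∷ xs) {f} {g} = trans (+-congˡ (sum-+ xs))
    (solve 4 (λ a b c d → (a :+ b) :+ (c :+ d) := (a :+ c) :+ (b :+ d)) refl (f x) (g x)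
        (sumOver xs f) (sumOver xs g))

  sum-*ˡ : ∀ (xs : List A) k {f} → sumOver xs (λ x → k * f x) ≈ k * sumOver xs f
  sum-*ˡ []       k = sym (zeroʳ k)
  sum-*ˡ (x ∷ xs) k = trans (+-congˡ (sum-*ˡ xs k)) (sym (distribˡ k _ _))

  sum-++ : ∀ (xs ys : List A) {f} → sumOver (xs ++ ys) f ≈ sumOver xs f + sumOver ys f
  sum-++ []       ys = sym (+-identityˡ _)
  sum-++ (x ∷ xs) ys = trans (+-congˡ (sum-++ xs ys)) (sym (+-assoc _ _ _))

  sum-map : ∀ (g : A → B) xs {f} → sumOver (map g xs) f ≈ sumOver xs (f ∘ g)
  sum-map g []       = refl
  sum-map g (x ∷ xs) = +-congˡ (sum-map g xs)

  sum-swap : ∀ (xs : List A) (ys : List B) {f : A → B → Carrier} →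
             sumOver xs (λ x → sumOver ys (f x)) ≈ sumOver ys (λ y → sumOver xs (λ x → f x y))
  sum-swap []       ys = sym (sum-zero ys)
  sum-swap (x ∷ xs) ys = trans (+-congˡ (sum-swap xs ys)) (sym (sum-+ ys))

  sum-upTo : ∀ n {f} → sumOver (upTo (suc n)) f ≈ f 0 + sumOver (upTo n) (f ∘ suc)
  sum-upTo n {f} = +-congˡ
      (trans (reflexive (≡.cong (λ xs → sumOver xs f) (≡.sym (List.map-upTo suc n))))
          (sum-map suc (upTo n)))

-- Branching of alternants

module Branching {c ℓ} (R : CommutativeRing c ℓ) where
  open CommutativeRing R
  open RingProperties ring
  open RingFacts R
  open Contraction R
  open AlternatingForms R
  open ListSums R
  open SemiringExp semiring
  open IntegerSolver R
  open SetoidReasoning setoid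
  open Alternating

  monomial : ℕ → Carrier → Carrier
  monomial b x = x ^ b

  -- x ^ b times the complete homogeneous polynomial of degree d - 1 in x and y.
  homogeneous : Carrier → ℕ → ℕ → Carrier → Carrier
  homogeneous y b d x = sumOver (upTo d) (λ j → y ^ (d ∸ suc j) * x ^ (b ℕ.+ j))

  homogeneous-* : ∀ y b d x → (y - x) * homogeneous y b d x ≈ y ^ d * x ^ b - x ^ (b ℕ.+ d)
  homogeneous-* y b zero    x = begin
    (y - x) * 0#        ≈⟨ zeroʳ _ ⟩
    0#                  ≈⟨ -‿inverseʳ _ ⟨
    x ^ b - x ^ b       ≈⟨ +-cong (sym (*-identityˡ _))
        (-‿cong (^-congʳ x (≡.sym (ℕ.+-identityʳ b)))) ⟩
    1# * x ^ b - x ^ (b ℕ.+ 0) ∎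
  homogeneous-* y b (suc d) x = begin
    (y - x) * homogeneous y b (suc d) x
      ≈⟨ *-congˡ (trans (sum-upTo d) (+-cong (*-congˡ (^-congʳ x (ℕ.+-identityʳ b)))
           (sum-cong (upTo d) (λ j → *-congˡ (^-congʳ x (ℕ.+-suc b j)))))) ⟩
    (y - x) * (y ^ d * x ^ b + homogeneous y (suc b) d x)
      ≈⟨ distribˡ _ _ _ ⟩
    (y - x) * (y ^ d * x ^ b) + (y - x) * homogeneous y (suc b) d x
      ≈⟨ +-congˡ (homogeneous-* y (suc b) d x) ⟩
    (y - x) * (y ^ d * x ^ b) + (y ^ d * (x * x ^ b) - x ^ (suc b ℕ.+ d))
      ≈⟨ solve 5 (λ y x p q r → (y :- x) :* (p :* q) :+ (p :* (x :* q) :- r) := (y :* p) :* q :- r)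
          refl
           y x (y ^ d) (x ^ b) (x ^ (suc b ℕ.+ d)) ⟩
    y ^ suc d * x ^ b - x ^ (suc b ℕ.+ d)
      ≈⟨ +-congˡ (-‿cong (^-congʳ x (≡.sym (ℕ.+-suc b d)))) ⟩
    y ^ suc d * x ^ b - x ^ (b ℕ.+ suc d) ∎

  -- What remains of the columns after subtracting from each of them the multiple
  -- of the next one that clears row y, and dividing row x by y - x.
  reduced : Carrier → ℕ → List ℕ → List (Carrier → Carrier)
  reduced y b []        = []
  reduced y b (b′ ∷ bs) = homogeneous y b′ (b ∸ b′) ∷ reduced y b′ bs

  final : ℕ → List ℕ → ℕ
  final b []        = b
  final b (b′ ∷ bs) = final b′ bs

  scaled : Carrier → (Carrier → Carrier) → Carrier → Carrier
  scaled y u x = (y - x) * u x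

  -- Modulo the next column, x^b is minus the scaled column y^d x^b′ - x^b. The latter vanishes in
  -- row y, so the expansion passes over it with a sign that cancels this minus. Only the last
  -- column keeps an entry in row y.
  expand-reduce : ∀ y {F} → Alternating F → ∀ {b bs} → Linked ℕ._≥_ (b ∷ bs) →
    expand (at y) F (map monomial (b ∷ bs)) ≈ y ^ final b bs * F (map (scaled y) (reduced y b bs))
  expand-reduce y {F} alt {b} [-] = x-0≈x _
  expand-reduce y {F} alt {b} {b′ ∷ bs} (b≥b′ ∷ bs↘) = begin
    H (monomial b ∷ cs)
      ≈⟨ H-alt .linear [] (- 1#) (y ^ d) monomial≈ ⟩
    - 1# * H (s ∷ cs) + y ^ d * H (monomial b′ ∷ cs)
      ≈⟨ +-cong (-1*x≈-x _) (trans (*-congˡ (H-alt .repeat [])) (zeroʳ _)) ⟩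
    - H (s ∷ cs) + 0#
      ≈⟨ +-identityʳ _ ⟩
    - (s y * F cs - expand (at y) (F ∘ (s ∷_)) cs)
      ≈⟨ -‿cong (+-congʳ (trans (*-congʳ (trans (*-congʳ (-‿inverseʳ y)) (zeroˡ _))) (zeroˡ _))) ⟩
    - (0# - expand (at y) (F ∘ (s ∷_)) cs)
      ≈⟨ trans (-‿cong (0-x≈-x _)) (-‿involutive _) ⟩
    expand (at y) (F ∘ (s ∷_)) cs
      ≈⟨ expand-reduce y (alternating-∷ alt s) bs↘ ⟩
    y ^ final b′ bs * F (s ∷ map (scaled y) (reduced y b′ bs)) ∎
    where
    d = b ∸ b′
    H = expand (at y) F
    H-alt = expand-alternating y alt
    s = scaled y (homogeneous y b′ d)
    cs = map monomial (b′ ∷ bs)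
    monomial≈ : ∀ x → x ^ b ≈ - 1# * s x + y ^ d * x ^ b′
    monomial≈ x = begin
      x ^ b
        ≈⟨ solve 2 (λ q r → r := :- (q :- r) :+ q) refl (y ^ d * x ^ b′) (x ^ b) ⟩
      - (y ^ d * x ^ b′ - x ^ b) + y ^ d * x ^ b′
        ≈⟨ +-congʳ (-‿cong (+-congˡ (-‿cong (^-congʳ x (≡.sym (ℕ.m+[n∸m]≡n b≥b′)))))) ⟩
      - (y ^ d * x ^ b′ - x ^ (b′ ℕ.+ d)) + y ^ d * x ^ b′
        ≈⟨ +-congʳ (trans (-1*x≈-x _) (-‿cong (homogeneous-* y b′ d x))) ⟨
      - 1# * s x + y ^ d * x ^ b′ ∎

  differences : Carrier → List Carrier → Carrier
  differences y []       = 1#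
  differences y (x ∷ xs) = (y - x) * differences y xs

  -- Every column is scaled, so row `x` has the common factor `y - x`; `k` collects the factors of
  -- the rows expanded earlier.
  expand-scaled : ∀ y x k {F G : List (Carrier → Carrier) → Carrier} →
      (∀ us → F (map (scaled y) us) ≈ k * G us) → ∀ us →
    expand (at x) F (map (scaled y) us) ≈ (y - x) * (k * expand (at x) G us)
  expand-scaled y x k F≈kG [] = sym (trans (*-congˡ (zeroʳ k)) (zeroʳ _))
  expand-scaled y x k {F} {G} F≈kG (u ∷ us) = begin
    ((y - x) * u x) * F (map (scaled y) us) - expand (at x) (F ∘ (scaled y u ∷_))
        (map (scaled y) us)
      ≈⟨ +-cong (*-congˡ (F≈kG us)) (-‿cong (expand-scaled y x k (λ vs → F≈kG (u ∷ vs)) us)) ⟩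
    ((y - x) * u x) * (k * G us) - (y - x) * (k * expand (at x) (G ∘ (u ∷_)) us)
      ≈⟨ solve 6 (λ y x v k g h → ((y :- x) :* v) :* (k :* g) :- (y :- x) :* (k :* h)
                                := (y :- x) :* (k :* (v :* g :- h))) refl
           y x (u x) k (G us) (expand (at x) (G ∘ (u ∷_)) us) ⟩
    (y - x) * (k * (u x * G us - expand (at x) (G ∘ (u ∷_)) us)) ∎

  foldl-scaled : ∀ y xs k {F G : List (Carrier → Carrier) → Carrier} →
      (∀ us → F (map (scaled y) us) ≈ k * G us) → ∀ us →
    foldl (λ H x → expand (at x) H) F xs (map (scaled y) us) ≈
    (k * differences y xs) * foldl (λ H x → expand (at x) H) G xs us
  foldl-scaled y []       k F≈kG us = trans (F≈kG us) (*-congʳ (sym (*-identityʳ k)))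
  foldl-scaled y (x ∷ xs) k F≈kG us =
    trans (foldl-scaled y xs ((y - x) * k)
             (λ vs → trans (expand-scaled y x k F≈kG vs) (sym (*-assoc _ _ _))) us)
          (*-congʳ (solve 3 (λ d k e → (d :* k) :* e := k :* (d :* e)) refl (y - x) k
              (differences y xs)))

  det-scaled : ∀ y xs us → det xs (map (scaled y) us) ≈ differences y xs * det xs us
  det-scaled y xs us = trans (foldl-scaled y xs 1# {F = empty} {G = empty} empty-scaled us)
      (*-congʳ (*-identityˡ _))
    where
    empty-scaled : ∀ vs → empty (map (scaled y) vs) ≈ 1# * empty vs
    empty-scaled []      = sym (*-identityˡ 1#)
    empty-scaled (_ ∷ _) = sym (zeroʳ 1#)

  linear-sum : ∀ {a} {A : Set a} {F} → Alternating F → ∀ (is : List A) (k : A → Carrier)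
      (v : A → Carrier → Carrier) {us} →
    F ((λ x → sumOver is (λ i → k i * v i x)) ∷ us) ≈ sumOver is (λ i → k i * F (v i ∷ us))
  linear-sum {F = F} alt [] k v {us} = begin
    F (u ∷ us)                ≈⟨ alt .linear [] 0# 0#
        (λ _ → sym (trans (+-cong (zeroˡ _) (zeroˡ _)) (+-identityʳ 0#))) ⟩
    0# * F (u ∷ us) + 0# * F (u ∷ us) ≈⟨ trans (+-cong (zeroˡ _) (zeroˡ _)) (+-identityʳ 0#) ⟩
    0# ∎
    where u = λ (_ : Carrier) → 0#
  linear-sum {F = F} alt (i ∷ is) k v {us} = begin
    F ((λ x → k i * v i x + sumOver is (λ j → k j * v j x)) ∷ us)
      ≈⟨ alt .linear [] (k i) 1# (λ _ → +-congˡ (sym (*-identityˡ _))) ⟩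
    k i * F (v i ∷ us) + 1# * F ((λ x → sumOver is (λ j → k j * v j x)) ∷ us)
      ≈⟨ +-congˡ (trans (*-identityˡ _) (linear-sum alt is k v)) ⟩
    k i * F (v i ∷ us) + sumOver is (λ j → k j * F (v j ∷ us)) ∎

  -- With c = b′ + j the sum runs over sequences satisfying b′ ≤ c < b for neighbours b > b′, which
  -- is interlacing in terms of exponents. Each step contributes y^(b - 1 - c), and the last
  -- exponent contributes in full.
  branch : Carrier → (List ℕ → Carrier) → ℕ → List ℕ → Carrier
  branch y f b []        = y ^ b * f []
  branch y f b (b′ ∷ bs) =
    sumOver (upTo (b ∸ b′)) λ j → y ^ (b ∸ b′ ∸ suc j) * branch y (f ∘ ((b′ ℕ.+ j) ∷_)) b′ bs

  reduced-branch : ∀ y {F} → Alternating F → ∀ b bs →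
    y ^ final b bs * F (reduced y b bs) ≈ branch y (F ∘ map monomial) b bs
  reduced-branch y alt b []        = refl
  reduced-branch y {F} alt b (b′ ∷ bs) = begin
    y ^ final b′ bs * F (homogeneous y b′ d ∷ reduced y b′ bs)
      ≈⟨ *-congˡ (linear-sum alt (upTo d) (λ j → y ^ (d ∸ suc j)) (λ j → monomial (b′ ℕ.+ j))) ⟩
    y ^ final b′ bs * sumOver (upTo d) (λ j → y ^ (d ∸ suc j) * F
        (monomial (b′ ℕ.+ j) ∷ reduced y b′ bs))
      ≈⟨ sum-*ˡ (upTo d) _ ⟨
    sumOver (upTo d) (λ j → y ^ final b′ bs
        * (y ^ (d ∸ suc j) * F (monomial (b′ ℕ.+ j) ∷ reduced y b′ bs)))
      ≈⟨ sum-cong (upTo d) (λ j → trans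
           (solve 3 (λ p q r → p :* (q :* r) := q :* (p :* r)) refl _ _ _)
           (*-congˡ (reduced-branch y (alternating-∷ alt (monomial (b′ ℕ.+ j))) b′ bs))) ⟩
    branch y (F ∘ map monomial) b (b′ ∷ bs) ∎
    where d = b ∸ b′

  det-branch : ∀ y xs {b bs} → Linked ℕ._≥_ (b ∷ bs) →
    expand (at y) (det xs) (map monomial (b ∷ bs)) ≈ differences y xs * branch y
        (det xs ∘ map monomial) b bs
  det-branch y xs {b} {bs} bs↘ = begin
    expand (at y) (det xs) (map monomial (b ∷ bs))
      ≈⟨ expand-reduce y (det-alternating xs) bs↘ ⟩
    y ^ final b bs * det xs (map (scaled y) (reduced y b bs))
      ≈⟨ *-congˡ (det-scaled y xs _) ⟩
    y ^ final b bs * (differences y xs * det xs (reduced y b bs))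
      ≈⟨ solve 3 (λ p q r → p :* (q :* r) := q :* (p :* r)) refl _ _ _ ⟩
    differences y xs * (y ^ final b bs * det xs (reduced y b bs))
      ≈⟨ *-congˡ (reduced-branch y (det-alternating xs) b bs) ⟩
    differences y xs * branch y (det xs ∘ map monomial) b bs ∎

-- Semistandardness as a Boolean condition on neighbouring rows

private variable
  n : ℕ

increasing : List (Fin n) → Bool
increasing r = does (linked? Fin._≤?_ r)

fits : List (Fin n) → List (Fin n) → Bool
fits v u = does (prefix? (flip Fin._<?_) v u)

semistandard : Filling n → Bool
semistandard T = does (isSemistandard? T)

-- Whether u ∷ T is semistandard, given that u is increasing.
semistandardBelow : List (Fin n) → Filling n → Bool
semistandardBelow u []      = true
semistandardBelow u (v ∷ T) = increasing v ∧ (fits v u ∧ semistandardBelow v T)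

private
  columns : Filling n → Bool
  columns T = does (linked? (flip (prefix? (flip Fin._<?_))) T)

  rowsIncreasing : Filling n → Bool
  rowsIncreasing T = does (all? (linked? Fin._≤?_) T)

  below-correct : ∀ (u : List (Fin n)) T → rowsIncreasing T ∧ columns (u ∷ T) ≡ semistandardBelow u
      T
  below-correct u []      = ≡.refl
  below-correct u (v ∷ T) = ≡.trans (shuffle (increasing v) (rowsIncreasing T) (fits v u)
      (columns (v ∷ T)))
    (≡.cong (λ b → increasing v ∧ (fits v u ∧ b)) (below-correct v T))
    where
    shuffle : ∀ a b c d → (a ∧ b) ∧ (c ∧ d) ≡ a ∧ (c ∧ (b ∧ d))
    shuffle false b     c     d = ≡.refl
    shuffle true  true  c     d = ≡.refl
    shuffle true  false true  d = ≡.refl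
    shuffle true  false false d = ≡.refl

semistandard-∷ : ∀ (u : List (Fin n)) T → semistandard (u ∷ T) ≡ increasing u ∧ semistandardBelow u
    T
semistandard-∷ u T = ≡.trans (Bool.∧-assoc (increasing u) _ _) (≡.cong (increasing u ∧_)
    (below-correct u T))

-- Every increasing row over n + 1 letters has this form for exactly one `r` and `b`: the copies of
-- the largest letter stand at its end.
lift : List (Fin n) → ℕ → List (Fin (suc n))
lift r b = map inject₁ r ++ replicate b (fromℕ _)

≤ᵇ-suc : ∀ m n → (suc m ≤ᵇ suc n) ≡ (m ≤ᵇ n)
≤ᵇ-suc zero    n = ≡.refl
≤ᵇ-suc (suc m) n = ≡.refl

private
  ≤ᵇ-inject₁ : ∀ (i j : Fin n) → (toℕ (inject₁ i) ≤ᵇ toℕ (inject₁ j)) ≡ (toℕ i ≤ᵇ toℕ j)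
  ≤ᵇ-inject₁ i j = ≡.cong₂ _≤ᵇ_ (Fin.toℕ-inject₁ i) (Fin.toℕ-inject₁ j)

  <ᵇ-inject₁ : ∀ (i j : Fin n) → (toℕ (inject₁ i) <ᵇ toℕ (inject₁ j)) ≡ (toℕ i <ᵇ toℕ j)
  <ᵇ-inject₁ i j = ≡.cong₂ _<ᵇ_ (Fin.toℕ-inject₁ i) (Fin.toℕ-inject₁ j)

  inject₁<max : ∀ (i : Fin n) → inject₁ i Fin.< fromℕ n
  inject₁<max {n} i =
    ≡.subst₂ ℕ._<_ (≡.sym (Fin.toℕ-inject₁ i)) (≡.sym (Fin.toℕ-fromℕ n)) (Fin.toℕ<n i)

  inject₁<ᵇmax : ∀ (i : Fin n) → (toℕ (inject₁ i) <ᵇ toℕ (fromℕ n)) ≡ true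
  inject₁<ᵇmax i = dec-true (_ Fin.<? _) (inject₁<max i)

  inject₁≤ᵇmax : ∀ (i : Fin n) → (toℕ (inject₁ i) ≤ᵇ toℕ (fromℕ n)) ≡ true
  inject₁≤ᵇmax i = dec-true (_ Fin.≤? _) (ℕ.<⇒≤ (inject₁<max i))

  max≰ᵇinject₁ : ∀ (i : Fin n) → (toℕ (fromℕ n) ≤ᵇ toℕ (inject₁ i)) ≡ false
  max≰ᵇinject₁ i = dec-false (_ Fin.≤? _) (ℕ.<⇒≱ (inject₁<max i))

  max≮ᵇ : ∀ (i : Fin (suc n)) → (toℕ (fromℕ n) <ᵇ toℕ i) ≡ false
  max≮ᵇ i = dec-false (_ Fin.<? _) (ℕ.≤⇒≯ (Fin.≤fromℕ i))

-- A largest letter of the lower row must lie below a smaller letter, hence below u.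
fits-lift : ∀ (v u : List (Fin n)) b a → fits (lift v b) (lift u a) ≡ fits v u ∧
    (length v ℕ.+ b ≤ᵇ length u)
fits-lift []      u       zero    a       = ≡.refl
fits-lift []      []      (suc b) zero    = ≡.refl
fits-lift {n} []  []      (suc b) (suc a) =
  ≡.cong (_∧ fits (lift {n} [] b) (lift [] a)) (max≮ᵇ (fromℕ n))
fits-lift []      (x ∷ u) (suc b) a       =
  ≡.trans (≡.cong₂ _∧_ (inject₁<ᵇmax x) (fits-lift [] u b a)) (≡.sym (≤ᵇ-suc b (length u)))
fits-lift (y ∷ v) []      b       zero    = ≡.refl
fits-lift (y ∷ v) []      b       (suc a) =
  ≡.cong (_∧ fits (lift v b) (lift [] a)) (max≮ᵇ (inject₁ y))
fits-lift (y ∷ v) (x ∷ u) b       a       = ≡.trans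
  (≡.cong₂ _∧_ (<ᵇ-inject₁ x y) (≡.trans (fits-lift v u b a)
      (≡.cong (fits v u ∧_) (≡.sym (≤ᵇ-suc (length v ℕ.+ b) (length u))))))
  (≡.sym (Bool.∧-assoc (toℕ x <ᵇ toℕ y) (fits v u) _))

precedes : Fin n → List (Fin n) → Bool
precedes a []      = true
precedes a (b ∷ _) = toℕ a ≤ᵇ toℕ b

increasing-∷ : ∀ (a : Fin n) r → increasing (a ∷ r) ≡ precedes a r ∧ increasing r
increasing-∷ a []      = ≡.refl
increasing-∷ a (b ∷ r) = ≡.refl

precedes-lift : ∀ (a : Fin n) r b → precedes (inject₁ a) (lift r b) ≡ precedes a r
precedes-lift a []      zero    = ≡.refl
precedes-lift a []      (suc b) = inject₁≤ᵇmax a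
precedes-lift a (c ∷ r) b       = ≤ᵇ-inject₁ a c

rows : ∀ n → ℕ → List (List (Fin n))
rows n m = choices (replicate m (allFin n))

fillingsOf : ∀ n → List ℕ → List (Filling n)
fillingsOf n L = choices (map (rows n) L)

length-choices : ∀ {a} {A : Set a} (xss : List (List A)) → All (λ ys → length ys ≡ length xss)
    (choices xss)
length-choices []         = ≡.refl ∷ []
length-choices (xs ∷ xss) =
  All.cartesianProductWith⁺ (≡.setoid _) (≡.setoid _) _∷_ xs (choices xss)
    (λ _ ys∈ → ≡.cong suc (All.lookup (length-choices xss) ys∈))

length-rows : ∀ n m → All (λ r → length r ≡ m) (rows n m)
length-rows n m = All.map (λ eq → ≡.trans eq (List.length-replicate m))
    (length-choices (replicate m (allFin n)))

tabulate-∷ʳ : ∀ {a} {A : Set a} {n} (f : Fin (suc n) → A) →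
              List.tabulate f ≡ List.tabulate (f ∘ inject₁) ++ [ f (fromℕ n) ]
tabulate-∷ʳ {n = zero}  f = ≡.refl
tabulate-∷ʳ {n = suc n} f = ≡.cong (f Fin.zero ∷_) (tabulate-∷ʳ (f ∘ Fin.suc))

-- Sums over increasing rows

module Tableaux {c ℓ} (R : CommutativeRing c ℓ) where
  open CommutativeRing R
  open ListSums R
  open IntegerSolver R
  open SetoidReasoning setoid

  private variable
    a : Level
    A : Set a

  -- The Iverson bracket. With semistandardness as a factor, sums run over all fillings and can be
  -- split row by row.
  ⟦_⟧ : Bool → Carrier
  ⟦ true  ⟧ = 1#
  ⟦ false ⟧ = 0#

  ⟦⟧-cong : ∀ {b b′} → b ≡ b′ → ⟦ b ⟧ ≈ ⟦ b′ ⟧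
  ⟦⟧-cong eq = reflexive (≡.cong ⟦_⟧ eq)

  ⟦⟧-∧ : ∀ b b′ → ⟦ b ∧ b′ ⟧ ≈ ⟦ b ⟧ * ⟦ b′ ⟧
  ⟦⟧-∧ true  b′ = sym (*-identityˡ _)
  ⟦⟧-∧ false b′ = sym (zeroˡ _)

  sum-filter : ∀ {p} {P : A → Set p} (P? : Decidable P) xs {f} →
               sumOver (filter P? xs) f ≈ sumOver xs (λ x → ⟦ does (P? x) ⟧ * f x)
  sum-filter P? []       = refl
  sum-filter P? (x ∷ xs) with does (P? x)
  ... | true  = +-cong (sym (*-identityˡ _)) (sum-filter P? xs)
  ... | false = trans (sum-filter P? xs) (sym (trans (+-congʳ (zeroˡ _)) (+-identityˡ _)))

  sum-product : ∀ (xs : List A) (yss : List (List A)) {f} →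
                sumOver (cartesianProductWith _∷_ xs yss) f ≈ sumOver xs
                    (λ x → sumOver yss (λ ys → f (x ∷ ys)))
  sum-product []       yss = refl
  sum-product (x ∷ xs) yss =
    trans (sum-++ (map (x ∷_) yss) _) (+-cong (sum-map (x ∷_) yss) (sum-product xs yss))

  sum-allFin : ∀ n {f} → sumOver (allFin (suc n)) f ≈ sumOver (allFin n) (f ∘ inject₁) + f (fromℕ n)
  sum-allFin n {f} = begin
    sumOver (allFin (suc n)) f
      ≡⟨ ≡.cong (λ xs → sumOver xs f) (≡.trans (tabulate-∷ʳ id) (≡.cong (_++ [ fromℕ n ])
          (≡.sym (List.map-tabulate id inject₁)))) ⟩
    sumOver (map inject₁ (allFin n) ++ [ fromℕ n ]) f
      ≈⟨ sum-++ (map inject₁ (allFin n)) _ ⟩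
    sumOver (map inject₁ (allFin n)) f + (f (fromℕ n) + 0#)
      ≈⟨ +-cong (sum-map inject₁ (allFin n)) (+-identityʳ _) ⟩
    sumOver (allFin n) (f ∘ inject₁) + f (fromℕ n) ∎

  -- Only the largest letter can follow the largest letter, so a single row survives.
  sum-rows-max : ∀ n m {g : List (Fin (suc n)) → Carrier} →
    sumOver (rows (suc n) m) (λ r → ⟦ increasing (fromℕ n ∷ r) ⟧ * g r) ≈ g (replicate m (fromℕ n))
  sum-rows-max n zero    {g} = trans (+-identityʳ _) (*-identityˡ _)
  sum-rows-max n (suc m) {g} = begin
    sumOver (rows (suc n) (suc m)) (λ r → ⟦ increasing (fromℕ n ∷ r) ⟧ * g r)
      ≈⟨ trans (sum-product (allFin (suc n)) (rows (suc n) m)) (sum-allFin n) ⟩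
    sumOver (allFin n) (λ i → sumOver (rows (suc n) m) (λ r → ⟦ increasing (fromℕ n ∷ inject₁ i ∷ r)
        ⟧ * g (inject₁ i ∷ r)))
      + sumOver (rows (suc n) m) (λ r → ⟦ increasing (fromℕ n ∷ fromℕ n ∷ r) ⟧ * g (fromℕ n ∷ r))
      ≈⟨ +-cong (sum-vanishes (allFin n) (λ i → sum-vanishes (rows (suc n) m) (λ r →
                   trans (*-congʳ (⟦⟧-cong (≡.cong (_∧ increasing (inject₁ i ∷ r))
                       (max≰ᵇinject₁ i)))) (zeroˡ _))))
                (sum-cong (rows (suc n) m) (λ r →
                   *-congʳ (⟦⟧-cong (≡.cong (_∧ increasing (fromℕ n ∷ r))
                       (dec-true (fromℕ n Fin.≤? fromℕ n) Fin.≤-refl))))) ⟩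
    0# + sumOver (rows (suc n) m) (λ r → ⟦ increasing (fromℕ n ∷ r) ⟧ * g (fromℕ n ∷ r))
      ≈⟨ trans (+-identityˡ _) (sum-rows-max n m {g ∘ (fromℕ n ∷_)}) ⟩
    g (replicate (suc m) (fromℕ n)) ∎

  -- Here k counts the letters below the largest one. If the first letter is the largest, the row is
  -- constant and gives the term k = 0; otherwise the first letter adds 1 to the k of the tail.
  sum-rows : ∀ n m {g : List (Fin (suc n)) → Carrier} →
    sumOver (rows (suc n) m) (λ r → ⟦ increasing r ⟧ * g r) ≈
    sumOver (upTo (suc m)) (λ k → sumOver (rows n k) (λ r → ⟦ increasing r ⟧ * g (lift r (m ∸ k))))
  sum-rows n zero    = sym (+-identityʳ _)
  sum-rows n (suc m) {g} = begin
    sumOver (rows (suc n) (suc m)) (λ r → ⟦ increasing r ⟧ * g r)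
      ≈⟨ trans (sum-product (allFin (suc n)) (rows (suc n) m)) (sum-allFin n) ⟩
    sumOver (allFin n) (λ i → sumOver (rows (suc n) m) (λ r → ⟦ increasing (inject₁ i ∷ r) ⟧ * g
        (inject₁ i ∷ r)))
      + sumOver (rows (suc n) m) (λ r → ⟦ increasing (fromℕ n ∷ r) ⟧ * g (fromℕ n ∷ r))
      ≈⟨ +-cong (sum-cong (allFin n) first-letter) (sum-rows-max n m {g ∘ (fromℕ n ∷_)}) ⟩
    sumOver (allFin n) (λ i → sumOver (upTo (suc m)) (λ k → sumOver (rows n k) (term i k))) + g
        (replicate (suc m) (fromℕ n))
      ≈⟨ +-congʳ (trans (sum-swap (allFin n) (upTo (suc m)))
                        (sum-cong (upTo (suc m)) (λ k → sym (sum-product (allFin n) (rows n k))))) ⟩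
    sumOver (upTo (suc m)) (λ k → sumOver (rows n (suc k)) (λ r → ⟦ increasing r ⟧ * g
        (lift r (m ∸ k))))
      + g (replicate (suc m) (fromℕ n))
      ≈⟨ +-comm _ _ ⟩
    g (replicate (suc m) (fromℕ n)) + sumOver (upTo (suc m)) (λ k → sumOver (rows n (suc k))
        (λ r → ⟦ increasing r ⟧ * g (lift r (m ∸ k))))
      ≈⟨ +-congʳ (trans (+-identityʳ _) (*-identityˡ _)) ⟨
    (1# * g (replicate (suc m) (fromℕ n)) + 0#) + sumOver (upTo (suc m))
        (λ k → sumOver (rows n (suc k)) (λ r → ⟦ increasing r ⟧ * g (lift r (m ∸ k))))
      ≈⟨ sum-upTo (suc m) {λ k → sumOver (rows n k) (λ r → ⟦ increasing r ⟧ * g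
          (lift r (suc m ∸ k)))} ⟨
    sumOver (upTo (suc (suc m))) (λ k → sumOver (rows n k) (λ r → ⟦ increasing r ⟧ * g
        (lift r (suc m ∸ k)))) ∎
    where
    term : Fin n → ℕ → List (Fin n) → Carrier
    term i k r = ⟦ increasing (i ∷ r) ⟧ * g (lift (i ∷ r) (m ∸ k))

    split : ∀ {n} (i : Fin n) r h → ⟦ increasing (i ∷ r) ⟧ * h ≈ ⟦ increasing r ⟧
        * (⟦ precedes i r ⟧ * h)
    split i r h = trans (*-congʳ (trans (⟦⟧-cong (increasing-∷ i r))
        (⟦⟧-∧ (precedes i r) (increasing r))))
                        (solve 3 (λ p q h → (p :* q) :* h := q :* (p :* h)) refl _ _ _)

    first-letter : ∀ i → sumOver (rows (suc n) m) (λ r → ⟦ increasing (inject₁ i ∷ r) ⟧ * g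
        (inject₁ i ∷ r)) ≈
                         sumOver (upTo (suc m)) (λ k → sumOver (rows n k) (term i k))
    first-letter i = begin
      sumOver (rows (suc n) m) (λ r → ⟦ increasing (inject₁ i ∷ r) ⟧ * g (inject₁ i ∷ r))
        -- The condition on the first letter moves into the summand, so that the induction
        -- hypothesis applies to the tail.
        ≈⟨ sum-cong (rows (suc n) m) (λ r → split (inject₁ i) r _) ⟩
      sumOver (rows (suc n) m) (λ r → ⟦ increasing r ⟧ * (⟦ precedes (inject₁ i) r ⟧ * g
          (inject₁ i ∷ r)))
        ≈⟨ sum-rows n m {λ r → ⟦ precedes (inject₁ i) r ⟧ * g (inject₁ i ∷ r)} ⟩
      sumOver (upTo (suc m)) (λ k → sumOver (rows n k) (λ r →
        ⟦ increasing r ⟧ * (⟦ precedes (inject₁ i) (lift r (m ∸ k)) ⟧ * g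
            (inject₁ i ∷ lift r (m ∸ k)))))
        ≈⟨ sum-cong (upTo (suc m)) (λ k → sum-cong (rows n k) (λ r →
             trans (*-congˡ (*-congʳ (⟦⟧-cong (precedes-lift i r (m ∸ k))))) (sym (split i r _)))) ⟩
      sumOver (upTo (suc m)) (λ k → sumOver (rows n k) (term i k)) ∎

-- Branching of Schur polynomials

module SchurBranching {c ℓ} (R : CommutativeRing c ℓ) where
  open CommutativeRing R
  open ListSums R
  open Tableaux R
  open SemiringExp semiring
  open IntegerSolver R
  open SetoidReasoning setoid

  rowWeight : Vector Carrier n → List (Fin n) → Carrier
  rowWeight x r = foldr _*_ 1# (map x r)

  rowWeight-++ : ∀ (x : Vector Carrier n) r s → rowWeight x (r ++ s) ≈ rowWeight x r * rowWeight x s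
  rowWeight-++ x []      s = sym (*-identityˡ _)
  rowWeight-++ x (i ∷ r) s = trans (*-congˡ (rowWeight-++ x r s)) (sym (*-assoc _ _ _))

  rowWeight-lift : ∀ (x : Vector Carrier (suc n)) r b →
    rowWeight x (lift r b) ≈ rowWeight (x ∘ inject₁) r * x (fromℕ n) ^ b
  rowWeight-lift {n} x r b = begin
    rowWeight x (map inject₁ r ++ replicate b (fromℕ n))
      ≈⟨ rowWeight-++ x (map inject₁ r) _ ⟩
    rowWeight x (map inject₁ r) * rowWeight x (replicate b (fromℕ n))
      ≈⟨ *-cong (reflexive (≡.cong (foldr _*_ 1#) (≡.sym (List.map-∘ r)))) (powers b) ⟩
    rowWeight (x ∘ inject₁) r * x (fromℕ n) ^ b ∎
    where
    powers : ∀ b → rowWeight x (replicate b (fromℕ n)) ≈ x (fromℕ n) ^ b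
    powers zero    = refl
    powers (suc b) = *-congˡ (powers b)

  weight-∷ : ∀ (x : Vector Carrier n) v T → weight R x (v ∷ T) ≈ rowWeight x v * weight R x T
  weight-∷ x v T = rowWeight-++ x v (concat T)

  -- The sum of f μ, with weight y ^ |L - μ|, over the μ such that p ∷ μ
  -- interlaces p ∷ L.
  interlacing : Carrier → ℕ → (List ℕ → Carrier) → List ℕ → Carrier
  interlacing y p f []      = f []
  interlacing y p f (l ∷ L) =
    ⟦ l ≤ᵇ p ⟧ * sumOver (upTo (suc l)) (λ k → y ^ (l ∸ k) * interlacing y k (f ∘ (k ∷_)) L)

  interlacing-cong : ∀ y p {f g} → (∀ μ → f μ ≈ g μ) → ∀ L → interlacing y p f L ≈ interlacing y p g
      L
  interlacing-cong y p f≈g []      = f≈g []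
  interlacing-cong y p f≈g (l ∷ L) =
    *-congˡ (sum-cong (upTo (suc l)) (λ k → *-congˡ (interlacing-cong y k (f≈g ∘ (k ∷_)) L)))

  interlacing-sum : ∀ y p {a} {A : Set a} (is : List A) (k : A → Carrier) (f : A → List ℕ → Carrier)
      L →
    interlacing y p (λ μ → sumOver is (λ i → k i * f i μ)) L ≈ sumOver is
        (λ i → k i * interlacing y p (f i) L)
  interlacing-sum y p is k f []      = refl
  interlacing-sum y p is k f (l ∷ L) = begin
    ⟦ l ≤ᵇ p ⟧ * sumOver (upTo (suc l)) (λ j → y ^ (l ∸ j) * interlacing y j
        (λ μ → sumOver is (λ i → k i * f i (j ∷ μ))) L)
      ≈⟨ *-congˡ (sum-cong (upTo (suc l))
          (λ j → trans (*-congˡ (interlacing-sum y j is k (λ i → f i ∘ (j ∷_)) L))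
              (sym (sum-*ˡ is _)))) ⟩
    ⟦ l ≤ᵇ p ⟧ * sumOver (upTo (suc l)) (λ j → sumOver is (λ i → y ^ (l ∸ j) * (k i * I i j)))
      ≈⟨ *-congˡ (trans (sum-swap (upTo (suc l)) is) (sum-cong is (λ i → trans
           (sum-cong (upTo (suc l)) (λ j → solve 3 (λ a b c → a :* (b :* c) := b :* (a :* c)) refl
               (y ^ (l ∸ j)) (k i) (I i j)))
           (sum-*ˡ (upTo (suc l)) (k i))))) ⟩
    ⟦ l ≤ᵇ p ⟧ * sumOver is (λ i → k i * sumOver (upTo (suc l)) (λ j → y ^ (l ∸ j) * I i j))
      ≈⟨ sum-*ˡ is _ ⟨
    sumOver is (λ i → ⟦ l ≤ᵇ p ⟧ * (k i * sumOver (upTo (suc l)) (λ j → y ^ (l ∸ j) * I i j)))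
      ≈⟨ sum-cong is (λ i → solve 3 (λ a b c → a :* (b :* c) := b :* (a :* c)) refl _ _ _) ⟩
    sumOver is (λ i → k i * interlacing y p (f i) (l ∷ L)) ∎
    where
    I : _ → ℕ → Carrier
    I i j = interlacing y j (f i ∘ (j ∷_)) L

  -- All that the lower rows see of the upper ones is the adjacent row, so `u` is the only state of
  -- the recursion.
  belowSum : ∀ n → Vector Carrier n → List (Fin n) → List ℕ → Carrier
  belowSum n x u L = sumOver (fillingsOf n L) (λ T → ⟦ semistandardBelow u T ⟧ * weight R x T)

  schurSum : ∀ n → Vector Carrier n → List ℕ → Carrier
  schurSum n x L = sumOver (fillingsOf n L) (λ T → ⟦ semistandard T ⟧ * weight R x T)

  schurSum-schur : ∀ (x : Vector Carrier n) lam → schur R lam x ≈ schurSum n x (Vector.toList lam)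
  schurSum-schur x lam = sum-filter isSemistandard? (fillings lam)

  belowSum-∷ : ∀ n (x : Vector Carrier n) u l L →
    belowSum n x u (l ∷ L) ≈
    sumOver (rows n l) (λ v → ⟦ increasing v ⟧
        * (⟦ fits v u ⟧ * (rowWeight x v * belowSum n x v L)))
  belowSum-∷ n x u l L = trans (sum-product (rows n l) (fillingsOf n L))
      (sum-cong (rows n l) λ v → begin
    sumOver (fillingsOf n L) (λ T → ⟦ increasing v ∧ (fits v u ∧ semistandardBelow v T) ⟧ * weight R
        x (v ∷ T))
      ≈⟨ sum-cong (fillingsOf n L) (λ T → trans
           (*-cong (trans (⟦⟧-∧ (increasing v) _) (*-congˡ (⟦⟧-∧ (fits v u) _))) (weight-∷ x v T))
           (solve 5 (λ a b c d e → (a :* (b :* c)) :* (d :* e) := (a :* (b :* d)) :* (c :* e)) refl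
              ⟦ increasing v ⟧ ⟦ fits v u ⟧ ⟦ semistandardBelow v T ⟧ (rowWeight x v)
                  (weight R x T))) ⟩
    sumOver (fillingsOf n L) (λ T → (⟦ increasing v ⟧ * (⟦ fits v u ⟧ * rowWeight x v))
        * (⟦ semistandardBelow v T ⟧ * weight R x T))
      ≈⟨ sum-*ˡ (fillingsOf n L) _ ⟩
    (⟦ increasing v ⟧ * (⟦ fits v u ⟧ * rowWeight x v)) * belowSum n x v L
      ≈⟨ solve 4 (λ a b c d → (a :* (b :* c)) :* d := a :* (b :* (c :* d))) refl _ _ _ _ ⟩
    ⟦ increasing v ⟧ * (⟦ fits v u ⟧ * (rowWeight x v * belowSum n x v L)) ∎)

  schurSum-∷ : ∀ n (x : Vector Carrier n) l L →
    schurSum n x (l ∷ L) ≈ sumOver (rows n l)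
        (λ v → ⟦ increasing v ⟧ * (rowWeight x v * belowSum n x v L))
  schurSum-∷ n x l L = trans (sum-product (rows n l) (fillingsOf n L))
      (sum-cong (rows n l) λ v → begin
    sumOver (fillingsOf n L) (λ T → ⟦ semistandard (v ∷ T) ⟧ * weight R x (v ∷ T))
      ≈⟨ sum-cong (fillingsOf n L) (λ T → trans
           (*-cong (trans (⟦⟧-cong (semistandard-∷ v T)) (⟦⟧-∧ (increasing v) _)) (weight-∷ x v T))
           (solve 4 (λ a c d e → (a :* c) :* (d :* e) := (a :* d) :* (c :* e)) refl
              ⟦ increasing v ⟧ ⟦ semistandardBelow v T ⟧ (rowWeight x v) (weight R x T))) ⟩
    sumOver (fillingsOf n L) (λ T → (⟦ increasing v ⟧ * rowWeight x v) * (⟦ semistandardBelow v T ⟧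
        * weight R x T))
      ≈⟨ trans (sum-*ˡ (fillingsOf n L) _) (*-assoc _ _ _) ⟩
    ⟦ increasing v ⟧ * (rowWeight x v * belowSum n x v L) ∎)

  -- No letter can stand below a largest one. Hence the value is independent of `a`, and the next
  -- row has length at most `length u`, which is one half of interlacing. The number k of smaller
  -- letters in that row becomes the next bound.
  belowSum-lift : ∀ (x : Vector Carrier (suc n)) L u a →
    belowSum (suc n) x (lift u a) L ≈
    interlacing (x (fromℕ n)) (length u) (belowSum n (x ∘ inject₁) u) L
  belowSum-lift x []      u a = refl
  belowSum-lift {n} x (l ∷ L) u a = begin
    belowSum (suc n) x (lift u a) (l ∷ L)
      ≈⟨ trans (belowSum-∷ (suc n) x (lift u a) l L) (sum-rows n l) ⟩
    sumOver (upTo (suc l)) (λ k → sumOver (rows n k) (λ v → ⟦ increasing v ⟧ *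
      (⟦ fits (lift v (l ∸ k)) (lift u a) ⟧ * (rowWeight x (lift v (l ∸ k)) * belowSum (suc n) x
          (lift v (l ∸ k)) L))))
      -- Subtraction is truncated, so k ≤ l is what gives the lifted row its length l.
      ≈⟨ sum-cong-All (All.all-upTo (suc l)) (λ k k≤l → trans
           (sum-cong-All (length-rows n k) (λ v |v|≡k → rearrange v k |v|≡k (ℕ.≤-pred k≤l)))
           (trans (sum-*ˡ (rows n k) _) (*-congˡ (sum-*ˡ (rows n k) _)))) ⟩
    sumOver (upTo (suc l)) (λ k → ⟦ l ≤ᵇ length u ⟧ * (y ^ (l ∸ k) * sumOver (rows n k)
        (λ v → coefficient v * I v k)))
      ≈⟨ sum-*ˡ (upTo (suc l)) _ ⟩
    ⟦ l ≤ᵇ length u ⟧ * sumOver (upTo (suc l)) (λ k → y ^ (l ∸ k) * sumOver (rows n k)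
        (λ v → coefficient v * I v k))
      -- The sum over rows moves inside `interlacing`, where `belowSum-∷` read backwards assembles
      -- the shape `k ∷ μ`.
      ≈⟨ *-congˡ (sum-cong (upTo (suc l)) (λ k → *-congˡ (trans
           (sym (interlacing-sum y k (rows n k) coefficient (belowSum n x′) L))
           (interlacing-cong y k
               (λ μ → sym (trans (belowSum-∷ n x′ u k μ) (sum-cong (rows n k) (λ v →
              solve 4 (λ a b c d → a :* (b :* (c :* d)) := (a :* (b :* c)) :* d) refl
                ⟦ increasing v ⟧ ⟦ fits v u ⟧ (rowWeight x′ v) (belowSum n x′ v μ))))) L)))) ⟩
    interlacing y (length u) (belowSum n x′ u) (l ∷ L) ∎
    where
    y = x (fromℕ n)
    x′ = x ∘ inject₁
    I : List (Fin n) → ℕ → Carrier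
    I v k = interlacing y k (belowSum n x′ v) L
    coefficient : List (Fin n) → Carrier
    coefficient v = ⟦ increasing v ⟧ * (⟦ fits v u ⟧ * rowWeight x′ v)

    rearrange : ∀ v k → length v ≡ k → k ℕ.≤ l →
      ⟦ increasing v ⟧ * (⟦ fits (lift v (l ∸ k)) (lift u a) ⟧ *
        (rowWeight x (lift v (l ∸ k)) * belowSum (suc n) x (lift v (l ∸ k)) L)) ≈
      ⟦ l ≤ᵇ length u ⟧ * (y ^ (l ∸ k) * (coefficient v * I v k))
    rearrange v k ≡.refl k≤l = begin
      ⟦ increasing v ⟧ * (⟦ fits (lift v b) (lift u a) ⟧ * (rowWeight x (lift v b) * belowSum
          (suc n) x (lift v b) L))
        ≈⟨ *-congˡ (*-cong
             (trans (⟦⟧-cong (≡.trans (fits-lift v u b a) (≡.cong (λ m → fits v u ∧ (m ≤ᵇ length u))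
                 (ℕ.m+[n∸m]≡n k≤l))))
                    (⟦⟧-∧ (fits v u) _))
             (*-cong (rowWeight-lift x v b) (belowSum-lift x L v b))) ⟩
      ⟦ increasing v ⟧ * ((⟦ fits v u ⟧ * ⟦ l ≤ᵇ length u ⟧) * ((rowWeight x′ v * y ^ b) * I v k))
        ≈⟨ solve 6 (λ i f z r p s → i :* ((f :* z) :* ((r :* p) :* s)) := z :*
            (p :* ((i :* (f :* r)) :* s))) refl
             ⟦ increasing v ⟧ ⟦ fits v u ⟧ ⟦ l ≤ᵇ length u ⟧ (rowWeight x′ v) (y ^ b) (I v k) ⟩
      ⟦ l ≤ᵇ length u ⟧ * (y ^ b * (coefficient v * I v k)) ∎
      where b = l ∸ k

  -- Erasing the largest letter leaves a tableau whose shape `k ∷ μ` interlaces `l ∷ L`. No row lies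
  -- above the first one, so k is bounded by l alone.
  schurSum-branch : ∀ (x : Vector Carrier (suc n)) l L →
    schurSum (suc n) x (l ∷ L) ≈
    sumOver (upTo (suc l)) (λ k → x (fromℕ n) ^ (l ∸ k) *
      interlacing (x (fromℕ n)) k (λ μ → schurSum n (x ∘ inject₁) (k ∷ μ)) L)
  schurSum-branch {n} x l L = begin
    schurSum (suc n) x (l ∷ L)
      ≈⟨ trans (schurSum-∷ (suc n) x l L) (sum-rows n l) ⟩
    sumOver (upTo (suc l)) (λ k → sumOver (rows n k) (λ v → ⟦ increasing v ⟧ *
      (rowWeight x (lift v (l ∸ k)) * belowSum (suc n) x (lift v (l ∸ k)) L)))
      ≈⟨ sum-cong (upTo (suc l)) (λ k → trans
           (sum-cong-All (length-rows n k) (λ v |v|≡k → rearrange v k |v|≡k))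
           (sum-*ˡ (rows n k) _)) ⟩
    sumOver (upTo (suc l)) (λ k → y ^ (l ∸ k) * sumOver (rows n k)
        (λ v → (⟦ increasing v ⟧ * rowWeight x′ v) * I v k))
      ≈⟨ sum-cong (upTo (suc l)) (λ k → *-congˡ (trans
           (sym (interlacing-sum y k (rows n k) _ (belowSum n x′) L))
           (interlacing-cong y k (λ μ → sym (trans (schurSum-∷ n x′ k μ)
              (sum-cong (rows n k) (λ v → sym (*-assoc _ _ _))))) L))) ⟩
    sumOver (upTo (suc l)) (λ k → y ^ (l ∸ k) * interlacing y k (λ μ → schurSum n x′ (k ∷ μ)) L) ∎
    where
    y = x (fromℕ n)
    x′ = x ∘ inject₁
    I : List (Fin n) → ℕ → Carrier
    I v k = interlacing y k (belowSum n x′ v) L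

    rearrange : ∀ v k → length v ≡ k →
      ⟦ increasing v ⟧ * (rowWeight x (lift v (l ∸ k)) * belowSum (suc n) x (lift v (l ∸ k)) L) ≈
      y ^ (l ∸ k) * ((⟦ increasing v ⟧ * rowWeight x′ v) * I v k)
    rearrange v k ≡.refl = begin
      ⟦ increasing v ⟧ * (rowWeight x (lift v b) * belowSum (suc n) x (lift v b) L)
        ≈⟨ *-congˡ (*-cong (rowWeight-lift x v b) (belowSum-lift x L v b)) ⟩
      ⟦ increasing v ⟧ * ((rowWeight x′ v * y ^ b) * I v k)
        ≈⟨ solve 4 (λ i r p s → i :* ((r :* p) :* s) := p :* ((i :* r) :* s)) refl
             ⟦ increasing v ⟧ (rowWeight x′ v) (y ^ b) (I v k) ⟩
      y ^ b * ((⟦ increasing v ⟧ * rowWeight x′ v) * I v k) ∎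
      where b = l ∸ k

  -- Interlacing makes each part of `p ∷ μ` at least the part of the given list in the same
  -- position, so `suc k` forces a positive part there.
  interlacing-vanishes : ∀ y p {f} L₁ {k L₂} →
    (∀ M₁ m M₂ → length M₁ ≡ length L₁ → f (M₁ ++ suc m ∷ M₂) ≈ 0#) →
    interlacing y p (f ∘ (p ∷_)) (L₁ ++ suc k ∷ L₂) ≈ 0#
  interlacing-vanishes y zero    []       f≈0 = zeroˡ _
  interlacing-vanishes y (suc p) {f} [] {k} {L₂} f≈0 = trans
      (*-congˡ (sum-vanishes (upTo (suc (suc k))) (λ j →
    trans (*-congˡ (trans (interlacing-cong y j (λ μ → f≈0 [] p (j ∷ μ) ≡.refl) L₂)
        (interlacing-zero j L₂))) (zeroʳ _)))) (zeroʳ _)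
    where
    interlacing-zero : ∀ j L → interlacing y j (λ _ → 0#) L ≈ 0#
    interlacing-zero j []      = refl
    interlacing-zero j (l ∷ L) = trans (*-congˡ (sum-vanishes (upTo (suc l)) (λ i →
      trans (*-congˡ (interlacing-zero i L)) (zeroʳ _)))) (zeroʳ _)
  interlacing-vanishes y p {f} (l ∷ L₁) f≈0 = trans (*-congˡ (sum-vanishes (upTo (suc l)) (λ j →
    trans (*-congˡ (interlacing-vanishes y j {f ∘ (p ∷_)} L₁ (λ M₁ m M₂ eq → f≈0 (p ∷ M₁) m M₂
        (≡.cong suc eq)))) (zeroʳ _)))) (zeroʳ _)

  -- Columns increase strictly, so n letters fill at most n nonempty rows. Erasing the largest
  -- letter keeps a positive part, now with one part fewer before it.
  schurSum-vanishes : ∀ n (x : Vector Carrier n) L₁ k L₂ → length L₁ ≡ n → schurSum n x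
      (L₁ ++ suc k ∷ L₂) ≈ 0#
  schurSum-vanishes zero    x []       k L₂ eq = refl
  schurSum-vanishes (suc n) x (l ∷ L₁) k L₂ eq = trans (schurSum-branch x l (L₁ ++ suc k ∷ L₂))
    (sum-vanishes (upTo (suc l))
        (λ j → trans (*-congˡ (interlacing-vanishes (x (fromℕ n)) j {schurSum n (x ∘ inject₁)} L₁
      (λ M₁ m M₂ eq′ → schurSum-vanishes n (x ∘ inject₁) M₁ m M₂
          (≡.trans eq′ (ℕ.suc-injective eq))))) (zeroʳ _)))

  private
    sum-trim : ∀ n L {f : Filling n → Carrier} →
      sumOver (fillingsOf n (L ++ [ 0 ])) f ≈ sumOver (fillingsOf n L) (λ T → f (T ++ [ [] ]))
    sum-trim n []      = refl
    sum-trim n (l ∷ L) {f} = begin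
      sumOver (fillingsOf n (l ∷ L ++ [ 0 ])) f
        ≈⟨ trans (sum-product (rows n l) (fillingsOf n (L ++ [ 0 ])))
            (sum-cong (rows n l) (λ v → sum-trim n L)) ⟩
      sumOver (rows n l) (λ v → sumOver (fillingsOf n L) (λ T → f (v ∷ T ++ [ [] ])))
        ≈⟨ sum-product (rows n l) (fillingsOf n L) ⟨
      sumOver (fillingsOf n (l ∷ L)) (λ T → f (T ++ [ [] ])) ∎

    below-trim : ∀ (u : List (Fin n)) T → semistandardBelow u (T ++ [ [] ]) ≡ semistandardBelow u T
    below-trim u []      = ≡.refl
    below-trim u (v ∷ T) = ≡.cong (λ b → increasing v ∧ (fits v u ∧ b)) (below-trim v T)

    semistandard-trim : ∀ (T : Filling n) → semistandard (T ++ [ [] ]) ≡ semistandard T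
    semistandard-trim []      = ≡.refl
    semistandard-trim (v ∷ T) = ≡.trans (semistandard-∷ v (T ++ [ [] ]))
      (≡.trans (≡.cong (increasing v ∧_) (below-trim v T)) (≡.sym (semistandard-∷ v T)))

    concat-trim : ∀ (T : Filling n) → concat (T ++ [ [] ]) ≡ concat T
    concat-trim []      = ≡.refl
    concat-trim (v ∷ T) = ≡.cong (v ++_) (concat-trim T)

  -- Erasing a letter does not shorten the list of row lengths, while an alternant in n variables
  -- has n exponents. Dropping a zero last part restores the balance.
  schurSum-trim : ∀ n (x : Vector Carrier n) L → schurSum n x (L ++ [ 0 ]) ≈ schurSum n x L
  schurSum-trim n x L = trans (sum-trim n L) (sum-cong (fillingsOf n L) (λ T →
    *-cong (⟦⟧-cong (semistandard-trim T)) (reflexive (≡.cong (rowWeight x) (concat-trim T)))))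

-- Beta sets and the bialternant formula

betaList : List ℕ → List ℕ
betaList []      = []
betaList (l ∷ L) = l ℕ.+ length L ∷ betaList L

beta-toList : ∀ (lam : Vector ℕ n) → beta lam ≡ betaList (Vector.toList lam)
beta-toList {zero}  lam = ≡.refl
beta-toList {suc n} lam = ≡.cong₂ _∷_
  (≡.cong (lam Fin.zero ℕ.+_) (≡.sym (List.length-tabulate (lam ∘ Fin.suc))))
  (beta-toList (lam ∘ Fin.suc))

partition-linked : ∀ {lam : Vector ℕ n} → IsPartition lam → Linked ℕ._≥_ (Vector.toList lam)
partition-linked {zero}        p = []
partition-linked {suc zero}    p = [-]
partition-linked {suc (suc n)} p = p {Fin.zero} {Fin.suc Fin.zero} ℕ.z≤n ∷ partition-linked
    (λ i≤j → p (ℕ.s≤s i≤j))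

betaList-linked : ∀ {L} → Linked ℕ._≥_ L → Linked ℕ._>_ (betaList L)
betaList-linked []                      = []
betaList-linked [-]                     = [-]
betaList-linked {l ∷ m ∷ L} (l≥m ∷ L↘) =
  ≡.subst (ℕ._> m ℕ.+ length L) (≡.sym (ℕ.+-suc l (length L))) (ℕ.s≤s (ℕ.+-monoˡ-≤ (length L) l≥m))
  ∷ betaList-linked L↘

beta-linked : ∀ {lam : Vector ℕ n} → IsPartition lam → Linked ℕ._>_ (beta lam)
beta-linked {lam = lam} p =
  ≡.subst (Linked ℕ._>_) (≡.sym (beta-toList lam)) (betaList-linked (partition-linked p))

module Bialternant {c ℓ} (R : CommutativeRing c ℓ) where
  open CommutativeRing R
  open Contraction R
  open AlternatingForms R
  open ListSums R
  open Branching R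
  open Tableaux R
  open SchurBranching R
  open SemiringExp semiring
  open IntegerSolver R
  open SetoidReasoning setoid

  private
    sum-from : ∀ y {l} m {h : ℕ → Carrier} → m ℕ.≤ l →
      sumOver (upTo (suc l)) (λ k → y ^ (l ∸ k) * (⟦ m ≤ᵇ k ⟧ * h k)) ≈
      sumOver (upTo (suc (l ∸ m))) (λ j → y ^ (l ∸ m ∸ j) * h (m ℕ.+ j))
    sum-from y {l} zero _ = sum-cong (upTo (suc l)) (λ k → *-congˡ (*-identityˡ _))
    sum-from y {suc l} (suc m) {h} (ℕ.s≤s m≤l) = begin
      sumOver (upTo (suc (suc l))) (λ k → y ^ (suc l ∸ k) * (⟦ suc m ≤ᵇ k ⟧ * h k))
        ≈⟨ sum-upTo (suc l) ⟩
      y ^ suc l * (0# * h 0) + sumOver (upTo (suc l))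
          (λ k → y ^ (l ∸ k) * (⟦ suc m ≤ᵇ suc k ⟧ * h (suc k)))
        ≈⟨ +-cong (trans (*-congˡ (zeroˡ _)) (zeroʳ _))
                  (sum-cong (upTo (suc l)) (λ k → *-congˡ (*-congʳ (⟦⟧-cong (≤ᵇ-suc m k))))) ⟩
      0# + sumOver (upTo (suc l)) (λ k → y ^ (l ∸ k) * (⟦ m ≤ᵇ k ⟧ * h (suc k)))
        ≈⟨ trans (+-identityˡ _) (sum-from y m {h ∘ suc} m≤l) ⟩
      sumOver (upTo (suc (l ∸ m))) (λ j → y ^ (l ∸ m ∸ j) * h (suc m ℕ.+ j)) ∎

  -- For c = k + length L the condition l′ ≤ k ≤ l reads b′ ≤ c < b, because the gap b - b′ is one
  -- more than l - l′. The part left in last place after erasing a letter must be zero, so in the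
  -- base case all of y^l splits off.
  interlacing-branch : ∀ y l L {f g} → Linked ℕ._≥_ (l ∷ L) →
    (∀ μ → length μ ≡ length L → Linked ℕ._≥_ (l ∷ μ) → f (μ ++ [ 0 ]) ≈ g (betaList μ)) →
    (∀ μ k → length μ ≡ length L → f (μ ++ [ suc k ]) ≈ 0#) →
    sumOver (upTo (suc l)) (λ k → y ^ (l ∸ k) * interlacing y k (f ∘ (k ∷_)) L) ≈
    branch y g (l ℕ.+ length L) (betaList L)
  interlacing-branch y l [] {f} {g} _ f≈g f≈0 = begin
    sumOver (upTo (suc l)) (λ k → y ^ (l ∸ k) * f [ k ])
      ≈⟨ sum-upTo l ⟩
    y ^ l * f [ 0 ] + sumOver (upTo l) (λ k → y ^ (l ∸ suc k) * f [ suc k ])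
      ≈⟨ +-cong (*-cong (^-congʳ y (≡.sym (ℕ.+-identityʳ l))) (f≈g [] ≡.refl [-]))
                (sum-vanishes (upTo l) (λ k → trans (*-congˡ (f≈0 [] k ≡.refl)) (zeroʳ _))) ⟩
    y ^ (l ℕ.+ 0) * g [] + 0#
      ≈⟨ +-identityʳ _ ⟩
    y ^ (l ℕ.+ 0) * g [] ∎
  interlacing-branch y l (l′ ∷ L) {f} {g} (l≥l′ ∷ L↘) f≈g f≈0 = begin
    sumOver (upTo (suc l)) (λ k → y ^ (l ∸ k) * (⟦ l′ ≤ᵇ k ⟧ *
      sumOver (upTo (suc l′)) (λ j → y ^ (l′ ∸ j) * interlacing y j (f ∘ (k ∷_) ∘ (j ∷_)) L)))
      ≈⟨ sum-cong-All (All.all-upTo (suc l)) (λ k k≤l → *-congˡ (inner k (ℕ.≤-pred k≤l))) ⟩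
    sumOver (upTo (suc l)) (λ k → y ^ (l ∸ k) * (⟦ l′ ≤ᵇ k ⟧ * B (k ℕ.+ length L)))
      ≈⟨ sum-from y l′ {λ k → B (k ℕ.+ length L)} l≥l′ ⟩
    sumOver (upTo (suc (l ∸ l′))) (λ j → y ^ (l ∸ l′ ∸ j) * B (l′ ℕ.+ j ℕ.+ length L))
      ≈⟨ sum-cong (upTo (suc (l ∸ l′)))
          (λ j → *-congˡ (reflexive (≡.cong B (swap-right l′ j (length L))))) ⟩
    sumOver (upTo (suc (l ∸ l′))) (λ j → y ^ (l ∸ l′ ∸ j) * B (l′ ℕ.+ length L ℕ.+ j))
      ≡⟨ ≡.cong (λ d → sumOver (upTo d) (λ j → y ^ (d ∸ suc j) * B (l′ ℕ.+ length L ℕ.+ j))) gap ⟨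
    branch y g (l ℕ.+ length (l′ ∷ L)) (betaList (l′ ∷ L)) ∎
    where
    B : ℕ → Carrier
    B b = branch y (g ∘ (b ∷_)) (l′ ℕ.+ length L) (betaList L)

    swap-right : ∀ a b d → a ℕ.+ b ℕ.+ d ≡ a ℕ.+ d ℕ.+ b
    swap-right a b d = ≡.trans (ℕ.+-assoc a b d) (≡.trans (≡.cong (a ℕ.+_) (ℕ.+-comm b d))
        (≡.sym (ℕ.+-assoc a d b)))

    gap : l ℕ.+ suc (length L) ∸ (l′ ℕ.+ length L) ≡ suc (l ∸ l′)
    gap = ≡.trans (≡.cong₂ _∸_ (≡.trans (ℕ.+-suc l (length L)) (ℕ.+-comm (suc l) (length L)))
        (ℕ.+-comm l′ (length L)))
          (≡.trans (ℕ.[m+n]∸[m+o]≡n∸o (length L) (suc l) l′) (ℕ.+-∸-assoc 1 l≥l′))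

    inner : ∀ k → k ℕ.≤ l →
      ⟦ l′ ≤ᵇ k ⟧ * sumOver (upTo (suc l′)) (λ j → y ^ (l′ ∸ j) * interlacing y j
          (f ∘ (k ∷_) ∘ (j ∷_)) L) ≈
      ⟦ l′ ≤ᵇ k ⟧ * B (k ℕ.+ length L)
    -- The comparison of `f` with `g` is available for partitions only, that is for l′ ≤ k;
    -- otherwise the bracket makes both sides zero.
    inner k k≤l with l′ ℕ.≤? k
    ... | yes l′≤k = *-congˡ (interlacing-branch y l′ L {f ∘ (k ∷_)} {g ∘ (k ℕ.+ length L ∷_)} L↘
            (λ μ |μ| μ↘ → trans (f≈g (k ∷ μ) (≡.cong suc |μ|) (k≤l ∷ raise μ↘))
                                 (reflexive (≡.cong (λ m → g (k ℕ.+ m ∷ betaList μ)) |μ|)))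
            (λ μ m |μ| → f≈0 (k ∷ μ) m (≡.cong suc |μ|)))
      where
      raise : ∀ {μ} → Linked ℕ._≥_ (l′ ∷ μ) → Linked ℕ._≥_ (k ∷ μ)
      raise [-]           = [-]
      raise (l′≥m ∷ μ↘) = ℕ.≤-trans l′≥m l′≤k ∷ μ↘
    ... | no l′≰k = trans (vanish _) (sym (vanish _))
      where
      vanish : ∀ v → ⟦ l′ ≤ᵇ k ⟧ * v ≈ 0#
      vanish v = trans (*-congʳ (⟦⟧-cong (dec-false (l′ ℕ.≤? k) l′≰k))) (zeroˡ v)

  vandermonde : List Carrier → Carrier
  vandermonde []       = 1#
  vandermonde (x ∷ xs) = foldr (λ y v → (y - x) * v) 1# xs * vandermonde xs

  vandermonde-∷ʳ : ∀ xs y → vandermonde (xs ++ [ y ]) ≈ differences y xs * vandermonde xs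
  vandermonde-∷ʳ []       y = refl
  vandermonde-∷ʳ (x ∷ xs) y = trans (*-cong (last xs) (vandermonde-∷ʳ xs y))
    (solve 4 (λ d p q v → (d :* p) :* (q :* v) := (d :* q) :* (p :* v)) refl (y - x) _
        (differences y xs) (vandermonde xs))
    where
    last : ∀ zs → foldr (λ z v → (z - x) * v) 1# (zs ++ [ y ]) ≈ (y - x) * foldr
        (λ z v → (z - x) * v) 1# zs
    last []       = refl
    last (z ∷ zs) = trans (*-congˡ (last zs)) (solve 3 (λ a b c → a :* (b :* c) := b :* (a :* c))
        refl _ _ _)

  private
    det-∷ʳ : ∀ (xs : List Carrier) y us → det (xs ++ [ y ]) us ≡ expand (at y) (det xs) us
    det-∷ʳ xs y us = ≡.cong (λ F → F us) (List.foldl-++ _ empty xs [ y ])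

  -- By induction on the number of variables. The Vandermonde determinant stays on the right as a
  -- factor, so nothing is divided and the identity holds over every commutative ring.
  bialternant : ∀ n (x : Vector Carrier n) L → length L ≡ n → Linked ℕ._≥_ L →
    det (List.tabulate x) (map monomial (betaList L)) ≈ vandermonde (List.tabulate x) * schurSum n x
        L
  bialternant zero    x []      eq _  = sym
      (trans (*-identityˡ _) (trans (+-identityʳ _) (*-identityˡ _)))
  bialternant (suc n) x (l ∷ L) eq L↘ = begin
    det (List.tabulate x) (map monomial (betaList (l ∷ L)))
      ≡⟨ ≡.trans (≡.cong (λ xs → det xs (map monomial (betaList (l ∷ L)))) (tabulate-∷ʳ x))
          (det-∷ʳ xs y _) ⟩
    expand (at y) (det xs) (map monomial (betaList (l ∷ L)))
      ≈⟨ det-branch y xs (Linked.map ℕ.<⇒≤ (betaList-linked L↘)) ⟩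
    differences y xs * branch y (det xs ∘ map monomial) (l ℕ.+ length L) (betaList L)
      ≈⟨ *-congˡ (interlacing-branch y l L {λ μ → vandermonde xs * schurSum n x′ μ}
          {det xs ∘ map monomial} L↘
           (λ μ |μ| μ↘ → trans (*-congˡ (schurSum-trim n x′ μ))
                                (sym (bialternant n x′ μ (≡.trans |μ| |L|) (Linked.tail μ↘))))
           -- With n + 1 rows and n letters, a positive last part leaves no tableau.
           (λ μ k |μ| → trans (*-congˡ (schurSum-vanishes n x′ μ k [] (≡.trans |μ| |L|)))
               (zeroʳ _))) ⟨
    differences y xs * sumOver (upTo (suc l)) (λ k → y ^ (l ∸ k) * interlacing y k
        (λ μ → vandermonde xs * schurSum n x′ (k ∷ μ)) L)
      ≈⟨ *-congˡ (sum-cong (upTo (suc l)) (λ k → trans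
           (*-congˡ (interlacing-scale k L))
           (solve 3 (λ a b c → a :* (b :* c) := b :* (a :* c)) refl _ _ _))) ⟩
    differences y xs * sumOver (upTo (suc l)) (λ k → vandermonde xs * (y ^ (l ∸ k) * interlacing y k
        (λ μ → schurSum n x′ (k ∷ μ)) L))
      ≈⟨ *-congˡ (sum-*ˡ (upTo (suc l)) _) ⟩
    differences y xs * (vandermonde xs * sumOver (upTo (suc l)) (λ k → y ^ (l ∸ k) * interlacing y k
        (λ μ → schurSum n x′ (k ∷ μ)) L))
      ≈⟨ *-congˡ (*-congˡ (schurSum-branch x l L)) ⟨
    differences y xs * (vandermonde xs * schurSum (suc n) x (l ∷ L))
      ≈⟨ *-assoc _ _ _ ⟨
    (differences y xs * vandermonde xs) * schurSum (suc n) x (l ∷ L)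
      ≈⟨ *-congʳ (vandermonde-∷ʳ xs y) ⟨
    vandermonde (xs ++ [ y ]) * schurSum (suc n) x (l ∷ L)
      ≡⟨ ≡.cong (λ zs → vandermonde zs * schurSum (suc n) x (l ∷ L)) (tabulate-∷ʳ x) ⟨
    vandermonde (List.tabulate x) * schurSum (suc n) x (l ∷ L) ∎
    where
    y = x (fromℕ n)
    x′ = x ∘ inject₁
    xs = List.tabulate x′
    |L| = ℕ.suc-injective eq
    interlacing-scale : ∀ {f} k L → interlacing y k (λ μ → vandermonde xs * f μ) L ≈ vandermonde xs
        * interlacing y k f L
    interlacing-scale {f} k L = trans
      (interlacing-cong y k (λ μ → sym (+-identityʳ _)) L)
      (trans (interlacing-sum y k [ vandermonde xs ] id (λ _ → f) L) (+-identityʳ _))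

-- Counting elements of residue classes

open CommutativeMonoidSum ℕ.+-0-commutativeMonoid using (sum; sum-replicate-zero; ∑-distrib-+;
    sum-cong-≗)

module _ {a p} {A : Set a} {P : A → Set p} (P? : Decidable P) where

  filter-↭-++ : ∀ xs → xs ↭ filter P? xs ++ filter (¬? ∘ P?) xs
  filter-↭-++ []       = ↭.refl
  filter-↭-++ (x ∷ xs) with does (P? x)
  ... | true  = ↭.prep x (filter-↭-++ xs)
  ... | false = ↭-trans (↭.prep x (filter-↭-++ xs)) (↭-sym (↭.shift x _ _))

  filter-filter : ∀ {q} {Q : A → Set q} (Q? : Decidable Q) → (∀ {x} → Q x → P x) →
                  ∀ xs → filter Q? (filter P? xs) ≡ filter Q? xs
  filter-filter Q? Q⇒P []       = ≡.refl
  filter-filter Q? Q⇒P (x ∷ xs) with P? x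
  ... | no ¬Px = ≡.trans (filter-filter Q? Q⇒P xs) (≡.sym (List.filter-reject Q? (¬Px ∘ Q⇒P)))
  ... | yes _ with does (Q? x)
  ...   | true  = ≡.cong (x ∷_) (filter-filter Q? Q⇒P xs)
  ...   | false = filter-filter Q? Q⇒P xs

private
  ExactlyOne : ∀ {n} → ℕ → (Fin n → ℕ) → Set
  ExactlyOne k g = ∃[ r ] g r ≡ k × (∀ s → s ≢ r → g s ≡ 0)

  sum≡0 : ∀ {n} (g : Fin n → ℕ) → sum g ≡ 0 → ∀ r → g r ≡ 0
  sum≡0 g eq Fin.zero    = ℕ.m+n≡0⇒m≡0 (g Fin.zero) eq
  sum≡0 g eq (Fin.suc r) = sum≡0 (g ∘ Fin.suc) (ℕ.m+n≡0⇒n≡0 (g Fin.zero) eq) r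

  here-only : ∀ {n k} {g : Fin (suc n) → ℕ} → g Fin.zero ≡ k → (∀ r → g (Fin.suc r) ≡ 0) →
      ExactlyOne k g
  here-only eq rest = Fin.zero , eq , λ { Fin.zero 0≢0 → contradiction ≡.refl 0≢0 ; (Fin.suc s) _ → rest s }

  there-only : ∀ {n k} {g : Fin (suc n) → ℕ} → g Fin.zero ≡ 0 → ExactlyOne k (g ∘ Fin.suc) →
      ExactlyOne k g
  there-only eq (r , gr , rest) =
    Fin.suc r , gr , λ { Fin.zero _ → eq ; (Fin.suc s) s≢r → rest s (s≢r ∘ ≡.cong Fin.suc) }

  sum≡1 : ∀ {n} (g : Fin n → ℕ) → sum g ≡ 1 → ExactlyOne 1 g
  sum≡1 {suc n} g eq with g Fin.zero in g0
  ... | 0 = there-only g0 (sum≡1 (g ∘ Fin.suc) eq)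
  ... | 1 = here-only g0 (sum≡0 (g ∘ Fin.suc) (ℕ.suc-injective eq))

  ExactlyTwo : ∀ {n} → (Fin n → ℕ) → Set
  ExactlyTwo g = ∃[ r ] ∃[ s ] r Fin.< s × g r ≡ 1 × g s ≡ 1 × (∀ q → q ≢ r → q ≢ s → g q ≡ 0)

  sum≡2 : ∀ {n} (g : Fin n → ℕ) → sum g ≡ 2 → ExactlyOne 2 g ⊎ ExactlyTwo g
  sum≡2 {suc n} g eq with g Fin.zero in g0
  ... | 2 = inj₁ (here-only g0 (sum≡0 (g ∘ Fin.suc) (ℕ.suc-injective (ℕ.suc-injective eq))))
  ... | 1 with r , gr , rest ← sum≡1 (g ∘ Fin.suc) (ℕ.suc-injective eq) =
    inj₂ (Fin.zero , Fin.suc r , ℕ.z<s , g0 , gr ,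
      λ { Fin.zero 0≢0 _ → contradiction ≡.refl 0≢0 ; (Fin.suc q) _ q≢r → rest q (q≢r ∘ ≡.cong Fin.suc) })
  ... | 0 with sum≡2 (g ∘ Fin.suc) eq
  ...   | inj₁ one = inj₁ (there-only g0 one)
  ...   | inj₂ (r , s , r<s , gr , gs , rest) =
    inj₂ (Fin.suc r , Fin.suc s , ℕ.s<s r<s , gr , gs ,
      λ { Fin.zero _ _ → g0 ; (Fin.suc q) q≢r q≢s → rest q (q≢r ∘ ≡.cong Fin.suc) (q≢s ∘ ≡.cong Fin.suc) })

  sum-suc : ∀ {n} (g : Fin n → ℕ) → sum (suc ∘ g) ≡ n ℕ.+ sum g
  sum-suc {zero}  g = ≡.refl
  sum-suc {suc n} g = ≡.cong suc (≡.trans (≡.cong (g Fin.zero ℕ.+_) (sum-suc (g ∘ Fin.suc)))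
    (≡.trans (≡.sym (ℕ.+-assoc (g Fin.zero) n _))
        (≡.trans (≡.cong (ℕ._+ sum (g ∘ Fin.suc)) (ℕ.+-comm (g Fin.zero) n)) (ℕ.+-assoc n _ _))))

  indicator-sum : ∀ t m → m ℕ.< t → sum {t} (λ r → if m ℕ.≡ᵇ toℕ r then 1 else 0) ≡ 1
  indicator-sum (suc t) zero    _           = ≡.cong suc (sum-replicate-zero t)
  indicator-sum (suc t) (suc m) (ℕ.s≤s m<t) = indicator-sum t m m<t

-- The single occurrence of the largest value moves to the front; taking it out leaves the counts of
-- the smaller values unchanged.
occurring-once : ∀ t xs → All (ℕ._< t) xs → (∀ r → r ℕ.< t → length (filter (ℕ._≟ r) xs) ≡ 1) →
    xs ↭ downFrom t
occurring-once zero    []       _        once = ↭.refl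
occurring-once zero    (_ ∷ _)  (() ∷ _) once
occurring-once (suc t) xs       xs<      once with filter (ℕ._≟ t) xs in eq | once t ℕ.≤-refl |
    All.all-filter (ℕ._≟ t) xs
... | y ∷ [] | _ | ≡.refl ∷ [] = ↭-trans (filter-↭-++ (ℕ._≟ t) xs)
  (↭-trans (↭-reflexive (≡.cong (_++ others) eq))
    (↭.prep t (occurring-once t others
      (All.zipWith (λ (x≢t , x<) → ℕ.≤∧≢⇒< (ℕ.≤-pred x<) x≢t) (All.all-filter (¬? ∘ (ℕ._≟ t)) xs ,
          All.filter⁺ (¬? ∘ (ℕ._≟ t)) xs<))
      (λ r r<t → ≡.trans (≡.cong length (filter-filter (¬? ∘ (ℕ._≟ t)) (ℕ._≟ r) (λ { ≡.refl → ℕ.<⇒≢ r<t }) xs))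
                          (once r (ℕ.m≤n⇒m≤1+n r<t))))))
  where others = filter (¬? ∘ (ℕ._≟ t)) xs

module Residues (t : ℕ) .{{_ : NonZero t}} where

  class : List ℕ → Fin t → List ℕ
  class xs r = filter (λ b → b % t ℕ.≟ toℕ r) xs

  count : List ℕ → Fin t → ℕ
  count xs r = length (class xs r)

  count-∷ : ∀ x xs r → count (x ∷ xs) r ≡ (if x % t ℕ.≡ᵇ toℕ r then 1 else 0) ℕ.+ count xs r
  count-∷ x xs r with x % t ℕ.≡ᵇ toℕ r
  ... | true  = ≡.refl
  ... | false = ≡.refl

  count-↭ : ∀ {xs ys} → xs ↭ ys → ∀ r → count xs r ≡ count ys r
  count-↭ p r = ↭.↭-length (↭.filter-↭ (λ b → b % t ℕ.≟ toℕ r) p)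

  sum-count : ∀ xs → sum (count xs) ≡ length xs
  sum-count []       = sum-replicate-zero t
  sum-count (x ∷ xs) = ≡.trans (sum-cong-≗ (count-∷ x xs))
    (≡.trans (∑-distrib-+ (λ r → if x % t ℕ.≡ᵇ toℕ r then 1 else 0) (count xs))
             (≡.cong₂ ℕ._+_ (indicator-sum t (x % t) (ℕ.m%n<n x t)) (sum-count xs)))

  EachOnce : List ℕ → Set
  EachOnce xs = ∀ r → count xs r ≡ 1

  residues-↭ : ∀ {xs} → EachOnce xs → map (_% t) xs ↭ downFrom t
  residues-↭ {xs} once = occurring-once t (map (_% t) xs)
      (All.map⁺ (All.universal (λ x → ℕ.m%n<n x t) xs))
    (λ r r<t → ≡.trans (≡.sym (count-map r r<t xs)) (once (fromℕ< r<t)))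
    where
    count-map : ∀ r (r<t : r ℕ.< t) ys → count ys (fromℕ< r<t) ≡ length
        (filter (ℕ._≟ r) (map (_% t) ys))
    count-map r r<t []       = ≡.refl
    count-map r r<t (y ∷ ys) rewrite Fin.toℕ-fromℕ< r<t with y % t ℕ.≡ᵇ r
    ... | true  = ≡.cong suc (≡.trans (≡.cong (λ k → length (filter (λ b → b % t ℕ.≟ k) ys))
        (≡.sym (Fin.toℕ-fromℕ< r<t))) (count-map r r<t ys))
    ... | false = ≡.trans (≡.cong (λ k → length (filter (λ b → b % t ℕ.≟ k) ys))
        (≡.sym (Fin.toℕ-fromℕ< r<t))) (count-map r r<t ys)

  class-residue : ∀ {xs r x ys} → class xs r ≡ x ∷ ys → All (λ b → b % t ≡ toℕ r) (x ∷ ys)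
  class-residue {xs} {r} eq = ≡.subst (All _) eq (All.all-filter (λ b → b % t ℕ.≟ toℕ r) xs)

  -- The set xs is the disjoint union of {a₁, b₁} and the last argument.
  data Split (xs : List ℕ) : (a₁ a₂ b₁ b₂ : ℕ) → List ℕ → Set where
    disjoint    : ∀ {a₁ a₂ b₁ b₂ ys} → xs ↭ a₁ ∷ a₂ ∷ b₁ ∷ b₂ ∷ ys → Split xs a₁ a₂ b₁ b₂
        (a₂ ∷ b₂ ∷ ys)
    overlapping : ∀ {p q r ys} → xs ↭ p ∷ q ∷ r ∷ ys → Split xs p q q r (r ∷ ys)

  -- What the determinant computation uses, uniformly for two double classes and for a triple one:
  -- without a₁ and b₁ the beta set is a complete system of residues.
  record PairStructure (xs : List ℕ) (a₁ a₂ b₁ b₂ : ℕ) : Set where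
    field
      {rest} : List ℕ
      split  : Split xs a₁ a₂ b₁ b₂ rest
      once   : EachOnce rest
      a₁>a₂  : a₁ ℕ.> a₂
      b₁>b₂  : b₁ ℕ.> b₂
      a-congruent : a₁ % t ≡ a₂ % t
      b-congruent : b₁ % t ≡ b₂ % t

  private
    count-hit : ∀ {x r} xs → x % t ≡ toℕ r → count (x ∷ xs) r ≡ suc (count xs r)
    count-hit {r = r} xs eq = ≡.cong length (List.filter-accept (λ b → b % t ℕ.≟ toℕ r) eq)

    count-miss : ∀ {x r s} xs → x % t ≡ toℕ r → s ≢ r → count (x ∷ xs) s ≡ count xs s
    count-miss {r = r} {s} xs eq s≢r = ≡.cong length (List.filter-reject (λ b → b % t ℕ.≟ toℕ s)
      (λ eq′ → s≢r (Fin.toℕ-injective (≡.trans (≡.sym eq′) eq))))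

  module _ {n} (lam : Vector ℕ n) (beta↘ : Linked ℕ._>_ (beta lam)) where

    class-linked : ∀ r → Linked ℕ._>_ (residueClass t lam r)
    class-linked r = Linked.filter⁺ (λ b → b % t ℕ.≟ toℕ r) (flip ℕ.<-trans) beta↘

    pairStructure : ∀ {a₁ a₂ b₁ b₂} → Pairs t lam a₁ a₂ b₁ b₂ → PairStructure (beta lam) a₁ a₂ b₁ b₂
    pairStructure {a₁} {a₂} {b₁} {b₂} (twoDoubles rA rB rA<rB eqA eqB others)
      with class-residue {beta lam} eqA | class-residue {beta lam} eqB
         | ≡.subst (Linked ℕ._>_) eqA (class-linked rA) | ≡.subst (Linked ℕ._>_) eqB
             (class-linked rB)
    ... | a₁∈ ∷ a₂∈ ∷ [] | b₁∈ ∷ b₂∈ ∷ [] | a₁>a₂ ∷ _ | b₁>b₂ ∷ _ = record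
      { split = disjoint split
      ; once  = once
      ; a₁>a₂ = a₁>a₂
      ; b₁>b₂ = b₁>b₂
      ; a-congruent = ≡.trans a₁∈ (≡.sym a₂∈)
      ; b-congruent = ≡.trans b₁∈ (≡.sym b₂∈)
      }
      where
      A? = λ b → b % t ℕ.≟ toℕ rA
      B? = λ b → b % t ℕ.≟ toℕ rB
      rA≢rB : rA ≢ rB
      rA≢rB eq = ℕ.<-irrefl (≡.cong toℕ eq) rA<rB
      ys = filter (¬? ∘ A?) (beta lam)
      zs = filter (¬? ∘ B?) ys
      split : beta lam ↭ a₁ ∷ a₂ ∷ b₁ ∷ b₂ ∷ zs
      split = ↭-trans (filter-↭-++ A? (beta lam)) (↭-trans (↭-reflexive (≡.cong (_++ ys) eqA))
        (↭.prep a₁ (↭.prep a₂ (↭-trans (filter-↭-++ B? ys) (↭-reflexive (≡.cong (_++ zs) (≡.trans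
          (filter-filter (¬? ∘ A?) B?
              (λ b∈B b∈A → rA≢rB (Fin.toℕ-injective (≡.trans (≡.sym b∈A) b∈B))) (beta lam))
                  eqB)))))))
      once : EachOnce (a₂ ∷ b₂ ∷ zs)
      -- Moving b₁ next to a₁ exhibits the remaining list as a tail, so its counts are those of
      -- `beta lam` with a₁ and b₁ deducted.
      once r with r Fin.≟ rA | r Fin.≟ rB
      ... | yes ≡.refl | yes rA≡rB = contradiction rA≡rB rA≢rB
      ... | yes ≡.refl | no _ = ℕ.suc-injective (≡.trans (≡.sym total) (≡.cong length eqA))
        where
        total : count (beta lam) r ≡ suc (count (a₂ ∷ b₂ ∷ zs) r)
        total = ≡.trans (count-↭ (↭-trans split (↭.prep a₁ (↭.swap a₂ b₁ ↭.refl))) r)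
          (≡.trans (count-hit (b₁ ∷ a₂ ∷ b₂ ∷ zs) a₁∈)
              (≡.cong suc (count-miss (a₂ ∷ b₂ ∷ zs) b₁∈ rA≢rB)))
      ... | no r≢rA | yes ≡.refl = ℕ.suc-injective (≡.trans (≡.sym total) (≡.cong length eqB))
        where
        total : count (beta lam) r ≡ suc (count (a₂ ∷ b₂ ∷ zs) r)
        total = ≡.trans (count-↭ (↭-trans split (↭.prep a₁ (↭.swap a₂ b₁ ↭.refl))) r)
          (≡.trans (count-miss (b₁ ∷ a₂ ∷ b₂ ∷ zs) a₁∈ r≢rA) (count-hit (a₂ ∷ b₂ ∷ zs) b₁∈))
      ... | no r≢rA | no r≢rB = ≡.trans (≡.sym total) (others r r≢rA r≢rB)
        where
        total : count (beta lam) r ≡ count (a₂ ∷ b₂ ∷ zs) r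
        total = ≡.trans (count-↭ (↭-trans split (↭.prep a₁ (↭.swap a₂ b₁ ↭.refl))) r)
          (≡.trans (count-miss (b₁ ∷ a₂ ∷ b₂ ∷ zs) a₁∈ r≢rA) (count-miss (a₂ ∷ b₂ ∷ zs) b₁∈ r≢rB))
    pairStructure (oneTriple {p} {q} {r} s (_ , others) eq)
      with class-residue {beta lam} eq | ≡.subst (Linked ℕ._>_) eq (class-linked s)
    ... | p∈ ∷ q∈ ∷ r∈ ∷ [] | p>q ∷ q>r ∷ _ = record
      { split = overlapping split
      ; once  = once
      ; a₁>a₂ = p>q
      ; b₁>b₂ = q>r
      ; a-congruent = ≡.trans p∈ (≡.sym q∈)
      ; b-congruent = ≡.trans q∈ (≡.sym r∈)
      }
      where
      S? = λ b → b % t ℕ.≟ toℕ s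
      ys = filter (¬? ∘ S?) (beta lam)
      split : beta lam ↭ p ∷ q ∷ r ∷ ys
      split = ↭-trans (filter-↭-++ S? (beta lam)) (↭-reflexive (≡.cong (_++ ys) eq))
      once : EachOnce (r ∷ ys)
      once s′ with s′ Fin.≟ s
      ... | yes ≡.refl = ℕ.suc-injective
          (ℕ.suc-injective (≡.trans (≡.sym total) (≡.cong length eq)))
        where
        total : count (beta lam) s ≡ suc (suc (count (r ∷ ys) s))
        total = ≡.trans (count-↭ split s) (≡.trans (count-hit (q ∷ r ∷ ys) p∈)
            (≡.cong suc (count-hit (r ∷ ys) q∈)))
      ... | no s′≢s = ≡.trans (≡.sym total) (others s′ s′≢s)
        where
        total : count (beta lam) s′ ≡ count (r ∷ ys) s′
        total = ≡.trans (count-↭ split s′) (≡.trans (count-miss (q ∷ r ∷ ys) p∈ s′≢s)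
            (count-miss (r ∷ ys) q∈ s′≢s))

  private
    two-elements : ∀ {xs : List ℕ} → length xs ≡ 2 → ∃[ a ] ∃[ b ] xs ≡ a ∷ b ∷ []
    two-elements {a ∷ b ∷ []} _ = a , b , ≡.refl

    three-elements : ∀ {xs : List ℕ} → length xs ≡ 3 → ∃[ a ] ∃[ b ] ∃[ c ] xs ≡ a ∷ b ∷ c ∷ []
    three-elements {a ∷ b ∷ c ∷ []} _ = a , b , c , ≡.refl

  triple-pairs : ∀ {n} {lam : Vector ℕ n} {r} → OneTriple t lam r → ∃[ p ] ∃[ q ] ∃[ s ] Pairs t lam
      p q q s
  triple-pairs {r = r} one with p , q , s , eq ← three-elements (proj₁ one) = p , q , s , oneTriple r one eq

  -- Every class has at least one element, and the excesses over this minimum sum to 2. So either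
  -- one class has excess 2 or two classes have excess 1.
  nonempty-pairs : (lam : Vector ℕ (t ℕ.+ 2)) → (∀ r → residueClass t lam r ≢ []) →
    ∃[ a₁ ] ∃[ a₂ ] ∃[ b₁ ] ∃[ b₂ ] Pairs t lam a₁ a₂ b₁ b₂
  nonempty-pairs lam nonempty = pairs (sum≡2 excess sum-excess)
    where
    excess : Fin t → ℕ
    excess r = ℕ.pred (count (beta lam) r)
    positive : ∀ r → count (beta lam) r ≡ suc (excess r)
    positive r with residueClass t lam r in eq
    ... | []    = contradiction eq (nonempty r)
    ... | _ ∷ _ = ≡.refl
    exactly : ∀ {r k} → excess r ≡ k → count (beta lam) r ≡ suc k
    exactly eq = ≡.trans (positive _) (≡.cong suc eq)
    sum-excess : sum excess ≡ 2
    sum-excess = ℕ.+-cancelˡ-≡ t _ _ (≡.trans (≡.sym (sum-suc excess))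
      (≡.trans (sum-cong-≗ (≡.sym ∘ positive)) (≡.trans (sum-count (beta lam))
          (List.length-tabulate _))))
    pairs : ExactlyOne 2 excess ⊎ ExactlyTwo excess → ∃[ a₁ ] ∃[ a₂ ] ∃[ b₁ ] ∃[ b₂ ] Pairs t lam a₁
        a₂ b₁ b₂
    pairs (inj₁ (r , er , others))
      with p , q , s , pair ← triple-pairs {lam = lam} {r} (exactly er , λ s s≢r → exactly (others s s≢r)) =
      p , q , q , s , pair
    pairs (inj₂ (r , s , r<s , er , es , others))
      with a₁ , a₂ , eqA ← two-elements (exactly er) | b₁ , b₂ , eqB ← two-elements (exactly es) =
      a₁ , a₂ , b₁ , b₂ , twoDoubles r s r<s eqA eqB (λ q q≢r q≢s → exactly (others q q≢r q≢s))

-- Units of a commutative ring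

module Units {c ℓ} (R : CommutativeRing c ℓ) where
  open CommutativeRing R
  open RingProperties ring
  open RingFacts R
  open SemiringExp semiring
  open IntegerSolver R
  open SetoidReasoning setoid

  IsUnit : Carrier → Set (c ⊔ ℓ)
  IsUnit x = ∃[ y ] x * y ≈ 1#

  unit-cong : ∀ {x y} → x ≈ y → IsUnit x → IsUnit y
  unit-cong x≈y (u , xu) = u , trans (*-congʳ (sym x≈y)) xu

  unit-1 : IsUnit 1#
  unit-1 = 1# , *-identityˡ 1#

  unit-* : ∀ {x y} → IsUnit x → IsUnit y → IsUnit (x * y)
  unit-* {x} {y} (u , xu) (v , yv) = u * v , (begin
    (x * y) * (u * v) ≈⟨ solve 4 (λ x y u v → (x :* y) :* (u :* v) := (x :* u) :* (y :* v)) refl x y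
        u v ⟩
    (x * u) * (y * v) ≈⟨ *-cong xu yv ⟩
    1# * 1#           ≈⟨ *-identityˡ 1# ⟩
    1#                ∎)

  unit-neg : ∀ {x} → IsUnit x → IsUnit (- x)
  unit-neg {x} (u , xu) = - u , trans (solve 2 (λ x u → :- x :* :- u := x :* u) refl x u) xu

  unit-factor : ∀ {x y} → IsUnit (x * y) → IsUnit x
  unit-factor {x} {y} (u , xyu) = y * u , trans (sym (*-assoc x y u)) xyu

  unit-^ : ∀ {x} n → IsUnit x → IsUnit (x ^ n)
  unit-^ zero    ux = unit-1
  unit-^ (suc n) ux = unit-* ux (unit-^ n ux)

  unit-cancel : ∀ {x y} → IsUnit x → x * y ≈ 0# → y ≈ 0#
  unit-cancel {x} {y} (u , xu) xy≈0 = begin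
    y           ≈⟨ *-identityˡ y ⟨
    1# * y      ≈⟨ *-congʳ xu ⟨
    (x * u) * y ≈⟨ solve 3 (λ x u y → (x :* u) :* y := u :* (x :* y)) refl x u y ⟩
    u * (x * y) ≈⟨ *-congˡ xy≈0 ⟩
    u * 0#      ≈⟨ zeroʳ u ⟩
    0#          ∎

  ≈±-unit : ∀ {x y} → x ≈± y → IsUnit y → IsUnit x
  ≈±-unit (inj₁ e) u = unit-cong (sym e) u
  ≈±-unit (inj₂ e) u = unit-cong (sym e) (unit-neg u)

  ≈±-zero : ∀ {x y} → x ≈± y → y ≈ 0# → x ≈ 0#
  ≈±-zero (inj₁ e) y≈0 = trans e y≈0
  ≈±-zero (inj₂ e) y≈0 = trans e (trans (-‿cong y≈0) -0#≈0#)

-- Determinants with vanishing columns, repeated rows or dependent rows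

module Alternants {c ℓ} (R : CommutativeRing c ℓ) where
  open CommutativeRing R
  open RingProperties ring
  open RingFacts R
  open Units R
  open Contraction R
  open AlternatingForms R
  open Alternating
  open ListSums R
  open Branching R
  open Tableaux R
  open SchurBranching R
  open Bialternant R
  open SemiringExp semiring
  open IntegerSolver R
  open SetoidReasoning setoid

  private
    Column = Carrier → Carrier

    expandAll : (List Column → Carrier) → List Carrier → List Column → Carrier
    expandAll = foldl (λ F x → expand (at x) F)

  -- A term in which a row of `xs` uses `u` is zero; otherwise `u` is left over at the end, where
  -- `empty` rejects a nonempty list.
  det-kills : ∀ {xs u} → All (λ x → u x ≈ 0#) xs → ∀ us → det xs (u ∷ us) ≈ 0#
  det-kills {xs} {u} = go xs {empty} (λ _ → refl)
    where
    go : ∀ xs {F} → (∀ us → F (u ∷ us) ≈ 0#) → All (λ x → u x ≈ 0#) xs → ∀ us → expandAll F xs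
        (u ∷ us) ≈ 0#
    go []       F≈0 []           us = F≈0 us
    go (x ∷ xs) {F} F≈0 (ux≈0 ∷ uxs) = go xs {expand (at x) F} (λ us → begin
      u x * F us - expand (at x) (F ∘ (u ∷_)) us
        ≈⟨ +-cong (trans (*-congʳ ux≈0) (zeroˡ _)) (-‿cong (expand-zero F≈0 us)) ⟩
      0# - 0# ≈⟨ -‿inverseʳ 0# ⟩
      0#      ∎) uxs

  -- Block form: the two leading columns live in the rows z and w only, so their 2 × 2 minor splits
  -- off.
  det-two-killed : ∀ {xs u v} → All (λ x → u x ≈ 0#) xs → All (λ x → v x ≈ 0#) xs → ∀ z w us →
    expand (at w) (expand (at z) (det xs)) (u ∷ v ∷ us) ≈ (u w * v z - u z * v w) * det xs us
  det-two-killed {xs} {u} {v} uxs vxs z w us = begin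
    u w * expand (at z) E (v ∷ us) - expand (at w) (expand (at z) E ∘ (u ∷_)) (v ∷ us)
      ≈⟨ +-cong (*-congˡ (remove z vxs us))
                (-‿cong (trans (expand-cong (λ _ → refl) (remove z uxs) (v ∷ us))
                        (trans (expand-scale (u z) {E} (v ∷ us)) (*-congˡ (remove w vxs us))))) ⟩
    u w * (v z * E us) - u z * (v w * E us)
      ≈⟨ solve 5 (λ a b c d e → a :* (b :* e) :- c :* (d :* e) := (a :* b :- c :* d) :* e) refl
           (u w) (v z) (u z) (v w) (E us) ⟩
    (u w * v z - u z * v w) * E us ∎
    where
    E = det xs
    remove : ∀ y {u} → All (λ x → u x ≈ 0#) xs → ∀ us → expand (at y) E (u ∷ us) ≈ u y * E us
    remove y {u} uxs us = trans (+-congˡ (-‿cong (expand-zero {F = E ∘ (u ∷_)} (det-kills uxs) us)))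
        (x-0≈x _)

  difference : ℕ → ℕ → Column
  difference a b x = x ^ a - x ^ b

  subtract-next : ∀ {F} → Alternating F → ∀ pre a b {us} →
    F (pre ++ monomial a ∷ monomial b ∷ us) ≈ F (pre ++ difference a b ∷ monomial b ∷ us)
  subtract-next {F} alt pre a b {us} = begin
    F (pre ++ monomial a ∷ monomial b ∷ us)
      ≈⟨ alt .linear pre 1# 1# (λ x → trans (solve 2 (λ p q → p := (p :- q) :+ q) refl (x ^ a)
          (x ^ b))
                                              (sym (+-cong (*-identityˡ _) (*-identityˡ _)))) ⟩
    1# * F (pre ++ difference a b ∷ monomial b ∷ us) + 1# * F (pre ++ monomial b ∷ monomial b ∷ us)
      ≈⟨ +-cong (*-identityˡ _) (trans (*-congˡ (alt .repeat pre)) (zeroʳ _)) ⟩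
    F (pre ++ difference a b ∷ monomial b ∷ us) + 0#
      ≈⟨ +-identityʳ _ ⟩
    F (pre ++ difference a b ∷ monomial b ∷ us) ∎

  pairFactor : (a₁ a₂ b₁ b₂ : ℕ) → Carrier → Carrier → Carrier
  pairFactor a₁ a₂ b₁ b₂ z w =
    difference a₁ a₂ w * difference b₁ b₂ z - difference a₁ a₂ z * difference b₁ b₂ w

  module _ (t : ℕ) .{{_ : NonZero t}} where
    open Residues t

    -- The two difference columns must lead the list. In the disjoint case this costs one swap,
    -- hence a sign. In the overlapping case the column of q first clears that of p and only then is
    -- replaced by its own difference with r.
    det-split : ∀ {bs a₁ a₂ b₁ b₂ rest} → Split bs a₁ a₂ b₁ b₂ rest → ∀ {xs} →
      All (λ x → difference a₁ a₂ x ≈ 0#) xs → All (λ x → difference b₁ b₂ x ≈ 0#) xs → ∀ z w →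
      expand (at w) (expand (at z) (det xs)) (map monomial bs) ≈±
      pairFactor a₁ a₂ b₁ b₂ z w * det xs (map monomial rest)
    det-split {a₁ = a₁} {a₂} {b₁} {b₂} (disjoint {ys = ys} p) {xs} as bs z w =
      ≈±-trans (alternating-↭ alt (↭.map⁺ monomial p)) (inj₂ (begin
        F (monomial a₁ ∷ monomial a₂ ∷ monomial b₁ ∷ monomial b₂ ∷ us)
          ≈⟨ subtract-next alt [] a₁ a₂ ⟩
        F (difference a₁ a₂ ∷ monomial a₂ ∷ monomial b₁ ∷ monomial b₂ ∷ us)
          ≈⟨ subtract-next alt (difference a₁ a₂ ∷ monomial a₂ ∷ []) b₁ b₂ ⟩
        F (difference a₁ a₂ ∷ monomial a₂ ∷ difference b₁ b₂ ∷ monomial b₂ ∷ us)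
          ≈⟨ alt .swap (difference a₁ a₂ ∷ []) ⟩
        - F (difference a₁ a₂ ∷ difference b₁ b₂ ∷ monomial a₂ ∷ monomial b₂ ∷ us)
          ≈⟨ -‿cong (det-two-killed as bs z w _) ⟩
        - (pairFactor a₁ a₂ b₁ b₂ z w * det xs (monomial a₂ ∷ monomial b₂ ∷ us)) ∎))
      where
      F = expand (at w) (expand (at z) (det xs))
      alt = expand-alternating w (expand-alternating z (det-alternating xs))
      us = map monomial ys
    det-split (overlapping {p} {q} {r} {ys} perm) {xs} as bs z w =
      ≈±-trans (alternating-↭ alt (↭.map⁺ monomial perm)) (inj₁ (begin
        F (monomial p ∷ monomial q ∷ monomial r ∷ us)
          ≈⟨ subtract-next alt [] p q ⟩
        F (difference p q ∷ monomial q ∷ monomial r ∷ us)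
          ≈⟨ subtract-next alt (difference p q ∷ []) q r ⟩
        F (difference p q ∷ difference q r ∷ monomial r ∷ us)
          ≈⟨ det-two-killed as bs z w _ ⟩
        pairFactor p q q r z w * det xs (monomial r ∷ us) ∎))
      where
      F = expand (at w) (expand (at z) (det xs))
      alt = expand-alternating w (expand-alternating z (det-alternating xs))
      us = map monomial ys

  -- Agreement at the points `xs` is all that x^b and x^(b % t) have in common at roots of unity. In
  -- `go` this set of points stays fixed while the rows still to be expanded, always a subset of it,
  -- get fewer.
  det-cong : ∀ {xs us vs} → Pointwise (λ u v → All (λ x → u x ≈ v x) xs) us vs → det xs us ≈ det xs
      vs
  det-cong {xs} = go xs {xs} {empty} id empty-cong
    where
    Agree : List Carrier → Column → Column → Set (c ⊔ ℓ)
    Agree xs u v = All (λ x → u x ≈ v x) xs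

    Respects : List Carrier → (List Column → Carrier) → Set (c ⊔ ℓ)
    Respects xs F = ∀ {us vs} → Pointwise (Agree xs) us vs → F us ≈ F vs

    agree-refl : ∀ {xs u} → Agree xs u u
    agree-refl {xs} = All.universal (λ _ → refl) xs

    empty-cong : Respects xs empty
    empty-cong []      = refl
    empty-cong (_ ∷ _) = refl

    expand-respects : ∀ {xs x F} → x ∈ xs → Respects xs F → Respects xs (expand (at x) F)
    expand-respects x∈ resp []       = refl
    expand-respects {xs} {x} {F} x∈ resp {u ∷ us} {v ∷ vs} (q ∷ qs) =
      +-cong (*-cong (All.lookup q x∈) (resp qs)) (-‿cong (trans
        (expand-cong (λ _ → refl) (λ ws → resp (q ∷ Pointwise.refl agree-refl)) us)
        (expand-respects x∈ (λ rs → resp (agree-refl ∷ rs)) qs)))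

    go : ∀ ys {xs F} → (∀ {y} → y ∈ ys → y ∈ xs) → Respects xs F → Respects xs (expandAll F ys)
    go []       ys⊆ resp = resp
    go (y ∷ ys) {F = F} ys⊆ resp = go ys {F = expand (at y) F} (ys⊆ ∘ there)
        (expand-respects (ys⊆ (here ≡.refl)) resp)

  schurSum-zero : ∀ n (x : Vector Carrier n) m → schurSum n x (replicate m 0) ≈ 1#
  schurSum-zero n x m = begin
    schurSum n x (replicate m 0)
      ≡⟨ ≡.cong (λ Ts → sumOver Ts (λ T → ⟦ semistandard T ⟧ * weight′ T)) (only m) ⟩
    ⟦ semistandard {n} (replicate m []) ⟧ * weight′ (replicate m []) + 0#
      ≈⟨ trans (+-identityʳ _) (*-cong (⟦⟧-cong (standard m))
          (reflexive (≡.cong (foldr _*_ 1# ∘ map x) (no-letters m)))) ⟩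
    1# * 1# ≈⟨ *-identityˡ 1# ⟩
    1#      ∎
    where
    weight′ = weight R x
    only : ∀ m → fillingsOf n (replicate m 0) ≡ [ replicate m [] ]
    only zero    = ≡.refl
    only (suc m) = ≡.cong (List.cartesianProductWith _∷_ [ [] ]) (only m)
    standardBelow : ∀ m → semistandardBelow {n} [] (replicate m []) ≡ true
    standardBelow zero    = ≡.refl
    standardBelow (suc m) = standardBelow m
    standard : ∀ m → semistandard {n} (replicate m []) ≡ true
    standard zero    = ≡.refl
    standard (suc m) = ≡.trans (semistandard-∷ [] (replicate m [])) (standardBelow m)
    no-letters : ∀ m → List.concat (replicate m []) ≡ ([] {A = Fin n})
    no-letters zero    = ≡.refl
    no-letters (suc m) = no-letters m

  betaList-zero : ∀ n → betaList (replicate n 0) ≡ downFrom n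
  betaList-zero zero    = ≡.refl
  betaList-zero (suc n) = ≡.cong₂ _∷_ (List.length-replicate n) (betaList-zero n)

  -- The exponents n - 1, ..., 0 belong to the empty partition, whose Schur polynomial is 1, so the
  -- Vandermonde evaluation is a case of the bialternant formula.
  det-downFrom : ∀ {n} (x : Vector Carrier n) → det (List.tabulate x) (map monomial (downFrom n)) ≈
      vandermonde (List.tabulate x)
  det-downFrom {n} x = begin
    det (List.tabulate x) (map monomial (downFrom n))
      ≡⟨ ≡.cong (det (List.tabulate x) ∘ map monomial) (betaList-zero n) ⟨
    det (List.tabulate x) (map monomial (betaList (replicate n 0)))
      ≈⟨ bialternant n x (replicate n 0) (List.length-replicate n) (constant n) ⟩
    vandermonde (List.tabulate x) * schurSum n x (replicate n 0)
      ≈⟨ trans (*-congˡ (schurSum-zero n x n)) (*-identityʳ _) ⟩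
    vandermonde (List.tabulate x) ∎
    where
    constant : ∀ n → Linked ℕ._≥_ (replicate n 0)
    constant zero          = []
    constant (suc zero)    = [-]
    constant (suc (suc n)) = ℕ.≤-refl ∷ constant (suc n)

  vandermonde-unit : ∀ {xs} → AllPairs (λ x y → IsUnit (y - x)) xs → IsUnit (vandermonde xs)
  vandermonde-unit []         = unit-1
  vandermonde-unit (ux ∷ uxs) = unit-* (product ux) (vandermonde-unit uxs)
    where
    product : ∀ {x ys} → All (λ y → IsUnit (y - x)) ys → IsUnit (foldr (λ y v → (y - x) * v) 1# ys)
    product []       = unit-1
    product (u ∷ us) = unit-* u (product us)

  -- The second expansion along y is carried inwards past the other rows by anticommutativity until
  -- it meets the first.
  det-repeated : ∀ {xs y} → y ∈ xs → ∀ us → expand (at y) (det xs) us ≈ 0#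
  det-repeated {xs} {y} = go xs
    where
    keep : ∀ xs {F} → (∀ us → expand (at y) F us ≈ 0#) → ∀ us → expand (at y) (expandAll F xs) us ≈
        0#
    keep []       F≈0 = F≈0
    keep (x ∷ xs) {F} F≈0 = keep xs {expand (at x) F} (λ us →
      trans (expand-anticomm us) (trans (-‿cong (expand-zero F≈0 us)) -0#≈0#))
    go : ∀ xs {F} → y ∈ xs → ∀ us → expand (at y) (expandAll F xs) us ≈ 0#
    go (x ∷ xs) {F} (here ≡.refl) = keep xs {expand (at x) F} expand-repeated
    go (x ∷ xs) {F} (there y∈)    = go xs {expand (at x) F} y∈

  -- Adding multiples of the rows `x i` to the row y, scaled by `k₀`, contributes only determinants
  -- with a repeated row. The combined row is zero on the given columns, and `k₀` cancels.
  det-dependent : ∀ {a} {A : Set a} (is : List A) (k x : A → Carrier) {k₀} y → IsUnit k₀ → ∀ {us} →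
    All (λ u → k₀ * u y + sumOver is (λ i → k i * u (x i)) ≈ 0#) us →
    expand (at y) (det (map x is)) us ≈ 0#
  det-dependent is k x {k₀} y unit {us} relation = unit-cancel unit (begin
    k₀ * expand (at y) D us
      ≈⟨ +-identityʳ _ ⟨
    k₀ * expand (at y) D us + 0#
      ≈⟨ +-congˡ (sum-rows-vanish is (λ i∈ → ∈.∈-map⁺ x i∈)) ⟨
    k₀ * expand (at y) D us + expand (λ u → sumOver is (λ i → k i * u (x i))) D us
      ≈⟨ expand-row-linear k₀ us ⟨
    expand (λ u → k₀ * u y + sumOver is (λ i → k i * u (x i))) D us
      ≈⟨ expand-row-zero us relation ⟩
    0# ∎)
    where
    D = det (map x is)
    sum-rows-vanish : ∀ js → (∀ {j} → j ∈ js → x j ∈ map x is) → expand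
        (λ u → sumOver js (λ i → k i * u (x i))) D us ≈ 0#
    sum-rows-vanish []       _  = expand-row-zero us (All.universal (λ _ → refl) us)
    sum-rows-vanish (j ∷ js) ∈is = begin
      expand (λ u → k j * u (x j) + sumOver js (λ i → k i * u (x i))) D us
        ≈⟨ expand-row-linear (k j) us ⟩
      k j * expand (at (x j)) D us + expand (λ u → sumOver js (λ i → k i * u (x i))) D us
        ≈⟨ +-cong (trans (*-congˡ (det-repeated (∈is (here ≡.refl)) us)) (zeroʳ _))
            (sum-rows-vanish js (∈is ∘ there)) ⟩
      0# + 0# ≈⟨ +-identityʳ 0# ⟩
      0# ∎

-- Laurent polynomials with many integer roots

module LaurentPolynomials {c ℓ} (R : CommutativeRing c ℓ) where
  open CommutativeRing R
  open Units R
  open ListSums R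
  open Tableaux R
  open SchurBranching R
  open SemiringExp semiring
  open SemiringMult semiring using () renaming (_×_ to _·_)
  open IntegerSolver R
  open SetoidReasoning setoid

  evaluate : List Carrier → Carrier → Carrier
  evaluate []       z = 0#
  evaluate (c ∷ cs) z = c + z * evaluate cs z

  -- Synthetic division: (z p(z) - a p(a)) / (z - a).
  quotient : Carrier → List Carrier → List Carrier
  quotient a []       = []
  quotient a (c ∷ cs) = evaluate (c ∷ cs) a ∷ quotient a cs

  length-quotient : ∀ a cs → length (quotient a cs) ≡ length cs
  length-quotient a []       = ≡.refl
  length-quotient a (c ∷ cs) = ≡.cong suc (length-quotient a cs)

  quotient-* : ∀ a cs z → z * evaluate cs z - a * evaluate cs a ≈ (z - a) * evaluate (quotient a cs)
      z
  quotient-* a []       z = trans (+-cong (zeroʳ z) (trans (-‿cong (zeroʳ a)) refl))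
      (trans (-‿inverseʳ 0#) (sym (zeroʳ _)))
  quotient-* a (c ∷ cs) z = begin
    z * (c + z * p) - a * (c + a * q)
      ≈⟨ solve 5 (λ z a c p q → z :* (c :+ z :* p) :- a :* (c :+ a :* q) :=
                                (z :- a) :* (c :+ a :* q) :+ z :* (z :* p :- a :* q)) refl z a c p
                                    q ⟩
    (z - a) * (c + a * q) + z * (z * p - a * q)
      ≈⟨ +-congˡ (*-congˡ (quotient-* a cs z)) ⟩
    (z - a) * (c + a * q) + z * ((z - a) * evaluate (quotient a cs) z)
      ≈⟨ solve 4 (λ d e z r → d :* e :+ z :* (d :* r) := d :* (e :+ z :* r)) refl
           (z - a) (c + a * q) z (evaluate (quotient a cs) z) ⟩
    (z - a) * (c + a * q + z * evaluate (quotient a cs) z) ∎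
    where
    p = evaluate cs z
    q = evaluate cs a

  module _ (integer-unit : ∀ m → IsUnit (suc m · 1#)) where

    difference-unit : ∀ {m n} → m ℕ.< n → IsUnit (n · 1# - m · 1#)
    difference-unit {m} m<n with k , ≡.refl ← ℕ.m≤n⇒∃[o]m+o≡n m<n = unit-cong (begin
      suc k · 1#
        ≈⟨ solve 2 (λ m k → k := (m :+ k) :- m) refl (m · 1#) (suc k · 1#) ⟩
      (m · 1# + suc k · 1#) - m · 1#
        ≈⟨ +-congʳ (SemiringMult.×-homo-+ semiring 1# m (suc k)) ⟨
      (m ℕ.+ suc k) · 1# - m · 1#
        ≡⟨ ≡.cong (λ n → n · 1# - m · 1#) (ℕ.+-suc m k) ⟩
      (suc m ℕ.+ k) · 1# - m · 1# ∎) (integer-unit k)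

    -- Dividing out the root k shortens the polynomial, and later integers remain roots of the
    -- quotient because their differences with k are units. Taking all integers from k on as roots
    -- avoids counting roots against the degree.
    evaluate-vanishes : ∀ n cs k → length cs ≡ n → (∀ m → k ℕ.≤ m → evaluate cs (m · 1#) ≈ 0#) →
                        ∀ z → evaluate cs z ≈ 0#
    evaluate-vanishes zero    []       k eq roots z = refl
    evaluate-vanishes (suc n) (c ∷ cs) k eq roots z = begin
      c + z * evaluate cs z
        ≈⟨ solve 3 (λ c p q → c :+ p := (c :+ q) :+ (p :- q)) refl c (z * evaluate cs z)
            (a * evaluate cs a) ⟩
      (c + a * evaluate cs a) + (z * evaluate cs z - a * evaluate cs a)
        ≈⟨ +-cong (roots k ℕ.≤-refl) (quotient-* a cs z) ⟩
      0# + (z - a) * evaluate (quotient a cs) z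
        ≈⟨ trans (+-identityˡ _) (*-congˡ (evaluate-vanishes n (quotient a cs) (suc k)
             (≡.trans (length-quotient a cs) (ℕ.suc-injective eq)) quotient-roots z)) ⟩
      (z - a) * 0#
        ≈⟨ zeroʳ _ ⟩
      0# ∎
      where
      a = k · 1#
      quotient-roots : ∀ m → suc k ℕ.≤ m → evaluate (quotient a cs) (m · 1#) ≈ 0#
      quotient-roots m k<m = unit-cancel (difference-unit k<m) (begin
        (x - a) * evaluate (quotient a cs) x
          ≈⟨ quotient-* a cs x ⟨
        x * evaluate cs x - a * evaluate cs a
          ≈⟨ solve 3 (λ c p q → p :- q := (c :+ p) :- (c :+ q)) refl c (x * evaluate cs x)
              (a * evaluate cs a) ⟩
        (c + x * evaluate cs x) - (c + a * evaluate cs a)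
          ≈⟨ +-cong (roots m (ℕ.<⇒≤ k<m)) (-‿cong (roots k ℕ.≤-refl)) ⟩
        0# - 0#
          ≈⟨ -‿inverseʳ 0# ⟩
        0# ∎)
        where x = m · 1#

  _⊕_ : List Carrier → List Carrier → List Carrier
  []       ⊕ ds       = ds
  (c ∷ cs) ⊕ []       = c ∷ cs
  (c ∷ cs) ⊕ (d ∷ ds) = (c + d) ∷ (cs ⊕ ds)

  evaluate-⊕ : ∀ cs ds z → evaluate (cs ⊕ ds) z ≈ evaluate cs z + evaluate ds z
  evaluate-⊕ []       ds       z = sym (+-identityˡ _)
  evaluate-⊕ (c ∷ cs) []       z = sym (+-identityʳ _)
  evaluate-⊕ (c ∷ cs) (d ∷ ds) z = trans (+-congˡ (*-congˡ (evaluate-⊕ cs ds z)))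
    (solve 5 (λ c d z p q → (c :+ d) :+ z :* (p :+ q) := (c :+ z :* p) :+ (d :+ z :* q)) refl c d z
        _ _)

  evaluate-map : ∀ k cs z → evaluate (map (k *_) cs) z ≈ k * evaluate cs z
  evaluate-map k []       z = sym (zeroʳ k)
  evaluate-map k (c ∷ cs) z = trans (+-congˡ (*-congˡ (evaluate-map k cs z)))
    (solve 4 (λ k c z p → k :* c :+ z :* (k :* p) := k :* (c :+ z :* p)) refl k c z _)

  shift : ℕ → List Carrier → List Carrier
  shift zero    cs = cs
  shift (suc n) cs = 0# ∷ shift n cs

  evaluate-shift : ∀ n cs z → evaluate (shift n cs) z ≈ z ^ n * evaluate cs z
  evaluate-shift zero    cs z = sym (*-identityˡ _)
  evaluate-shift (suc n) cs z = trans (+-identityˡ _) (trans (*-congˡ (evaluate-shift n cs z))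
      (sym (*-assoc _ _ _)))

  -- A power of z clears the denominators; the identity is required only where w is the inverse of
  -- z.
  IsLaurent : (Carrier → Carrier → Carrier) → Set (c ⊔ ℓ)
  IsLaurent f = ∃[ n ] ∃[ cs ] (∀ z w → z * w ≈ 1# → z ^ n * f z w ≈ evaluate cs z)

  laurent-const : ∀ k → IsLaurent (λ _ _ → k)
  laurent-const k = 0 , k ∷ [] , λ z w _ → trans (*-identityˡ k)
      (sym (trans (+-congˡ (zeroʳ z)) (+-identityʳ k)))

  laurent-+ : ∀ {f g} → IsLaurent f → IsLaurent g → IsLaurent (λ z w → f z w + g z w)
  laurent-+ {f} {g} (m , cs , f≈) (n , ds , g≈) = m ℕ.+ n , shift n cs ⊕ shift m ds , λ z w zw →
      begin
    z ^ (m ℕ.+ n) * (f z w + g z w)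
      ≈⟨ *-congʳ (^-homo-* z m n) ⟩
    (z ^ m * z ^ n) * (f z w + g z w)
      ≈⟨ solve 4 (λ p q f g → (p :* q) :* (f :+ g) := q :* (p :* f) :+ p :* (q :* g)) refl (z ^ m)
          (z ^ n) (f z w) (g z w) ⟩
    z ^ n * (z ^ m * f z w) + z ^ m * (z ^ n * g z w)
      ≈⟨ +-cong (*-congˡ (f≈ z w zw)) (*-congˡ (g≈ z w zw)) ⟩
    z ^ n * evaluate cs z + z ^ m * evaluate ds z
      ≈⟨ trans (evaluate-⊕ (shift n cs) (shift m ds) z) (+-cong (evaluate-shift n cs z)
          (evaluate-shift m ds z)) ⟨
    evaluate (shift n cs ⊕ shift m ds) z ∎

  laurent-const-* : ∀ k {f} → IsLaurent f → IsLaurent (λ z w → k * f z w)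
  laurent-const-* k (n , cs , f≈) = n , map (k *_) cs , λ z w zw →
    trans (solve 3 (λ p k f → p :* (k :* f) := k :* (p :* f)) refl _ _ _)
          (trans (*-congˡ (f≈ z w zw)) (sym (evaluate-map k cs z)))

  laurent-z-* : ∀ {f} → IsLaurent f → IsLaurent (λ z w → z * f z w)
  laurent-z-* (n , cs , f≈) = n , 0# ∷ cs , λ z w zw →
    trans (solve 3 (λ p k f → p :* (k :* f) := k :* (p :* f)) refl _ _ _)
          (trans (*-congˡ (f≈ z w zw)) (sym (+-identityˡ _)))

  laurent-w-* : ∀ {f} → IsLaurent f → IsLaurent (λ z w → w * f z w)
  laurent-w-* (n , cs , f≈) = suc n , cs , λ z w zw →
    trans (solve 4 (λ z p w f → (z :* p) :* (w :* f) := (z :* w) :* (p :* f)) refl z _ w _)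
          (trans (*-congʳ zw) (trans (*-identityˡ _) (f≈ z w zw)))

  laurent-sum : ∀ {a} {A : Set a} (xs : List A) {f : A → Carrier → Carrier → Carrier} →
                (∀ x → IsLaurent (f x)) → IsLaurent (λ z w → sumOver xs (λ x → f x z w))
  laurent-sum []       f-laurent = laurent-const 0#
  laurent-sum (x ∷ xs) {f} f-laurent = laurent-+ {f x} (f-laurent x) (laurent-sum xs f-laurent)

  extend : ∀ {t} → Vector Carrier t → Carrier → Carrier → Vector Carrier (t ℕ.+ 2)
  extend x z w = x Vector.++ (z Vector.∷ w Vector.∷ Vector.[])

  laurent-schurSum : ∀ {t} (x : Vector Carrier t) L → IsLaurent (λ z w → schurSum (t ℕ.+ 2)
      (extend x z w) L)
  laurent-schurSum {t} x L = laurent-sum (fillingsOf (t ℕ.+ 2) L) {λ T z w → ⟦ semistandard T ⟧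
      * weight R (extend x z w) T}
    (λ T → laurent-const-* ⟦ semistandard T ⟧ (laurent-product (concat T)))
    where
    laurent-product : ∀ r → IsLaurent (λ z w → rowWeight (extend x z w) r)
    laurent-product []      = laurent-const 1#
    laurent-product (i ∷ r) with splitAt t i
    ... | inj₁ j                    = laurent-const-* (x j) (laurent-product r)
    ... | inj₂ Fin.zero             = laurent-z-* (laurent-product r)
    ... | inj₂ (Fin.suc Fin.zero)   = laurent-w-* (laurent-product r)

  laurent-vanishes : (∀ m → IsUnit (suc m · 1#)) → ∀ {f} → IsLaurent f →
    (∀ m w → (2 ℕ.+ m) · 1# * w ≈ 1# → f ((2 ℕ.+ m) · 1#) w ≈ 0#) →
    ∀ z w → z * w ≈ 1# → f z w ≈ 0#
  laurent-vanishes integer-unit {f} (n , cs , f≈) roots z w zw =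
    unit-cancel (unit-^ n (w , zw)) (trans (f≈ z w zw)
      -- The roots start at 2: 0 has no inverse in a nontrivial ring, and 1 is itself a power of ζ,
      -- which makes the Vandermonde determinant vanish.
      (evaluate-vanishes integer-unit (length cs) cs 2 ≡.refl polynomial-roots z))
    where
    polynomial-roots : ∀ m → 2 ℕ.≤ m → evaluate cs (m · 1#) ≈ 0#
    polynomial-roots (suc (suc m)) (ℕ.s≤s (ℕ.s≤s _)) with w′ , zw′ ← integer-unit (suc m) =
      trans (sym (f≈ _ w′ zw′)) (trans (*-congˡ (roots m w′ zw′)) (zeroʳ _))

-- Evaluation at the roots of unity, z and its inverse

tabulate-++ : ∀ {a} {A : Set a} {m n} (xs : Vector A m) (ys : Vector A n) →
              List.tabulate (xs Vector.++ ys) ≡ List.tabulate xs ++ List.tabulate ys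
tabulate-++ {m = zero}  xs ys = ≡.refl
tabulate-++ {m = suc m} xs ys = ≡.cong (xs Fin.zero ∷_)
  (≡.trans (List.tabulate-cong (λ i → Sum.[,]-map (splitAt m i))) (tabulate-++ (xs ∘ Fin.suc) ys))

tabulate-toℕ : ∀ {a} {A : Set a} n (f : ℕ → A) → List.tabulate {n = n} (f ∘ toℕ) ≡ applyUpTo f n
tabulate-toℕ zero    f = ≡.refl
tabulate-toℕ (suc n) f = ≡.cong (f 0 ∷_) (tabulate-toℕ n (f ∘ suc))

module RootsOfUnity {c ℓ} (R : CommutativeRing c ℓ) where
  open CommutativeRing R
  open RingProperties ring
  open RingFacts R
  open Units R
  open Contraction R
  open AlternatingForms R
  open ListSums R
  open Branching R
  open Bialternant R
  open SchurBranching R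
  open Alternants R
  open LaurentPolynomials R
  open SemiringExp semiring
  open CommutativeSemiringExp commutativeSemiring using (^-distrib-*)
  open SemiringMult semiring using (×1-homo-*) renaming (_×_ to _·_)
  open IntegerSolver R
  open SetoidReasoning setoid

  module PrimitiveRoot
    (integer-unit : ∀ m → IsUnit (suc m · 1#))
    (t : ℕ) .{{_ : NonZero t}} (ζ : Carrier) (ζ^t≈1 : ζ ^ t ≈ 1#)
    (ζ^k-1-unit : ∀ k → 0 ℕ.< k → k ℕ.< t → IsUnit (ζ ^ k - 1#))
    where

    open Residues t

    unit-flip : ∀ {x y} → IsUnit (x - y) → IsUnit (y - x)
    unit-flip {x} {y} u = unit-cong (solve 2 (λ x y → :- (x :- y) := y :- x) refl x y) (unit-neg u)

    1^n≈1 : ∀ n → 1# ^ n ≈ 1#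
    1^n≈1 zero    = refl
    1^n≈1 (suc n) = trans (*-identityˡ _) (1^n≈1 n)

    ζ-unit : IsUnit ζ
    ζ-unit = ζ ^ (ℕ.pred t) , trans (reflexive (≡.cong (ζ ^_) (ℕ.suc-pred t))) ζ^t≈1

    roots : List Carrier
    roots = map (ζ ^_) (upTo t)

    roots-^t : All (λ x → x ^ t ≈ 1#) roots
    roots-^t = All.map⁺ (All.universal (λ k → begin
      (ζ ^ k) ^ t   ≈⟨ ^-assocʳ ζ k t ⟩
      ζ ^ (k ℕ.* t) ≡⟨ ≡.cong (ζ ^_) (ℕ.*-comm k t) ⟩
      ζ ^ (t ℕ.* k) ≈⟨ ^-assocʳ ζ t k ⟨
      (ζ ^ t) ^ k   ≈⟨ ^-congˡ k ζ^t≈1 ⟩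
      1# ^ k        ≈⟨ 1^n≈1 k ⟩
      1#            ∎) (upTo t))

    ^-% : ∀ {x} → x ^ t ≈ 1# → ∀ b → x ^ b ≈ x ^ (b % t)
    ^-% {x} x^t≈1 b = begin
      x ^ b                                 ≡⟨ ≡.cong (x ^_) (≡.trans (ℕ.m≡m%n+[m/n]*n b t)
          (≡.cong (b % t ℕ.+_) (ℕ.*-comm (b ℕ./ t) t))) ⟩
      x ^ (b % t ℕ.+ t ℕ.* (b ℕ./ t))       ≈⟨ ^-homo-* x (b % t) _ ⟩
      x ^ (b % t) * x ^ (t ℕ.* (b ℕ./ t))   ≈⟨ *-congˡ (^-assocʳ x t (b ℕ./ t)) ⟨
      x ^ (b % t) * (x ^ t) ^ (b ℕ./ t)     ≈⟨ *-congˡ (trans (^-congˡ (b ℕ./ t) x^t≈1)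
          (1^n≈1 (b ℕ./ t))) ⟩
      x ^ (b % t) * 1#                      ≈⟨ *-identityʳ _ ⟩
      x ^ (b % t)                           ∎

    congruent-vanishes : ∀ {a b} → a % t ≡ b % t → All (λ x → difference a b x ≈ 0#) roots
    congruent-vanishes {a} {b} eq = All.map (λ {x} x^t≈1 → begin
      x ^ a - x ^ b             ≈⟨ +-cong (^-% x^t≈1 a) (-‿cong (^-% x^t≈1 b)) ⟩
      x ^ (a % t) - x ^ (b % t) ≡⟨ ≡.cong (λ k → x ^ k - x ^ (b % t)) eq ⟩
      x ^ (b % t) - x ^ (b % t) ≈⟨ -‿inverseʳ _ ⟩
      0#                        ∎) roots-^t

    roots-distinct : AllPairs (λ x y → IsUnit (y - x)) roots
    roots-distinct = ≡.subst (AllPairs _) (≡.sym (List.map-upTo (ζ ^_) t))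
        (AllPairs.applyUpTo⁺₁ (ζ ^_) t distinct)
      where
      distinct : ∀ {i j} → i ℕ.< j → j ℕ.< t → IsUnit (ζ ^ j - ζ ^ i)
      distinct {i} {j} i<j j<t = unit-cong (begin
        ζ ^ i * (ζ ^ (j ∸ i) - 1#)
          ≈⟨ solve 3 (λ p q e → p :* (q :- e) := p :* q :- p :* e) refl (ζ ^ i) (ζ ^ (j ∸ i)) 1# ⟩
        ζ ^ i * ζ ^ (j ∸ i) - ζ ^ i * 1#
          ≈⟨ +-cong (trans (sym (^-homo-* ζ i (j ∸ i)))
              (reflexive (≡.cong (ζ ^_) (ℕ.m+[n∸m]≡n (ℕ.<⇒≤ i<j))))) (-‿cong (*-identityʳ _)) ⟩
        ζ ^ j - ζ ^ i ∎)
        (unit-* (unit-^ i ζ-unit) (ζ^k-1-unit (j ∸ i) (ℕ.m<n⇒0<n∸m i<j)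
            (ℕ.≤-<-trans (ℕ.m∸n≤m j i) j<t)))

    -- In the rows ζ^k exponents may be reduced modulo t. A complete system of residues is then 0,
    -- ..., t - 1 up to order, and the alternant is up to sign a Vandermonde determinant whose
    -- factors are units.
    det-roots-unit : ∀ {bs} → EachOnce bs → IsUnit (det roots (map monomial bs))
    det-roots-unit {bs} once = unit-cong (sym (det-cong (reduce bs)))
      (≈±-unit (alternating-↭ (det-alternating roots) (↭.map⁺ monomial (residues-↭ once)))
        (unit-cong (sym value) (vandermonde-unit roots-distinct)))
      where
      reduce : ∀ bs → Pointwise (λ u v → All (λ x → u x ≈ v x) roots) (map monomial bs)
          (map monomial (map (_% t) bs))
      reduce []       = []
      reduce (b ∷ bs) = All.map (λ x^t≈1 → ^-% x^t≈1 b) roots-^t ∷ reduce bs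
      value : det roots (map monomial (List.downFrom t)) ≈ vandermonde roots
      value = ≡.subst (λ xs → det xs (map monomial (List.downFrom t)) ≈ vandermonde xs)
        (≡.trans (tabulate-toℕ t (ζ ^_)) (≡.sym (List.map-upTo (ζ ^_) t)))
            (det-downFrom {t} (λ k → ζ ^ toℕ k))

    geometric-sum : ∀ ρ n → (ρ - 1#) * sumOver (upTo n) (ρ ^_) ≈ ρ ^ n - 1#
    geometric-sum ρ zero    = trans (zeroʳ _) (sym (-‿inverseʳ 1#))
    geometric-sum ρ (suc n) = begin
      (ρ - 1#) * sumOver (upTo (suc n)) (ρ ^_)
        ≈⟨ *-congˡ (trans (sum-upTo n) (+-congˡ (sum-*ˡ (upTo n) ρ))) ⟩
      (ρ - 1#) * (1# + ρ * S)
        ≈⟨ trans (distribˡ _ _ _) (+-cong (*-identityʳ _)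
             (solve 3 (λ d ρ s → d :* (ρ :* s) := ρ :* (d :* s)) refl (ρ - 1#) ρ S)) ⟩
      (ρ - 1#) + ρ * ((ρ - 1#) * S)
        ≈⟨ +-congˡ (*-congˡ (geometric-sum ρ n)) ⟩
      (ρ - 1#) + ρ * (ρ ^ n - 1#)
        ≈⟨ +-congˡ (trans (distribˡ _ _ _)
            (+-congˡ (trans (sym (-‿distribʳ-* _ _)) (-‿cong (*-identityʳ ρ))))) ⟩
      (ρ - 1#) + (ρ * ρ ^ n - ρ)
        ≈⟨ solve 3 (λ ρ e p → (ρ :- e) :+ (p :- ρ) := p :- e) refl ρ 1# (ρ * ρ ^ n) ⟩
      ρ ^ suc n - 1# ∎
      where S = sumOver (upTo n) (ρ ^_)

    -- Orthogonality of characters: the geometric sum times the unit ζ^m - 1 equals (ζ^m)^t - 1,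
    -- which is zero.
    power-sum-vanishes : ∀ m → m % t ≢ 0 → sumOver (upTo t) (λ k → (ζ ^ m) ^ k) ≈ 0#
    power-sum-vanishes m m%t≢0 = unit-cancel
      (unit-cong (+-congʳ (sym (^-% ζ^t≈1 m))) (ζ^k-1-unit (m % t) (ℕ.n≢0⇒n>0 m%t≢0) (ℕ.m%n<n m t)))
      (begin
        (ζ ^ m - 1#) * sumOver (upTo t) ((ζ ^ m) ^_)
          ≈⟨ geometric-sum (ζ ^ m) t ⟩
        (ζ ^ m) ^ t - 1#
          ≈⟨ +-congʳ (begin
               (ζ ^ m) ^ t   ≈⟨ ^-assocʳ ζ m t ⟩
               ζ ^ (m ℕ.* t) ≡⟨ ≡.cong (ζ ^_) (ℕ.*-comm m t) ⟩
               ζ ^ (t ℕ.* m) ≈⟨ ^-assocʳ ζ t m ⟨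
               (ζ ^ t) ^ m   ≈⟨ trans (^-congˡ m ζ^t≈1) (1^n≈1 m) ⟩
               1#            ∎) ⟩
        1# - 1#
          ≈⟨ -‿inverseʳ 1# ⟩
        0# ∎)

    alternant : Carrier → Carrier → List ℕ → Carrier
    alternant z w bs = expand (at w) (expand (at z) (det roots)) (map monomial bs)

    missing-class-vanishes : ∀ {bs r} → r ℕ.< t → All (λ b → b % t ≢ r) bs → ∀ z w → alternant z w
        bs ≈ 0#
    missing-class-vanishes {bs} {r} r<t missing z w =
      expand-vanishes (λ us p → expand-vanishes det-vanishes us p) (map monomial bs)
          (All.map⁺ (All.map relation missing))
      where
      -- This is ζ^(-r) with a natural exponent.
      q = ζ ^ (t ∸ r)

      Relation : (Carrier → Carrier) → Set ℓ
      Relation u = sumOver (upTo t) (λ k → q ^ k * u (ζ ^ k)) ≈ 0#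

      nonzero : ∀ {b} → b % t ≢ r → (t ∸ r ℕ.+ b) % t ≢ 0
      nonzero {b} b≢r eq = b≢r
          (≡.trans (≡.trans (≡.sym (ℕ.[m+n]%n≡m%n b t)) (≡.cong (_% t) shifted))
        (≡.trans (ℕ.%-distribˡ-+ (t ∸ r ℕ.+ b) r t) (≡.trans (≡.cong (λ m → (m ℕ.+ r % t) % t) eq)
          (≡.trans (ℕ.m%n%n≡m%n r t) (ℕ.m<n⇒m%n≡m r<t)))))
        where
        shifted : b ℕ.+ t ≡ t ∸ r ℕ.+ b ℕ.+ r
        shifted = ≡.trans (≡.cong (b ℕ.+_) (≡.sym (ℕ.m∸n+n≡m (ℕ.<⇒≤ r<t))))
          (≡.trans (≡.sym (ℕ.+-assoc b (t ∸ r) r)) (≡.cong (ℕ._+ r) (ℕ.+-comm b (t ∸ r))))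

      relation : ∀ {b} → b % t ≢ r → Relation (monomial b)
      relation {b} b≢r = trans (sum-cong (upTo t) (λ k → begin
        q ^ k * (ζ ^ k) ^ b   ≈⟨ *-congˡ
            (trans (^-assocʳ ζ k b) (trans (reflexive (≡.cong (ζ ^_) (ℕ.*-comm k b)))
                (sym (^-assocʳ ζ b k)))) ⟩
        q ^ k * (ζ ^ b) ^ k   ≈⟨ ^-distrib-* q (ζ ^ b) k ⟨
        (q * ζ ^ b) ^ k       ≈⟨ ^-congˡ k (sym (^-homo-* ζ (t ∸ r) b)) ⟩
        (ζ ^ (t ∸ r ℕ.+ b)) ^ k ∎)) (power-sum-vanishes (t ∸ r ℕ.+ b) (nonzero b≢r))

      det-vanishes : ∀ us → All Relation us → det roots us ≈ 0#
      det-vanishes us rel = go t (≡.refl {x = t})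
        where
        -- The relation is solved for the last row ζ^(t-1), the outermost one in `det`; its
        -- coefficient is a power of ζ, hence a unit.
        go : ∀ n → n ≡ t → det (map (ζ ^_) (upTo t)) us ≈ 0#
        go zero    ≡.refl = contradiction ≡.refl (ℕ.m<n⇒n≢0 r<t)
        go (suc n) 1+n≡t = begin
          det (map (ζ ^_) (upTo t)) us
            ≡⟨ ≡.cong (λ ks → det (map (ζ ^_) ks) us) upTo≡ ⟩
          det (map (ζ ^_) (upTo n ++ [ n ])) us
            ≡⟨ ≡.cong (λ xs → det xs us) (List.map-++ (ζ ^_) (upTo n) [ n ]) ⟩
          det (map (ζ ^_) (upTo n) ++ [ ζ ^ n ]) us
            ≡⟨ ≡.cong (λ F → F us) (List.foldl-++ (λ F x → expand (at x) F) empty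
                (map (ζ ^_) (upTo n)) [ ζ ^ n ]) ⟩
          expand (at (ζ ^ n)) (det (map (ζ ^_) (upTo n))) us
            ≈⟨ det-dependent (upTo n) (q ^_) (ζ ^_) (ζ ^ n) (unit-^ n (unit-^ (t ∸ r) ζ-unit)) (All.map (λ {u} rel-u → trans (regroup u) rel-u) rel) ⟩
          0# ∎
          where
          upTo≡ : upTo t ≡ upTo n ++ [ n ]
          upTo≡ = ≡.trans (≡.cong upTo (≡.sym 1+n≡t)) (≡.sym (List.upTo-∷ʳ n))
          regroup : ∀ u → q ^ n * u (ζ ^ n) + sumOver (upTo n) (λ k → q ^ k * u (ζ ^ k)) ≈
                          sumOver (upTo t) (λ k → q ^ k * u (ζ ^ k))
          regroup u = begin
            q ^ n * u (ζ ^ n) + S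
              ≈⟨ +-comm _ _ ⟩
            S + q ^ n * u (ζ ^ n)
              ≈⟨ +-congˡ (+-identityʳ _) ⟨
            S + (q ^ n * u (ζ ^ n) + 0#)
              ≈⟨ sum-++ (upTo n) [ n ] ⟨
            sumOver (upTo n ++ [ n ]) (λ k → q ^ k * u (ζ ^ k))
              ≡⟨ ≡.cong (λ ks → sumOver ks (λ k → q ^ k * u (ζ ^ k))) upTo≡ ⟨
            sumOver (upTo t) (λ k → q ^ k * u (ζ ^ k)) ∎
            where S = sumOver (upTo n) (λ k → q ^ k * u (ζ ^ k))

    inverse-power : ∀ {z w} → z * w ≈ 1# → ∀ n → z ^ n * w ^ n ≈ 1#
    inverse-power {z} {w} zw n = trans (sym (^-distrib-* z w n)) (trans (^-congˡ n zw) (1^n≈1 n))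

    -- Writing a₁ = a + d and b₁ = b + e avoids truncated subtraction; multiplying by z^a₁ z^b₁
    -- removes the powers of w.
    pairFactor-identity : ∀ {z w} → z * w ≈ 1# → ∀ a d b e →
      (z ^ (a ℕ.+ d) * z ^ (b ℕ.+ e)) * pairFactor (a ℕ.+ d) a (b ℕ.+ e) b z w ≈
      ((z ^ d - 1#) * (z ^ e - 1#)) * (z ^ (a ℕ.+ d ℕ.+ a) - z ^ (b ℕ.+ e ℕ.+ b))
    pairFactor-identity {z} {w} zw a d b e = begin
      (A * B) * ((Aw - w ^ a) * (B - Z b) - (A - Z a) * (Bw - w ^ b))
        ≈⟨ solve 8 (λ A B Aw aw b a Bw bw → (A :* B) :* ((Aw :- aw) :* (B :- b) :- (A :- a) :*
            (Bw :- bw)) :=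
                     (A :* Aw :- A :* aw) :* (B :* (B :- b)) :- (B :* Bw :- B :* bw) :*
                         (A :* (A :- a))) refl
             A B Aw (w ^ a) (Z b) (Z a) Bw (w ^ b) ⟩
      (A * Aw - A * w ^ a) * (B * (B - Z b)) - (B * Bw - B * w ^ b) * (A * (A - Z a))
        ≈⟨ +-cong (*-cong (+-cong (inverse-power zw (a ℕ.+ d)) (-‿cong (partial a d)))
            (*-congˡ (+-congʳ (^-homo-* z b e))))
                  (-‿cong (*-cong (+-cong (inverse-power zw (b ℕ.+ e)) (-‿cong (partial b e)))
                      (*-congˡ (+-congʳ (^-homo-* z a d))))) ⟩
      (1# - Z d) * (B * (Z b * Z e - Z b)) - (1# - Z e) * (A * (Z a * Z d - Z a))
        -- Factors 1 are inserted because the next identity treats 1 as a variable and must be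
        -- homogeneous in it.
        ≈⟨ +-cong (*-congˡ (*-congˡ (+-congˡ (-‿cong (sym (*-identityʳ _))))))
                  (-‿cong (*-congˡ (*-congˡ (+-congˡ (-‿cong (sym (*-identityʳ _))))))) ⟩
      (1# - Z d) * (B * (Z b * Z e - Z b * 1#)) - (1# - Z e) * (A * (Z a * Z d - Z a * 1#))
        ≈⟨ solve 7 (λ u d e A B a b → (u :- d) :* (B :* (b :* e :- b :* u)) :- (u :- e) :*
            (A :* (a :* d :- a :* u)) :=
                     ((d :- u) :* (e :- u)) :* (A :* a :- B :* b)) refl
             1# (Z d) (Z e) A B (Z a) (Z b) ⟩
      ((Z d - 1#) * (Z e - 1#)) * (A * Z a - B * Z b)
        ≈⟨ *-congˡ (+-cong (^-homo-* z (a ℕ.+ d) a) (-‿cong (^-homo-* z (b ℕ.+ e) b))) ⟨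
      ((Z d - 1#) * (Z e - 1#)) * (z ^ (a ℕ.+ d ℕ.+ a) - z ^ (b ℕ.+ e ℕ.+ b)) ∎
      where
      Z : ℕ → Carrier
      Z = z ^_
      A = z ^ (a ℕ.+ d)
      B = z ^ (b ℕ.+ e)
      Aw = w ^ (a ℕ.+ d)
      Bw = w ^ (b ℕ.+ e)
      partial : ∀ a d → z ^ (a ℕ.+ d) * w ^ a ≈ z ^ d
      partial a d = begin
        z ^ (a ℕ.+ d) * w ^ a       ≈⟨ *-congʳ (^-homo-* z a d) ⟩
        (z ^ a * z ^ d) * w ^ a     ≈⟨ solve 3 (λ p q r → (p :* q) :* r := (p :* r) :* q) refl
            (z ^ a) (z ^ d) (w ^ a) ⟩
        (z ^ a * w ^ a) * z ^ d     ≈⟨ *-congʳ (inverse-power zw a) ⟩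
        1# * z ^ d                  ≈⟨ *-identityˡ _ ⟩
        z ^ d                       ∎

    pairFactor-value : ∀ {z w} → z * w ≈ 1# → ∀ {a₁ a₂ b₁ b₂} → a₁ ℕ.> a₂ → b₁ ℕ.> b₂ →
      (z ^ a₁ * z ^ b₁) * pairFactor a₁ a₂ b₁ b₂ z w ≈
      ((z ^ (a₁ ∸ a₂) - 1#) * (z ^ (b₁ ∸ b₂) - 1#)) * (z ^ (a₁ ℕ.+ a₂) - z ^ (b₁ ℕ.+ b₂))
    pairFactor-value {z} {w} zw {a₁} {a₂} {b₁} {b₂} a₁>a₂ b₁>b₂ =
      ≡.subst₂ (λ a b → (z ^ a * z ^ b) * pairFactor a a₂ b b₂ z w ≈
                         ((z ^ (a₁ ∸ a₂) - 1#) * (z ^ (b₁ ∸ b₂) - 1#))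
                             * (z ^ (a ℕ.+ a₂) - z ^ (b ℕ.+ b₂)))
        (ℕ.m+[n∸m]≡n (ℕ.<⇒≤ a₁>a₂)) (ℕ.m+[n∸m]≡n (ℕ.<⇒≤ b₁>b₂))
        (pairFactor-identity zw a₂ (a₁ ∸ a₂) b₂ (b₁ ∸ b₂))

    integer-^ : ∀ n k → (n · 1#) ^ k ≈ (n ℕ.^ k) · 1#
    integer-^ n zero    = sym (+-identityʳ 1#)
    integer-^ n (suc k) = trans (*-congˡ (integer-^ n k)) (sym (×1-homo-* n (n ℕ.^ k)))

    module _ (m : ℕ) where
      private
        z = (2 ℕ.+ m) · 1#

      -- Powers of an integer base at least 2 increase strictly, so the difference is the image of a
      -- positive integer.
      increasing-powers : ∀ {a b} → a ℕ.< b → IsUnit (z ^ b - z ^ a)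
      increasing-powers {a} {b} a<b = unit-cong
        (+-cong (sym (integer-^ (2 ℕ.+ m) b)) (-‿cong (sym (integer-^ (2 ℕ.+ m) a))))
        (difference-unit integer-unit (ℕ.^-monoʳ-< (2 ℕ.+ m) (ℕ.s≤s (ℕ.s≤s ℕ.z≤n)) a<b))

      powers-apart : ∀ {a b} → a ≢ b → IsUnit (z ^ a - z ^ b)
      powers-apart {a} {b} a≢b with ℕ.<-cmp a b
      ... | tri< a<b _ _ = unit-flip (increasing-powers a<b)
      ... | tri≈ _ a≡b _ = contradiction a≡b a≢b
      ... | tri> _ _ b<a = increasing-powers b<a

      t≢0 : t ≢ 0
      t≢0 = ℕ.≢-nonZero⁻¹ t

      module _ {w : Carrier} (zw : z * w ≈ 1#) where

        private
          -- The difference y - x divides y^t - x^t, and x^t = 1.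
          root-apart : ∀ {x y} → x ^ t ≈ 1# → IsUnit (y ^ t - 1#) → IsUnit (y - x)
          root-apart {x} {y} x^t≈1 unit = unit-factor (unit-cong (sym (begin
            (y - x) * homogeneous y 0 t x ≈⟨ homogeneous-* y 0 t x ⟩
            y ^ t * 1# - x ^ t            ≈⟨ +-cong (*-identityʳ _) (-‿cong x^t≈1) ⟩
            y ^ t - 1#                    ∎)) unit)

          w^t-1-unit : IsUnit (w ^ t - 1#)
          w^t-1-unit = unit-factor (unit-cong (begin
            1# - z ^ t
              ≈⟨ +-cong (sym (inverse-power zw t)) (-‿cong (sym (*-identityʳ _))) ⟩
            z ^ t * w ^ t - z ^ t * 1#
              ≈⟨ solve 3 (λ p q e → p :* q :- p :* e := (q :- e) :* p) refl (z ^ t) (w ^ t) 1# ⟩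
            (w ^ t - 1#) * z ^ t ∎)
            (powers-apart (t≢0 ∘ ≡.sym)))

          w-z-unit : IsUnit (w - z)
          w-z-unit = unit-factor (unit-cong (begin
            1# - z ^ 2
              ≈⟨ +-cong (sym zw) (-‿cong (*-congˡ (*-identityʳ z))) ⟩
            z * w - z * z
              ≈⟨ solve 2 (λ z w → z :* w :- z :* z := (w :- z) :* z) refl z w ⟩
            (w - z) * z ∎)
            (powers-apart {0} {2} (λ ())))

        points-vandermonde-unit : IsUnit (vandermonde (roots ++ z ∷ w ∷ []))
        points-vandermonde-unit = vandermonde-unit (AllPairs.++⁺ roots-distinct
            ((w-z-unit ∷ []) ∷ [] ∷ [])
          (All.map (λ x^t≈1 → root-apart x^t≈1 (powers-apart t≢0) ∷ root-apart x^t≈1 w^t-1-unit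
              ∷ []) roots-^t))

    evaluationPoint : Carrier → Carrier → Vector Carrier (t ℕ.+ 2)
    evaluationPoint = extend (λ k → ζ ^ toℕ k)

    tabulate-evaluationPoint : ∀ z w → List.tabulate (evaluationPoint z w) ≡ roots ++ z ∷ w ∷ []
    tabulate-evaluationPoint z w = ≡.trans (tabulate-++ {m = t} (λ k → ζ ^ toℕ k) _)
      (≡.cong (_++ z ∷ w ∷ []) (≡.trans (tabulate-toℕ t (ζ ^_)) (≡.sym (List.map-upTo (ζ ^_) t))))

    module _ (lam : Vector ℕ (t ℕ.+ 2)) (partition : IsPartition lam) where

      Vanishes : Set (c ⊔ ℓ)
      Vanishes = ∀ z w → z * w ≈ 1# → schur R lam (evaluationPoint z w) ≈ 0#

      private
        alternant-schur : ∀ z w →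
          alternant z w (beta lam) ≈ vandermonde (roots ++ z ∷ w ∷ []) * schur R lam
              (evaluationPoint z w)
        alternant-schur z w = begin
          alternant z w (beta lam)
            ≡⟨ ≡.cong (λ F → F (map monomial (beta lam))) (List.foldl-++ (λ F x → expand (at x) F)
                empty roots (z ∷ w ∷ [])) ⟨
          det (roots ++ z ∷ w ∷ []) (map monomial (beta lam))
            ≡⟨ ≡.cong₂ (λ xs bs → det xs (map monomial bs)) (≡.sym (tabulate-evaluationPoint z w))
                (beta-toList lam) ⟩
          det (List.tabulate (evaluationPoint z w)) (map monomial (betaList (Vector.toList lam)))
            ≈⟨ bialternant _ (evaluationPoint z w) (Vector.toList lam) (List.length-tabulate lam)
                (partition-linked partition) ⟩
          vandermonde (List.tabulate (evaluationPoint z w)) * schurSum _ (evaluationPoint z w)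
              (Vector.toList lam)
            ≈⟨ *-cong (reflexive (≡.cong vandermonde (tabulate-evaluationPoint z w)))
                (sym (schurSum-schur (evaluationPoint z w) lam)) ⟩
          vandermonde (roots ++ z ∷ w ∷ []) * schur R lam (evaluationPoint z w) ∎

        alternant-pairs : ∀ {a₁ a₂ b₁ b₂} (ps : PairStructure (beta lam) a₁ a₂ b₁ b₂) → ∀ z w →
          alternant z w (beta lam) ≈± pairFactor a₁ a₂ b₁ b₂ z w * det roots
              (map monomial (PairStructure.rest ps))
        alternant-pairs ps = det-split t split (congruent-vanishes a-congruent)
            (congruent-vanishes b-congruent)
          where open PairStructure ps

      -- The Vandermonde determinant is invertible at z = 2, 3, …, and a Laurent
      -- polynomial vanishing there is zero.
      vanishes-from-alternant : (∀ z w → z * w ≈ 1# → alternant z w (beta lam) ≈ 0#) → Vanishes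
      vanishes-from-alternant alternant≈0 z w zw = trans (schurSum-schur (evaluationPoint z w) lam)
        (laurent-vanishes integer-unit
          {λ z w → schurSum (t ℕ.+ 2) (evaluationPoint z w) (Vector.toList lam)}
          (laurent-schurSum (λ k → ζ ^ toℕ k) (Vector.toList lam))
          (λ m w zw → trans (sym (schurSum-schur (evaluationPoint _ w) lam))
              (unit-cancel (points-vandermonde-unit m zw)
            (trans (sym (alternant-schur _ w)) (alternant≈0 _ w zw)))) z w zw)

      missing-class⇒vanishes : ∀ {r} → residueClass t lam r ≡ [] → Vanishes
      missing-class⇒vanishes {r} eq = vanishes-from-alternant (λ z w _ →
        missing-class-vanishes (Fin.toℕ<n r) (All.tabulate missing) z w)
        where
        missing : ∀ {b} → b ∈ beta lam → b % t ≢ toℕ r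
        missing b∈ b∈r with () ← ≡.subst (_ ∈_) eq (∈.∈-filter⁺ (λ b → b % t ℕ.≟ toℕ r) b∈ b∈r)

      equal-sums⇒vanishes : ∀ {a₁ a₂ b₁ b₂} → Pairs t lam a₁ a₂ b₁ b₂ → a₁ ℕ.+ a₂ ≡ b₁ ℕ.+ b₂ →
          Vanishes
      equal-sums⇒vanishes {a₁} {a₂} {b₁} {b₂} pairs sums = vanishes-from-alternant (λ z w zw →
        ≈±-zero (alternant-pairs ps z w) (trans (*-congʳ (unit-cancel
          (unit-* (unit-^ a₁ (w , zw)) (unit-^ b₁ (w , zw)))
          (trans (pairFactor-value zw a₁>a₂ b₁>b₂)
            (trans (*-congˡ (trans (+-congʳ (reflexive (≡.cong (z ^_) sums))) (-‿inverseʳ _)))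
                (zeroʳ _))))) (zeroˡ _)))
        where
        ps = pairStructure lam (beta-linked partition) pairs
        open PairStructure ps

      -- One point suffices: at z = 2 the alternant is a unit, while the assumed vanishing makes it
      -- zero.
      distinct-sums⇒unit : ∀ {a₁ a₂ b₁ b₂} → Pairs t lam a₁ a₂ b₁ b₂ → a₁ ℕ.+ a₂ ≢ b₁ ℕ.+ b₂ →
          Vanishes → IsUnit 0#
      distinct-sums⇒unit {a₁} {a₂} {b₁} {b₂} pairs sums vanishes with w , zw ← integer-unit 1 =
        unit-cong (trans (alternant-schur z w) (trans (*-congˡ (vanishes z w zw)) (zeroʳ _)))
          (≈±-unit (alternant-pairs ps z w) (unit-* pairFactor-unit (det-roots-unit once)))
        where
        z = 2 · 1#
        ps = pairStructure lam (beta-linked partition) pairs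
        open PairStructure ps
        power-1-unit : ∀ {a b} → a ℕ.> b → IsUnit (z ^ (a ∸ b) - 1#)
        power-1-unit a>b = powers-apart 0 {b = 0} (ℕ.m>n⇒m∸n≢0 a>b)
        pairFactor-unit : IsUnit (pairFactor a₁ a₂ b₁ b₂ z w)
        pairFactor-unit = unit-factor (unit-cong
          (trans (sym (pairFactor-value zw a₁>a₂ b₁>b₂)) (*-comm _ _))
          (unit-* (unit-* (power-1-unit a₁>a₂) (power-1-unit b₁>b₂)) (powers-apart 0 sums)))

-- The vanishing criterion over a Heyting field

open import Data.Nat.Base using (_+_; _≤_)

corollary3p2 :
  ∀ {c ℓ₁ ℓ₂} (K : HeytingField c ℓ₁ ℓ₂) → CharacteristicZero K →
  (t : ℕ) .{{_ : NonZero t}} → 2 ≤ t →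
  (ζ : HeytingField.Carrier K) → IsPrimitiveRoot K t ζ →
  (lam : Vector ℕ (t + 2)) → IsPartition lam →
  ( VanishesIdentically K t ζ lam
    ⇔
    ( (∃[ r ] residueClass t lam r ≡ [])
      ⊎
      ( (∀ r → residueClass t lam r ≢ []) ×
        (∃[ a₁ ] ∃[ a₂ ] ∃[ b₁ ] ∃[ b₂ ]
           (Pairs t lam a₁ a₂ b₁ b₂ × a₁ + a₂ ≡ b₁ + b₂)) ) ) )
  ×
  ( (∃[ r ] OneTriple t lam r) → ¬ VanishesIdentically K t ζ lam )
corollary3p2 K characteristic t 2≤t ζ root lam partition = mk⇔ necessary sufficient , triple
  where
  open HeytingField K using (_≈_; _#_; 0#; 1#; #⇒invertible; tight; trans; sym) renaming
      (_-_ to _-ᴷ_)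
  R = HeytingCommutativeRing.commutativeRing (HeytingField.heytingCommutativeRing K)
  open RingProperties (CommutativeRing.ring R) using (-0#≈0#)
  open Units R using (IsUnit; unit-cong)
  open IsPrimitiveRoot root

  -- Through this, characteristic zero and the primitivity of ζ become the unit hypotheses over the
  -- underlying ring.
  apart-unit : ∀ {x y} → x # y → IsUnit (x -ᴷ y)
  apart-unit x#y with u , _ , xu ← #⇒invertible x#y = u , xu

  integer-unit : ∀ m → IsUnit _
  integer-unit m = unit-cong (trans (CommutativeRing.+-congˡ R -0#≈0#)
      (CommutativeRing.+-identityʳ R _))
    (apart-unit (characteristic m))

  open Residues t
  open RootsOfUnity R using (module PrimitiveRoot)
  open PrimitiveRoot integer-unit t ζ ζ^t≈1 (λ k 0<k k<t → apart-unit (ζ^k#1 k 0<k k<t))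

  zero-not-unit : ¬ IsUnit 0#
  zero-not-unit (u , 0u) = proj₂ (tight _ 0#)
    (trans (CommutativeRing.+-identityʳ R 1#) (trans (sym 0u) (CommutativeRing.zeroˡ R u)))
        (characteristic 0)

  distinct-sums : ∀ {a₁ a₂ b₁ b₂} → Pairs t lam a₁ a₂ b₁ b₂ → a₁ + a₂ ≢ b₁ + b₂ →
      ¬ VanishesIdentically K t ζ lam
  distinct-sums pairs sums vanishes = zero-not-unit (distinct-sums⇒unit lam partition pairs sums
      vanishes)

  Criterion : Set
  Criterion =
    (∃[ r ] residueClass t lam r ≡ []) ⊎
    ((∀ r → residueClass t lam r ≢ []) ×
     (∃[ a₁ ] ∃[ a₂ ] ∃[ b₁ ] ∃[ b₂ ] (Pairs t lam a₁ a₂ b₁ b₂ × a₁ + a₂ ≡ b₁ + b₂)))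

  necessary : VanishesIdentically K t ζ lam → Criterion
  -- Emptiness of a class, and later equality of the two sums, are decidable although equality in
  -- `K` is not.
  necessary vanishes with Fin.any? (λ r → length (residueClass t lam r) ℕ.≟ 0)
  ... | yes (r , empty) = inj₁ (r , length≡0 empty)
    where
    length≡0 : ∀ {xs : List ℕ} → length xs ≡ 0 → xs ≡ []
    length≡0 {[]} _ = ≡.refl
  ... | no nonempty = inj₂ (nonempty′ , sums (nonempty-pairs lam nonempty′))
    where
    nonempty′ : ∀ r → residueClass t lam r ≢ []
    nonempty′ r eq = nonempty (r , ≡.cong length eq)
    sums : (∃[ a₁ ] ∃[ a₂ ] ∃[ b₁ ] ∃[ b₂ ] Pairs t lam a₁ a₂ b₁ b₂) →
           ∃[ a₁ ] ∃[ a₂ ] ∃[ b₁ ] ∃[ b₂ ] (Pairs t lam a₁ a₂ b₁ b₂ × a₁ + a₂ ≡ b₁ + b₂)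
    sums (a₁ , a₂ , b₁ , b₂ , pairs) with a₁ + a₂ ℕ.≟ b₁ + b₂
    ... | yes eq = a₁ , a₂ , b₁ , b₂ , pairs , eq
    ... | no neq = contradiction vanishes (distinct-sums pairs neq)

  sufficient : Criterion → VanishesIdentically K t ζ lam
  sufficient (inj₁ (r , empty)) = missing-class⇒vanishes lam partition empty
  sufficient (inj₂ (_ , a₁ , a₂ , b₁ , b₂ , pairs , eq)) = equal-sums⇒vanishes lam partition pairs
      eq

  triple : (∃[ r ] OneTriple t lam r) → ¬ VanishesIdentically K t ζ lam
  triple (r , one) with p , q , s , pairs ← triple-pairs {lam = lam} {r} one =
    let open PairStructure (pairStructure lam (beta-linked partition) pairs) in
    -- Equal sums p + q = q + s would force p = s, against p > q > s.
    distinct-sums pairs (λ eq → ℕ.<⇒≢ (ℕ.<-trans b₁>b₂ a₁>a₂)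
      (ℕ.+-cancelʳ-≡ q s p (≡.trans (ℕ.+-comm s q) (≡.sym eq))))
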